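{- For $k\ge i\ge1$, \[ \sum_{m,n\ge0}O_{k,i}(m,n)x^mq^n=\sum_{N_1\ge\cdots\ge N_{k-1}\ge0}\frac{(-q^{2-2N_1};q^2)_{N_1-1}(-q^{1-2N_1};q^2)_{N_1}\,q^{2(N_1^2+\cdots+N_{k-1}^2+N_{i+1}+\cdots+N_{k-1})}(1+q^{2N_i})\,x^{N_1+\cdots+N_{k-1}}}{(q^2;q^2)_{N_1-N_2}\cdots(q^2;q^2)_{N_{k-2}-N_{k-1}}(q^2;q^2)_{N_{k-1}}}. \]
   Context: An overpartition of $n$ is a partition of $n$ in which the first occurrence of each part size may be overlined. For $t\ge1$, $f_t(\lambda)$ (resp. $f_{\overline t}(\lambda)$) is the number of non-overlined (resp. overlined) parts equal to $t$; $f_0=f_{\overline0}=0$. For $k\ge i\ge1$, $O_{k,i}(m,n)$ is the number of overpartitions $\lambda$ of $n$ with exactly $m$ parts such that (1) $f_{\overline1}(\lambda)+f_2(\lambda)\le i-1$; (2) $f_{\overline{2t}}(\lambda)+f_{2t}(\lambda)+f_{\overline{2t+1}}(\lambda)+f_{2t+2}(\lambda)\le k-1$ for every $t\ge0$; (3) for every $t\ge0$, if $f_{2t+1}(\lambda)\ge1$ then $f_{2t+2}(\lambda)\le k-2$. Notation: $(a;q)_\infty=\prod_{j\ge0}(1-aq^j)$, $(a;q)_n=(a;q)_\infty/(aq^n;q)_\infty$ for every integer $n$. The sum is over integer tuples $N_1\ge\cdots\ge N_{k-1}\ge0$; empty sums are $0$; when $i=k$, $N_k=0$. -}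

module Defs where

open import Data.Bool using (Bool; true; false; if_then_else_)
open import Data.Nat as ℕ using (ℕ; zero; suc; _∸_; _⊓_)
open import Data.Nat.DivMod using (_%_; _/_)
open import Data.Integer as ℤ using (ℤ; +_; -[1+_]; ∣_∣)
open import Data.Rational as ℚ using (ℚ; 0ℚ; 1ℚ; ≢-nonZero)
open import Data.Rational.Properties using () renaming (_≟_ to _≟ℚ_)
open import Data.List using (List; []; _∷_; _++_; map; concatMap; foldr; length; filter; upTo)
open import Data.Nat.ListAction using (sum)
open import Data.Product using (_×_; _,_; proj₁; proj₂)
open import Relation.Nullary using (yes; no; does)
open import Relation.Nullary.Decidable using (⌊_⌋)

-- An overpartition is encoded by its frequencies: the j-th entry
-- (j = 0,1,2,..) of the list is (f_{j+1}, b_{j+1}) where f_{j+1} is the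
-- number of non-overlined parts equal to j+1 and b_{j+1} says whether
-- (the first occurrence of) j+1 is overlined, i.e. f_{bar(j+1)} ∈ {0,1}.
Overpartition : Set
Overpartition = List (ℕ × Bool)

bit : Bool → ℕ
bit true  = 1
bit false = 0

private
  entry : Overpartition → ℕ → ℕ × Bool
  entry []       _       = 0 , false
  entry (x ∷ xs) zero    = x
  entry (x ∷ xs) (suc j) = entry xs j

fNon : Overpartition → ℕ → ℕ
fNon ov zero    = 0
fNon ov (suc t) = proj₁ (entry ov t)

fOv : Overpartition → ℕ → ℕ
fOv ov zero    = 0
fOv ov (suc t) = bit (proj₂ (entry ov t))

numParts : Overpartition → ℕ
numParts = foldr (λ { (f , b) r → f ℕ.+ bit b ℕ.+ r }) 0

private
  weightFrom : ℕ → Overpartition → ℕ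
  weightFrom s []             = 0
  weightFrom s ((f , b) ∷ xs) = (f ℕ.+ bit b) ℕ.* suc s ℕ.+ weightFrom (suc s) xs

weight : Overpartition → ℕ
weight = weightFrom 0

genOP : ℕ → ℕ → List Overpartition
genOP zero    zero    = [] ∷ []
genOP zero    (suc n) = []
genOP (suc s) n =
  concatMap
    (λ c → map (λ l → l ++ (c ∷ [])) (genOP s (n ∸ (proj₁ c ℕ.+ bit (proj₂ c)) ℕ.* suc s)))
    (filter (λ c → (proj₁ c ℕ.+ bit (proj₂ c)) ℕ.* suc s ℕ.≤? n)
      (concatMap (λ f → (f , false) ∷ (f , true) ∷ []) (upTo (suc n))))

-- all overpartitions of n (every part is ≤ n), each exactly once
overpartitions : ℕ → List Overpartition
overpartitions n = genOP n n

-- the conditions (1),(2),(3); the conditions for t are checked for all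
-- t ≤ length λ, beyond which every frequency involved is 0 (and then
-- (2),(3) hold trivially since k ≥ 1).
allUpTo : ℕ → (ℕ → Bool) → Bool
allUpTo zero    P = P 0
allUpTo (suc n) P = if P (suc n) then allUpTo n P else false

cond1 : ℕ → Overpartition → Bool
cond1 i ov = ⌊ fOv ov 1 ℕ.+ fNon ov 2 ℕ.+ 1 ℕ.≤? i ⌋

cond2 : ℕ → Overpartition → Bool
cond2 k ov = allUpTo (length ov) (λ t →
  ⌊ fOv ov (2 ℕ.* t) ℕ.+ fNon ov (2 ℕ.* t) ℕ.+ fOv ov (2 ℕ.* t ℕ.+ 1)
      ℕ.+ fNon ov (2 ℕ.* t ℕ.+ 2) ℕ.+ 1 ℕ.≤? k ⌋)

cond3 : ℕ → Overpartition → Bool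
cond3 k ov = allUpTo (length ov) (λ t →
  if ⌊ 1 ℕ.≤? fNon ov (2 ℕ.* t ℕ.+ 1) ⌋
  then ⌊ fNon ov (2 ℕ.* t ℕ.+ 2) ℕ.+ 2 ℕ.≤? k ⌋
  else true)

isCounted : ℕ → ℕ → ℕ → Overpartition → Bool
isCounted k i m ov =
  if ⌊ numParts ov ℕ.≟ m ⌋ then
    (if cond1 i ov then (if cond2 k ov then cond3 k ov else false) else false)
  else false

O : ℕ → ℕ → ℕ → ℕ → ℕ
O k i m n = length (filter (λ ov → isCounted k i m ov Data.Bool.≟ true) (overpartitions n))
  where import Data.Bool

-- Σ_{j ≥ 0} co j · q^(val + j)
record LSeries : Set where
  constructor ls
  field
    val : ℤ
    co  : ℕ → ℚ
open LSeries public

coeff : LSeries → ℤ → ℚ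
coeff s e with e ℤ.- val s
... | + j      = co s j
... | -[1+ _ ] = 0ℚ

sumTo : ℕ → (ℕ → ℚ) → ℚ
sumTo zero    g = 0ℚ
sumTo (suc n) g = sumTo n g ℚ.+ g n

_⊕_ : LSeries → LSeries → LSeries
s ⊕ t = ls v (λ j → coeff s (v ℤ.+ + j) ℚ.+ coeff t (v ℤ.+ + j))
  where v = val s ℤ.⊓ val t

_⊗_ : LSeries → LSeries → LSeries
s ⊗ t = ls (val s ℤ.+ val t) (λ n → sumTo (suc n) (λ j → co s j ℚ.* co t (n ∸ j)))

mono : ℚ → ℤ → LSeries
mono c e = ls e (λ { zero → c ; (suc _) → 0ℚ })

oneS : LSeries
oneS = mono 1ℚ (+ 0)

prodL : List LSeries → LSeries
prodL = foldr _⊗_ oneS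

powℚ : ℚ → ℕ → ℚ
powℚ c zero    = 1ℚ
powℚ c (suc n) = c ℚ.* powℚ c n

-- Σ_{t ≥ 0} c^t q^(d t),  d ≥ 1 (given as suc p)
geom : ℚ → ℕ → LSeries
geom c p = ls (+ 0) (λ j → if ⌊ j % suc p ℕ.≟ 0 ⌋ then powℚ c (j / suc p) else 0ℚ)

bin : ℚ → ℤ → LSeries
bin c e = oneS ⊕ mono (ℚ.- c) e

-- the reciprocal 1/(1 - c q^e) (as a Laurent series); it is only
-- undefined for (c = 1, e = 0), where 0 is returned (never used below).
invBin : ℚ → ℤ → LSeries
invBin c (+ suc p)  = geom c p
invBin c (+ zero) with (1ℚ ℚ.- c) ≟ℚ 0ℚ
... | yes _ = ls (+ 0) (λ _ → 0ℚ)
... | no ne = mono (ℚ.1/_ (1ℚ ℚ.- c) {{≢-nonZero ne}}) (+ 0)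
invBin c -[1+ p ] with c ≟ℚ 0ℚ
... | yes _ = oneS
... | no ne =
  -- 1 - c q^e = -c q^e (1 - c⁻¹ q^(-e))
  mono (ℚ.- ci) (+ suc p) ⊗ geom ci p
  where ci = ℚ.1/_ c {{≢-nonZero ne}}

-- q-Pochhammer (a;q^d)_n with a = c q^e and n ∈ ℤ, following
-- (a;q)_n = (a;q)_∞ / (a q^n;q)_∞ :
--   n ≥ 0 : Π_{j=0}^{n-1} (1 - a q^{dj})
--   n < 0 : Π_{j=1}^{-n} 1/(1 - a q^{-dj})
poch : ℚ → ℤ → ℕ → ℤ → LSeries
poch c e d (+ n)    = prodL (map (λ j → bin c (e ℤ.+ + (d ℕ.* j))) (upTo n))
poch c e d -[1+ n ] = prodL (map (λ j → invBin c (e ℤ.- + (d ℕ.* suc j))) (upTo (suc n)))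

recipPoch : ℚ → ℤ → ℕ → ℕ → LSeries
recipPoch c e d n = prodL (map (λ j → invBin c (e ℤ.+ + (d ℕ.* j))) (upTo n))

decTuples : ℕ → ℕ → ℕ → List (List ℕ)
decTuples zero    mx zero    = [] ∷ []
decTuples zero    mx (suc s) = []
decTuples (suc l) mx s =
  concatMap (λ a → map (a ∷_) (decTuples l a (s ∸ a))) (upTo (suc (mx ⊓ s)))

-- N_j for j ≥ 1 from the list (N_1,...,N_{k-1}); N_j = 0 for j ≥ k
Nat : List ℕ → ℕ → ℕ
Nat []       _             = 0
Nat (x ∷ xs) zero          = 0
Nat (x ∷ xs) (suc zero)    = x
Nat (x ∷ xs) (suc (suc j)) = Nat xs (suc j)

sumℕ : ℕ → ℕ → (ℕ → ℕ) → ℕ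
sumℕ a b g = sum (map (λ j → g (a ℕ.+ j)) (upTo (suc b ∸ a)))

q^ : ℤ → LSeries
q^ e = mono 1ℚ e

-ℚ1 : ℚ
-ℚ1 = ℚ.- 1ℚ

-- the summand for (N_1,...,N_{k-1}) (without the factor x^{N_1+...+N_{k-1}})
summand : ℕ → ℕ → List ℕ → LSeries
summand k i N =
  poch -ℚ1 (+ 2 ℤ.- + (2 ℕ.* N1)) 2 (+ N1 ℤ.- + 1)
  ⊗ (poch -ℚ1 (+ 1 ℤ.- + (2 ℕ.* N1)) 2 (+ N1)
  ⊗ (q^ (+ (2 ℕ.* (sumℕ 1 (k ∸ 1) (λ j → Nat N j ℕ.* Nat N j)
                  ℕ.+ sumℕ (suc i) (k ∸ 1) (Nat N))))
  ⊗ ((oneS ⊕ q^ (+ (2 ℕ.* Nat N i)))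
  ⊗ prodL (map (λ j → recipPoch 1ℚ (+ 2) 2 (Nat N (suc j) ∸ Nat N (suc (suc j))))
               (upTo (k ∸ 1))))))
  where N1 = Nat N 1

rhsCoeff : ℕ → ℕ → ℕ → ℕ → ℚ
rhsCoeff k i m n =
  foldr ℚ._+_ 0ℚ (map (λ N → coeff (summand k i N) (+ n)) (decTuples (k ∸ 1) m m))

{-# OPTIONS --safe #-}
-- Write s = q and Q = q². For fixed N_1 = M the inner multisum is obtained from the
-- unit sequence u = (1, 0, 0, ...) by iterating
--   (D_z f)_M = Σ_N z^N Q^{N²} f_N / (Q;Q)_{M-N},
-- with z = x for the first indices and z = xQ for the remaining ones. The Bailey
-- kernels b_r are eigenvectors of D_x and the c_r (those of xQ) of D_{xQ}; u is
-- expanded in the c_r, and each c_r in b_r and b_{r+1}. The remaining sum over N_1 is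
-- a linear functional L that kills ∂f = Sf - xs(1+E)(1+sE)f, where S is the shift and
-- (Ef)_M = Q^M f_M. Modulo ∂ all b_r and b_{r+1} are multiples of E c_r, and comparing
-- coefficients gives the recurrences that express (1 - xq) G_i(x) through the
-- G_j(xQ). Removing the parts 1 and 2 of an overpartition and subtracting 2 from the
-- others yields the same recurrences for the generating function of O_{k,i}, and they
-- determine all coefficients since x ↦ xQ raises the exponent of q in every term of
-- positive degree in x.

module Submission where

open import Defs
open import Level using (0ℓ)
open import Algebra.Bundles using (CommutativeRing)
open import Algebra.Structures using (IsCommutativeRing)
open import Data.Bool as Bool using (Bool; true; false; if_then_else_; _∧_)
open import Data.Bool.Properties using (⇔→≡)
open import Data.Empty using (⊥-elim)
open import Data.Integer as ℤ using (ℤ; +_; -[1+_]; _⊖_)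
import Data.Integer.Properties as ℤₚ
open import Data.List using (List; []; _∷_; _++_; map; concatMap; foldr; filter; length; applyUpTo; upTo)
open import Data.Maybe using (Maybe; just; nothing)
open import Data.Nat as ℕ using (ℕ; zero; suc; _∸_; _⊓_; _≤_; _≤?_; z≤n; s≤s)
open import Data.Nat.DivMod using (_%_; m<n⇒m%n≡m; [m+n]%n≡m%n)
open import Data.Nat.ListAction using (sum)
import Data.Nat.Properties as ℕₚ
open import Data.Product using (∃; _×_; _,_; proj₁; proj₂)
open import Data.Rational as ℚ using (ℚ; 0ℚ; 1ℚ; ½; _/_)
import Data.Rational.Properties as ℚₚ
import Data.Rational.Unnormalised as ℚᵘ
import Data.Rational.Unnormalised.Properties as ℚᵘₚ
open import Function using (_∘_; id; mk⇔)
open import Relation.Binary.PropositionalEquality as ≡ using (_≡_)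
open import Relation.Nullary using (Dec; yes; no; ¬_)
open import Relation.Nullary.Decidable using (⌊_⌋)
open import Relation.Unary using (Decidable)

-- A ring solver with integer coefficients

-- Where `∂` comes from: for N_1 = M the two Pochhammer symbols start at q^(-M(M-1)) and q^(-M²),
-- which leaves q^M of the factor q^(2M²). The ratio of consecutive weights is therefore
-- s(1+Q^M)(1+sQ^M), the multiplier in `∂`; at M = 0 the symbol of index -1 is 1/2. Since Q = s²,
-- the E²-terms of Q^r ∂c_r cancel, so it lies in the span of c_r and E c_r, together with b_r and
-- Q^r b_{r+1}. Its c_r-coefficient is Q^r(1 - xs), whence the factor 1 - xs in the recurrences; for
-- overpartitions the same factor clears the geometric series of the non-overlined parts 1. Two
-- obstacles shape the statements. Q is not invertible, so identities are multiplied by Q^r, and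
-- only combinations whose coefficients visibly contain Q^r are reduced; this factor normally comes
-- from an eigenvalue of D_{xQ}, and for i = k, where no such operator acts, from E u = u. Infinite
-- sums are avoided: b_r and c_r vanish at M < r, so every expansion is an exact finite sum once its
-- cutoff exceeds M, and overpartitions are summed over finite boxes of frequencies, whose error has
-- high order in q.

module RingSolver (R : CommutativeRing 0ℓ 0ℓ) where
  open CommutativeRing R
  open import Algebra.Properties.Ring ring
    using (-‿distribˡ-*; -‿distribʳ-*; -0#≈0#; -‿involutive)
  open import Algebra.Properties.AbelianGroup +-abelianGroup using (⁻¹-∙-comm)
  open import Algebra.Properties.Semiring.Mult.TCOptimised semiring
    using (×-homo-+; ×1-homo-*; 1+×) renaming (_×_ to _×ᴹ_)
  open import Relation.Binary.Reasoning.Setoid setoid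

  fromℤ : ℤ → Carrier
  fromℤ (+ n)    = n ×ᴹ 1#
  fromℤ -[1+ n ] = - (suc n ×ᴹ 1#)

  private
    cancel : ∀ a b c → (a + b) - (a + c) ≈ b - c
    cancel a b c = begin
      (a + b) - (a + c)         ≈⟨ +-cong (+-comm a b) (sym (⁻¹-∙-comm a c)) ⟩
      (b + a) + (- a + - c)     ≈⟨ +-assoc b a _ ⟩
      b + (a + (- a + - c))     ≈⟨ +-congˡ (sym (+-assoc a _ _)) ⟩
      b + ((a - a) + - c)       ≈⟨ +-congˡ (+-congʳ (-‿inverseʳ a)) ⟩
      b + (0# + - c)            ≈⟨ +-congˡ (+-identityˡ _) ⟩
      b - c                     ∎

    -0+ : ∀ a → a - 0# ≈ a
    -0+ a = trans (+-congˡ -0#≈0#) (+-identityʳ a)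

    fromℤ-⊖ : ∀ m n → fromℤ (m ⊖ n) ≈ (m ×ᴹ 1#) - (n ×ᴹ 1#)
    fromℤ-⊖ m       zero    = sym (-0+ _)
    fromℤ-⊖ zero    (suc n) = sym (+-identityˡ _)
    fromℤ-⊖ (suc m) (suc n) = begin
      fromℤ (suc m ⊖ suc n)                    ≡⟨ ≡.cong fromℤ (ℤₚ.[1+m]⊖[1+n]≡m⊖n m n) ⟩
      fromℤ (m ⊖ n)                            ≈⟨ fromℤ-⊖ m n ⟩
      (m ×ᴹ 1#) - (n ×ᴹ 1#)                    ≈⟨ cancel 1# _ _ ⟨
      (1# + (m ×ᴹ 1#)) - (1# + (n ×ᴹ 1#))      ≈⟨ +-cong (1+× m 1#) (-‿cong (1+× n 1#)) ⟨
      (suc m ×ᴹ 1#) - (suc n ×ᴹ 1#)            ∎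

    fromℤ-neg : ∀ i → fromℤ (ℤ.- i) ≈ - fromℤ i
    fromℤ-neg (+ zero)  = sym -0#≈0#
    fromℤ-neg (+ suc n) = refl
    fromℤ-neg -[1+ n ]  = sym (-‿involutive _)

    fromℤ-+ : ∀ i j → fromℤ (i ℤ.+ j) ≈ fromℤ i + fromℤ j
    fromℤ-+ (+ m)    (+ n)    = ×-homo-+ 1# m n
    fromℤ-+ (+ m)    -[1+ n ] = fromℤ-⊖ m (suc n)
    fromℤ-+ -[1+ m ] (+ n)    = trans (fromℤ-⊖ n (suc m)) (+-comm _ _)
    fromℤ-+ -[1+ m ] -[1+ n ] = begin
      - (suc (suc (m ℕ.+ n)) ×ᴹ 1#)            ≡⟨ ≡.cong (λ z → - (suc z ×ᴹ 1#)) (≡.sym (+-suc m n)) ⟩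
      - ((suc m ℕ.+ suc n) ×ᴹ 1#)              ≈⟨ -‿cong (×-homo-+ 1# (suc m) (suc n)) ⟩
      - ((suc m ×ᴹ 1#) + (suc n ×ᴹ 1#))        ≈⟨ ⁻¹-∙-comm _ _ ⟨
      - (suc m ×ᴹ 1#) - (suc n ×ᴹ 1#)          ∎
      where open import Data.Nat.Properties using (+-suc)

    fromℤ-*⁺ : ∀ m j → fromℤ (+ m ℤ.* j) ≈ (m ×ᴹ 1#) * fromℤ j
    fromℤ-*⁺ m (+ n) = trans (reflexive (≡.cong fromℤ (≡.sym (ℤₚ.pos-* m n)))) (×1-homo-* m n)
    fromℤ-*⁺ m -[1+ n ] = begin
      fromℤ (+ m ℤ.* (ℤ.- (+ suc n)))      ≡⟨ ≡.cong fromℤ (≡.sym (ℤₚ.neg-distribʳ-* (+ m) (+ suc n))) ⟩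
      fromℤ (ℤ.- (+ m ℤ.* + suc n))        ≈⟨ fromℤ-neg (+ m ℤ.* + suc n) ⟩
      - fromℤ (+ m ℤ.* + suc n)            ≈⟨ -‿cong (fromℤ-*⁺ m (+ suc n)) ⟩
      - ((m ×ᴹ 1#) * (suc n ×ᴹ 1#))        ≈⟨ -‿distribʳ-* _ _ ⟩
      (m ×ᴹ 1#) * - (suc n ×ᴹ 1#)          ∎

    fromℤ-* : ∀ i j → fromℤ (i ℤ.* j) ≈ fromℤ i * fromℤ j
    fromℤ-* (+ m) j = fromℤ-*⁺ m j
    fromℤ-* -[1+ m ] j = begin
      fromℤ ((ℤ.- (+ suc m)) ℤ.* j)     ≡⟨ ≡.cong fromℤ (≡.sym (ℤₚ.neg-distribˡ-* (+ suc m) j)) ⟩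
      fromℤ (ℤ.- (+ suc m ℤ.* j))       ≈⟨ fromℤ-neg (+ suc m ℤ.* j) ⟩
      - fromℤ (+ suc m ℤ.* j)           ≈⟨ -‿cong (fromℤ-*⁺ (suc m) j) ⟩
      - ((suc m ×ᴹ 1#) * fromℤ j)       ≈⟨ -‿distribˡ-* _ _ ⟩
      - (suc m ×ᴹ 1#) * fromℤ j         ∎

  open import Algebra.Solver.Ring.AlmostCommutativeRing
    using (fromCommutativeRing; _-Raw-AlmostCommutative⟶_)

  private
    morphism : ℤ.+-*-rawRing -Raw-AlmostCommutative⟶ fromCommutativeRing R
    morphism = record
      { ⟦_⟧ = fromℤ ; +-homo = fromℤ-+ ; *-homo = fromℤ-* ; -‿homo = fromℤ-neg
      ; 0-homo = refl ; 1-homo = refl }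

    _≟ᶜ_ : ∀ i j → Maybe (fromℤ i ≈ fromℤ j)
    i ≟ᶜ j with i ℤ.≟ j
    ... | yes i≡j = just (reflexive (≡.cong fromℤ i≡j))
    ... | no  _   = nothing

  open import Algebra.Solver.Ring ℤ.+-*-rawRing (fromCommutativeRing R) morphism _≟ᶜ_ public
    using (Polynomial; con; _:+_; _:*_; :-_; _:-_; _:=_; solve)

  :1 : ∀ {n : ℕ} → Polynomial n
  :1 = con (+ 1)

  :0 : ∀ {n : ℕ} → Polynomial n
  :0 = con (+ 0)

-- Finite sums and Bailey kernels

module FiniteSums (R : CommutativeRing 0ℓ 0ℓ) where
  open CommutativeRing R
  open import Relation.Binary.Reasoning.Setoid setoid
  open RingSolver R

  sum< : ℕ → (ℕ → Carrier) → Carrier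
  sum< zero    f = 0#
  sum< (suc n) f = sum< n f + f n

  sum<-cong′ : ∀ n {f g} → (∀ i → i ℕ.< n → f i ≈ g i) → sum< n f ≈ sum< n g
  sum<-cong′ zero    h = refl
  sum<-cong′ (suc n) h =
    +-cong (sum<-cong′ n (λ i i<n → h i (ℕₚ.m≤n⇒m≤1+n i<n))) (h n ℕₚ.≤-refl)

  sum<-cong : ∀ n {f g} → (∀ i → f i ≈ g i) → sum< n f ≈ sum< n g
  sum<-cong n h = sum<-cong′ n (λ i _ → h i)

  sum<-zero : ∀ n {f} → (∀ i → f i ≈ 0#) → sum< n f ≈ 0#
  sum<-zero zero    h = refl
  sum<-zero (suc n) h = trans (+-cong (sum<-zero n h) (h n)) (+-identityˡ 0#)

  sum<-+ : ∀ n f g → sum< n (λ i → f i + g i) ≈ sum< n f + sum< n g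
  sum<-+ zero    f g = sym (+-identityˡ 0#)
  sum<-+ (suc n) f g = trans (+-congʳ (sum<-+ n f g))
    (solve 4 (λ a b c d → (a :+ b) :+ (c :+ d) := (a :+ c) :+ (b :+ d)) refl _ _ _ _)

  sum<-*ˡ : ∀ n a f → a * sum< n f ≈ sum< n (λ i → a * f i)
  sum<-*ˡ zero    a f = zeroʳ a
  sum<-*ˡ (suc n) a f = trans (distribˡ a _ _) (+-congʳ (sum<-*ˡ n a f))

  sum<-head : ∀ n f → sum< (suc n) f ≈ f 0 + sum< n (f ∘ suc)
  sum<-head zero    f = +-comm 0# (f 0)
  sum<-head (suc n) f = trans (+-congʳ (sum<-head n f)) (+-assoc _ _ _)

  sum<-swap : ∀ m n (f : ℕ → ℕ → Carrier) →
    sum< m (λ i → sum< n (f i)) ≈ sum< n (λ j → sum< m (λ i → f i j))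
  sum<-swap zero    n f = sym (sum<-zero n (λ _ → refl))
  sum<-swap (suc m) n f =
    trans (+-congʳ (sum<-swap m n f)) (sym (sum<-+ n _ _))

  sum<-telescope : ∀ n (g : ℕ → Carrier) → sum< n (λ i → g i - g (suc i)) ≈ g 0 - g n
  sum<-telescope zero    g = sym (-‿inverseʳ (g 0))
  sum<-telescope (suc n) g = trans (+-congʳ (sum<-telescope n g))
    (solve 3 (λ a b c → (a :- b) :+ (b :- c) := a :- c) refl _ _ _)

  sum<-shift : ∀ n f → f 0 ≈ 0# → f n ≈ 0# → sum< n f ≈ sum< n (f ∘ suc)
  sum<-shift n f f0 fn = begin
    sum< n f                  ≈⟨ +-identityʳ _ ⟨
    sum< n f + 0#             ≈⟨ +-congˡ fn ⟨
    sum< (suc n) f            ≈⟨ sum<-head n f ⟩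
    f 0 + sum< n (f ∘ suc)    ≈⟨ +-congʳ f0 ⟩
    0# + sum< n (f ∘ suc)     ≈⟨ +-identityˡ _ ⟩
    sum< n (f ∘ suc)          ∎

module Base (R : CommutativeRing 0ℓ 0ℓ) (s : CommutativeRing.Carrier R) where
  open CommutativeRing R
  open import Algebra.Properties.Semiring.Exp semiring using (_^_)

  Q : Carrier
  Q = s * s

  -- The ring is arbitrary, so reciprocals are data: `i j` stands for 1/(1 - zQ^(j+1)), and the
  -- products `recip i n` of these become 1/(zQ;Q)_n.
  IsInverseFamily : Carrier → (ℕ → Carrier) → Set
  IsInverseFamily z i = ∀ j → (1# - z * Q ^ suc j) * i j ≈ 1#

  Q^≈ : ∀ j → Q ^ j ≈ s ^ (2 ℕ.* j)
  Q^≈ zero    = refl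
  Q^≈ (suc j) = trans (*-congˡ (Q^≈ j)) (trans (*-assoc s s _) (reflexive (≡.cong (s ^_) (≡.sym (ℕₚ.*-suc 2 j)))))

module Chain (R : CommutativeRing 0ℓ 0ℓ) (s : CommutativeRing.Carrier R)
             (iq : ℕ → CommutativeRing.Carrier R) where
  open CommutativeRing R
  open import Algebra.Properties.Semiring.Exp semiring using (_^_)
  open Base R s
  open FiniteSums R

  -- Factors are taken from the front, so that replacing `z` by `z * Q` amounts to `i ∘ suc`.
  recip : (ℕ → Carrier) → ℕ → Carrier
  recip i zero    = 1#
  recip i (suc n) = i 0 * recip (i ∘ suc) n

  -- 1 / (Q;Q)_{M-r}, which is 0 for r > M
  ρ : ℕ → ℕ → Carrier
  ρ M       zero    = recip iq M
  ρ zero    (suc r) = 0#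
  ρ (suc M) (suc r) = ρ M r

  -- With (E f) M = Q ^ M * f M one has D (z * Q) = D z ∘ E.
  D : Carrier → (ℕ → Carrier) → ℕ → Carrier
  D z f M = sum< (suc M) (λ N → z ^ N * Q ^ (N ℕ.* N) * ρ M N * f N)

  iter : Carrier → ℕ → (ℕ → Carrier) → ℕ → Carrier
  iter z zero    f = f
  iter z (suc n) f = D z (iter z n f)

  unit : ℕ → Carrier
  unit zero    = 1#
  unit (suc _) = 0#

  onePlusE : (ℕ → Carrier) → ℕ → Carrier
  onePlusE f M = (1# + Q ^ M) * f M

  -- VG x m n M is the inner sum over N_2 ≥ ... ≥ N_{k-1}, for N_1 = M, of the
  -- multisum with i = m + 1 and k = m + n + 1.
  VG : Carrier → ℕ → ℕ → ℕ → Carrier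
  VG z m n = iter z m (onePlusE (iter (z * Q) n unit))

  shift : (ℕ → Carrier) → ℕ → Carrier
  shift f zero    = 0#
  shift f (suc M) = f M

  -- The multiplier is `z` times the ratio of consecutive weights of N_1; summed against the
  -- weights, the two terms cancel.
  ∂ : Carrier → (ℕ → Carrier) → ℕ → Carrier
  ∂ z f M = shift f M - z * s * ((1# + Q ^ M) * (1# + s * Q ^ M)) * f M

module BaileyBasis (R : CommutativeRing 0ℓ 0ℓ) (s : CommutativeRing.Carrier R)
              (iq : ℕ → CommutativeRing.Carrier R)
              (iq-inv : Base.IsInverseFamily R s (CommutativeRing.1# R) iq) where
  open CommutativeRing R
  open import Relation.Binary.Reasoning.Setoid setoid
  open import Algebra.Properties.Semiring.Exp semiring using (_^_; ^-homo-*)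
  open import Algebra.Properties.CommutativeSemiring.Exp commutativeSemiring using (^-distrib-*)
  open RingSolver R
  open Base R s public
  open FiniteSums R public
  open Chain R s iq public

  ^-reflexive : ∀ x {m n} → m ≡ n → x ^ m ≈ x ^ n
  ^-reflexive x ≡.refl = refl

  shift-inv : ∀ {z i} → IsInverseFamily z i → IsInverseFamily (z * Q) (i ∘ suc)
  shift-inv {z} {i} h j = trans (*-congʳ (+-congˡ (-‿cong (*-assoc z Q _)))) (h (suc j))

  recip-last : ∀ i n → recip i (suc n) ≈ recip i n * i n
  recip-last i zero    = *-comm _ _
  recip-last i (suc n) = trans (*-congˡ (recip-last (i ∘ suc) n)) (sym (*-assoc _ _ _))

  recip-step : ∀ {z i} → IsInverseFamily z i → ∀ n → recip i n ≈ (1# - z * Q ^ suc n) * recip i (suc n)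
  recip-step {z} {i} h n = begin
    recip i n                                      ≈⟨ *-identityʳ _ ⟨
    recip i n * 1#                                 ≈⟨ *-congˡ (h n) ⟨
    recip i n * ((1# - z * Q ^ suc n) * i n)       ≈⟨ solve 3 (λ a b c → a :* (b :* c) := b :* (a :* c)) refl _ _ _ ⟩
    (1# - z * Q ^ suc n) * (recip i n * i n)       ≈⟨ *-congˡ (recip-last i n) ⟨
    (1# - z * Q ^ suc n) * recip i (suc n)         ∎

  -- Cancels the last factor 1 - Q^(M-r) of (Q;Q)_{M-r}. The factor Q^r clears the negative power of
  -- Q; for r ≥ M both sides are 0.
  ρ-step : ∀ M r → Q ^ r * ρ M (suc r) ≈ (Q ^ r - Q ^ M) * ρ M r
  ρ-step zero    zero    = solve 1 (λ a → :1 :* :0 := (:1 :- :1) :* a) refl _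
  ρ-step (suc M) zero    = begin
    1# * recip iq M                                 ≈⟨ *-identityˡ _ ⟩
    recip iq M                                      ≈⟨ recip-step iq-inv M ⟩
    (1# - 1# * Q ^ suc M) * recip iq (suc M)        ≈⟨ *-congʳ (+-congˡ (-‿cong (*-identityˡ _))) ⟩
    (1# - Q ^ suc M) * recip iq (suc M)             ∎
  ρ-step zero    (suc r) = trans (zeroʳ _) (sym (zeroʳ _))
  ρ-step (suc M) (suc r) = begin
    Q * Q ^ r * ρ M (suc r)             ≈⟨ *-assoc _ _ _ ⟩
    Q * (Q ^ r * ρ M (suc r))           ≈⟨ *-congˡ (ρ-step M r) ⟩
    Q * ((Q ^ r - Q ^ M) * ρ M r)       ≈⟨ solve 4 (λ q a b c → q :* ((a :- b) :* c) := (q :* a :- q :* b) :* c) refl _ _ _ _ ⟩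
    (Q * Q ^ r - Q * Q ^ M) * ρ M r     ∎

  ρ-zero : ∀ {M r} → M ℕ.< r → ρ M r ≈ 0#
  ρ-zero {zero}  {suc r} _       = refl
  ρ-zero {suc M} {suc r} (s≤s h) = ρ-zero h

  -- The kernels 1 / ((Q;Q)_{M-r} (zQ;Q)_{M+r}) and 1 / ((Q;Q)_{M-r} (zQ;Q)_{M+r+1})
  -- of Bailey pairs relative to z and z Q: eigenvectors of D z and of D (z * Q).
  b : (ℕ → Carrier) → ℕ → ℕ → Carrier
  b i r M = ρ M r * recip i (M ℕ.+ r)

  c : (ℕ → Carrier) → ℕ → ℕ → Carrier
  c i r M = ρ M r * recip i (suc (M ℕ.+ r))

  b-zero : ∀ i {r M} → M ℕ.< r → b i r M ≈ 0#
  b-zero i h = trans (*-congʳ (ρ-zero h)) (zeroˡ _)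

  c-zero : ∀ i {r M} → M ℕ.< r → c i r M ≈ 0#
  c-zero i h = trans (*-congʳ (ρ-zero h)) (zeroˡ _)

  -- Since (zQ;Q)_{n+1} = (1 - zQ)(zQ²;Q)_n, the kernel c relative to z is a scalar multiple of the
  -- kernel b relative to zQ.
  c≈b : ∀ i r M → c i r M ≈ i 0 * b (i ∘ suc) r M
  c≈b i r M = solve 3 (λ a b c → a :* (b :* c) := b :* (a :* c)) refl _ _ _

  Q^suc+ : ∀ M r → Q ^ suc (M ℕ.+ r) ≈ Q * (Q ^ M * Q ^ r)
  Q^suc+ M r = *-congˡ (^-homo-* Q M r)

  module _ {z : Carrier} {i : ℕ → Carrier} (inv : IsInverseFamily z i) where

    b≈c : ∀ r M → b i r M ≈ (1# - z * (Q * (Q ^ M * Q ^ r))) * c i r M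
    b≈c r M = begin
      ρ M r * recip i (M ℕ.+ r)
        ≈⟨ *-congˡ (recip-step inv (M ℕ.+ r)) ⟩
      ρ M r * ((1# - z * Q ^ suc (M ℕ.+ r)) * recip i (suc (M ℕ.+ r)))
        ≈⟨ *-congˡ (*-congʳ (+-congˡ (-‿cong (*-congˡ (Q^suc+ M r))))) ⟩
      ρ M r * ((1# - z * (Q * (Q ^ M * Q ^ r))) * recip i (suc (M ℕ.+ r)))
        ≈⟨ solve 3 (λ a b c → a :* (b :* c) := b :* (a :* c)) refl _ _ _ ⟩
      (1# - z * (Q * (Q ^ M * Q ^ r))) * c i r M ∎

    b⁺≈c : ∀ r M → Q ^ r * b i (suc r) M ≈ (Q ^ r - Q ^ M) * c i r M
    b⁺≈c r M = begin
      Q ^ r * (ρ M (suc r) * recip i (M ℕ.+ suc r))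
        ≈⟨ *-congˡ (*-congˡ (reflexive (≡.cong (recip i) (ℕₚ.+-suc M r)))) ⟩
      Q ^ r * (ρ M (suc r) * recip i (suc (M ℕ.+ r)))
        ≈⟨ *-assoc _ _ _ ⟨
      Q ^ r * ρ M (suc r) * recip i (suc (M ℕ.+ r))
        ≈⟨ *-congʳ (ρ-step M r) ⟩
      (Q ^ r - Q ^ M) * ρ M r * recip i (suc (M ℕ.+ r))
        ≈⟨ *-assoc _ _ _ ⟩
      (Q ^ r - Q ^ M) * c i r M ∎

    -- By the two preceding lemmas b_r = (1 - zQ^(r+1) E)c_r and Q^r b_{r+1} = (Q^r - E)c_r.
    -- Eliminating E c_r gives this expansion; eliminating c_r gives the next one.
    c-expand : ∀ r M →
      (1# - z * (Q * (Q ^ r * Q ^ r))) * c i r M ≈ b i r M - z * (Q * Q ^ r) * (Q ^ r * b i (suc r) M)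
    c-expand r M = sym (trans (+-cong (b≈c r M) (-‿cong (*-congˡ (b⁺≈c r M))))
      (solve 5 (λ z q m p c → (:1 :- z :* (q :* (m :* p))) :* c :- z :* (q :* p) :* ((p :- m) :* c)
                 := (:1 :- z :* (q :* (p :* p))) :* c) refl z Q (Q ^ M) (Q ^ r) _))

    Ec-expand : ∀ r M →
      Q ^ M * ((1# - z * (Q * (Q ^ r * Q ^ r))) * c i r M) ≈ Q ^ r * b i r M - Q ^ r * b i (suc r) M
    Ec-expand r M = sym (trans (+-cong (*-congˡ (b≈c r M)) (-‿cong (b⁺≈c r M)))
      (solve 5 (λ z q m p c → p :* ((:1 :- z :* (q :* (m :* p))) :* c) :- (p :- m) :* c
                 := m :* ((:1 :- z :* (q :* (p :* p))) :* c)) refl z Q (Q ^ M) (Q ^ r) _))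

  -- Only the values at N ≤ M enter, so an expansion that is valid below a cutoff stays valid below
  -- it after applying `D`.
  D-cong′ : ∀ z {f g} M → (∀ N → N ℕ.≤ M → f N ≈ g N) → D z f M ≈ D z g M
  D-cong′ z M h = sum<-cong′ (suc M) (λ { N (s≤s N≤M) → *-congˡ (h N N≤M) })

  D-*ˡ : ∀ z a f M → D z (λ N → a * f N) M ≈ a * D z f M
  D-*ˡ z a f M = sym (trans (sum<-*ˡ (suc M) a _)
    (sum<-cong (suc M) (λ N → solve 3 (λ a b c → a :* (b :* c) := b :* (a :* c)) refl _ _ _)))

  D-+ : ∀ z f g M → D z (λ N → f N + g N) M ≈ D z f M + D z g M
  D-+ z f g M = trans (sum<-cong (suc M) (λ N → distribˡ _ _ _)) (sum<-+ (suc M) _ _)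

  D-sum< : ∀ z R (f : ℕ → ℕ → Carrier) M →
    D z (λ N → sum< R (λ r → f r N)) M ≈ sum< R (λ r → D z (f r) M)
  D-sum< z R f M = trans (sum<-cong (suc M) (λ N → sum<-*ˡ R _ _)) (sum<-swap (suc M) R _)

  Q^sq-suc : ∀ n → Q ^ (suc n ℕ.* suc n) ≈ Q ^ (n ℕ.* n) * (Q ^ n * (Q ^ n * Q))
  Q^sq-suc n = begin
    Q ^ (suc n ℕ.* suc n)                      ≈⟨ ^-homo-* Q (suc n) (n ℕ.* suc n) ⟩
    Q ^ suc n * Q ^ (n ℕ.* suc n)              ≈⟨ *-congˡ (^-reflexive Q (ℕₚ.*-suc n n)) ⟩
    Q ^ suc n * Q ^ (n ℕ.+ n ℕ.* n)            ≈⟨ *-congˡ (^-homo-* Q n (n ℕ.* n)) ⟩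
    (Q * Q ^ n) * (Q ^ n * Q ^ (n ℕ.* n))      ≈⟨ solve 3 (λ q a e → (q :* a) :* (a :* e) := e :* (a :* (a :* q))) refl _ _ _ ⟩
    Q ^ (n ℕ.* n) * (Q ^ n * (Q ^ n * Q))      ∎

  module _ {z : Carrier} {i : ℕ → Carrier} (inv : IsInverseFamily z i) where
    private
      t : ℕ → ℕ → Carrier
      t M N = z ^ N * Q ^ (N ℕ.* N) * ρ M N * b i 0 N

      G : ℕ → ℕ → Carrier
      G M zero    = 0#
      G M (suc N) = z * (Q * (Q ^ M * Q ^ N)) * t M N

      b0-step : ∀ M → b i 0 M ≈ (1# - Q ^ suc M) * (1# - z * Q ^ suc M) * b i 0 (suc M)
      b0-step M = begin
        recip iq M * recip i (M ℕ.+ 0)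
          ≈⟨ *-cong (recip-step iq-inv M) (recip-step inv (M ℕ.+ 0)) ⟩
        (1# - 1# * Q ^ suc M) * recip iq (suc M) * ((1# - z * Q ^ suc (M ℕ.+ 0)) * recip i (suc (M ℕ.+ 0)))
          ≈⟨ *-congˡ (*-congʳ (+-congˡ (-‿cong (*-congˡ (^-reflexive Q (≡.cong suc (ℕₚ.+-identityʳ M))))))) ⟩
        (1# - 1# * Q ^ suc M) * recip iq (suc M) * ((1# - z * Q ^ suc M) * recip i (suc (M ℕ.+ 0)))
          ≈⟨ solve 4 (λ q z a b → (:1 :- :1 :* q) :* a :* ((:1 :- z :* q) :* b) := (:1 :- q) :* (:1 :- z :* q) :* (a :* b)) refl _ _ _ _ ⟩
        (1# - Q ^ suc M) * (1# - z * Q ^ suc M) * b i 0 (suc M) ∎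

      -- A Wilf–Zeilberger certificate for the finite form of Cauchy's identity.
      wz : ∀ M N → (1# - Q ^ suc M) * (1# - z * Q ^ suc M) * t (suc M) N ≈ t M N + (G M N - G M (suc N))
      wz M zero = begin
        (1# - q′) * (1# - z * q′) * (1# * 1# * recip iq (suc M) * β)
          ≈⟨ solve 4 (λ q z a b → (:1 :- q) :* (:1 :- z :* q) :* (:1 :* :1 :* a :* b)
               := (:1 :- z :* q) :* (((:1 :- :1 :* q) :* a) :* b)) refl q′ z _ β ⟩
        (1# - z * q′) * (((1# - 1# * q′) * recip iq (suc M)) * β)
          ≈⟨ *-congˡ (*-congʳ (recip-step iq-inv M)) ⟨
        (1# - z * (Q * Q ^ M)) * (recip iq M * β)
          ≈⟨ solve 5 (λ q m z a b → (:1 :- z :* (q :* m)) :* (a :* b) := :1 :* :1 :* a :* b :+ (:0 :- z :* (q :* (m :* :1)) :* (:1 :* :1 :* a :* b))) refl Q (Q ^ M) z _ β ⟩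
        1# * 1# * recip iq M * β + (0# - z * (Q * (Q ^ M * 1#)) * (1# * 1# * recip iq M * β)) ∎
        where β = b i 0 0
              q′ = Q ^ suc M
      wz M (suc N) = begin
        (1# - Q * v) * (1# - z * (Q * v)) * (z * a * Q ^ (suc N ℕ.* suc N) * P * β′)
          ≈⟨ *-congˡ (*-congʳ (*-congʳ (*-congˡ (Q^sq-suc N)))) ⟩
        (1# - Q * v) * (1# - z * (Q * v)) * (z * a * (e * (u * (u * Q))) * P * β′)
          ≈⟨ solve 8 (λ q z v u a e p w →
                (:1 :- q :* v) :* (:1 :- z :* (q :* v)) :* (z :* a :* (e :* (u :* (u :* q))) :* p :* w)
                := z :* a :* (e :* (u :* q)) :* ((u :- v) :* p) :* w
                   :+ (z :* (q :* (v :* u)) :* (a :* e :* p :* ((:1 :- q :* u) :* (:1 :- z :* (q :* u)) :* w))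
                       :- z :* (q :* (v :* (q :* u))) :* (z :* a :* (e :* (u :* q)) :* ((u :- v) :* p) :* w)))
                refl Q z v u a e P β′ ⟩
        z * a * (e * (u * Q)) * ((u - v) * P) * β′
          + (z * (Q * (v * u)) * (a * e * P * ((1# - Q * u) * (1# - z * (Q * u)) * β′))
             - z * (Q * (v * (Q * u))) * (z * a * (e * (u * Q)) * ((u - v) * P) * β′))
          ≈⟨ +-cong tP (+-cong (*-congˡ (*-congˡ (sym (b0-step N)))) (-‿cong (*-congˡ tP))) ⟩
        t M (suc N) + (z * (Q * (v * u)) * (a * e * P * b i 0 N) - z * (Q * (v * (Q * u))) * t M (suc N)) ∎
        where
        v = Q ^ M
        u = Q ^ N
        a = z ^ N
        e = Q ^ (N ℕ.* N)
        P = ρ M N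
        β′ = b i 0 (suc N)
        tP : z * a * (e * (u * Q)) * ((u - v) * P) * β′ ≈ t M (suc N)
        tP = begin
          z * a * (e * (u * Q)) * ((u - v) * P) * β′      ≈⟨ *-congʳ (*-congˡ (sym (ρ-step M N))) ⟩
          z * a * (e * (u * Q)) * (u * ρ M (suc N)) * β′
            ≈⟨ solve 7 (λ z a e u q p w → z :* a :* (e :* (u :* q)) :* (u :* p) :* w := z :* a :* (e :* (u :* (u :* q))) :* p :* w) refl _ _ _ _ _ _ _ ⟩
          z * a * (e * (u * (u * Q))) * ρ M (suc N) * β′  ≈⟨ *-congʳ (*-congʳ (*-congˡ (Q^sq-suc N))) ⟨
          t M (suc N) ∎

      F-step : ∀ M → (1# - Q ^ suc M) * (1# - z * Q ^ suc M) * D z (b i 0) (suc M) ≈ D z (b i 0) M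
      F-step M = begin
        (1# - Q ^ suc M) * (1# - z * Q ^ suc M) * sum< (2 ℕ.+ M) (t (suc M))
          ≈⟨ sum<-*ˡ (2 ℕ.+ M) _ _ ⟩
        sum< (2 ℕ.+ M) (λ N → (1# - Q ^ suc M) * (1# - z * Q ^ suc M) * t (suc M) N)
          ≈⟨ sum<-cong (2 ℕ.+ M) (wz M) ⟩
        sum< (2 ℕ.+ M) (λ N → t M N + (G M N - G M (suc N)))
          ≈⟨ sum<-+ (2 ℕ.+ M) _ _ ⟩
        sum< (2 ℕ.+ M) (t M) + sum< (2 ℕ.+ M) (λ N → G M N - G M (suc N))
          ≈⟨ +-cong (+-congˡ t0) (sum<-telescope (2 ℕ.+ M) (G M)) ⟩
        (D z (b i 0) M + 0#) + (0# - z * (Q * (Q ^ M * Q ^ suc M)) * t M (suc M))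
          ≈⟨ +-congˡ (+-congˡ (-‿cong (*-congˡ t0))) ⟩
        (D z (b i 0) M + 0#) + (0# - z * (Q * (Q ^ M * Q ^ suc M)) * 0#)
          ≈⟨ solve 2 (λ a b → (a :+ :0) :+ (:0 :- b :* :0) := a) refl _ _ ⟩
        D z (b i 0) M ∎
        where
        t0 : t M (suc M) ≈ 0#
        t0 = trans (*-congʳ (trans (*-congˡ (ρ-zero {M} ℕₚ.≤-refl)) (zeroʳ _))) (zeroˡ _)

      cancel : ∀ M {a b} → (1# - Q ^ suc M) * (1# - z * Q ^ suc M) * a ≈ (1# - Q ^ suc M) * (1# - z * Q ^ suc M) * b → a ≈ b
      cancel M {a} {b} h = trans (sym (e a)) (trans (*-congˡ h) (e b))
        where
        e : ∀ a → (iq M * i M) * ((1# - Q ^ suc M) * (1# - z * Q ^ suc M) * a) ≈ a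
        e a = begin
          (iq M * i M) * ((1# - Q ^ suc M) * (1# - z * Q ^ suc M) * a)
            ≈⟨ solve 5 (λ x y q z a → (x :* y) :* ((:1 :- q) :* (:1 :- z :* q) :* a) := ((:1 :- :1 :* q) :* x) :* (((:1 :- z :* q) :* y) :* a)) refl _ _ _ _ _ ⟩
          ((1# - 1# * Q ^ suc M) * iq M) * (((1# - z * Q ^ suc M) * i M) * a)
            ≈⟨ *-cong (iq-inv M) (*-congʳ (inv M)) ⟩
          1# * (1# * a) ≈⟨ trans (*-identityˡ _) (*-identityˡ _) ⟩
          a ∎

    -- Both sides satisfy the same first-order recurrence in M, and its coefficient (1 - Q^(M+1))(1
    -- - zQ^(M+1)) can be cancelled.
    D-b0 : ∀ M → D z (b i 0) M ≈ b i 0 M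
    D-b0 zero = solve 1 (λ a → :0 :+ :1 :* :1 :* :1 :* a := a) refl _
    D-b0 (suc M) = cancel M (trans (F-step M) (trans (D-b0 M) (b0-step M)))

  -- Replacing N by N + 1 turns Q^(N²) into Q^(N²+2N+1); the factor Q^(2N) is absorbed by z ↦ zQ².
  D-shift : ∀ z f M → D z (shift f) M ≈ z * Q * shift (D (z * Q * Q) f) M
  D-shift z f zero = solve 2 (λ a b → :0 :+ :1 :* :1 :* :1 :* :0 := a :* b :* :0) refl _ _
  D-shift z f (suc M) = begin
    D z (shift f) (suc M)
      ≈⟨ sum<-head (suc M) _ ⟩
    1# * 1# * recip iq (suc M) * 0# + sum< (suc M) (λ N → z ^ suc N * Q ^ (suc N ℕ.* suc N) * ρ M N * f N)
      ≈⟨ +-cong (zeroʳ _) (sum<-cong (suc M) term) ⟩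
    0# + sum< (suc M) (λ N → z * Q * ((z * Q * Q) ^ N * Q ^ (N ℕ.* N) * ρ M N * f N))
      ≈⟨ trans (+-identityˡ _) (sym (sum<-*ˡ (suc M) _ _)) ⟩
    z * Q * D (z * Q * Q) f M ∎
    where
    term : ∀ N → z ^ suc N * Q ^ (suc N ℕ.* suc N) * ρ M N * f N ≈ z * Q * ((z * Q * Q) ^ N * Q ^ (N ℕ.* N) * ρ M N * f N)
    term N = begin
      z * z ^ N * Q ^ (suc N ℕ.* suc N) * ρ M N * f N
        ≈⟨ *-congʳ (*-congʳ (*-congˡ (Q^sq-suc N))) ⟩
      z * z ^ N * (Q ^ (N ℕ.* N) * (Q ^ N * (Q ^ N * Q))) * ρ M N * f N
        ≈⟨ solve 7 (λ z a e u q p w → z :* a :* (e :* (u :* (u :* q))) :* p :* w := z :* q :* (a :* u :* u :* e :* p :* w)) refl _ _ _ _ _ _ _ ⟩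
      z * Q * (z ^ N * Q ^ N * Q ^ N * Q ^ (N ℕ.* N) * ρ M N * f N)
        ≈⟨ *-congˡ (*-congʳ (*-congʳ (*-congʳ (trans (*-congʳ (sym (^-distrib-* z Q N))) (sym (^-distrib-* (z * Q) Q N)))))) ⟩
      z * Q * ((z * Q * Q) ^ N * Q ^ (N ℕ.* N) * ρ M N * f N) ∎

  -- The eigenvalue of `D z` on the kernel b_r relative to z.
  μ : Carrier → ℕ → Carrier
  μ z r = z ^ r * Q ^ (r ℕ.* r)

  μ-suc : ∀ z r → μ z (suc r) ≈ μ z r * (z * (Q * (Q ^ r * Q ^ r)))
  μ-suc z r = trans (*-congˡ (Q^sq-suc r))
    (solve 5 (λ z a e u q → z :* a :* (e :* (u :* (u :* q))) := a :* e :* (z :* (q :* (u :* u)))) refl _ _ _ _ _)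

  μ-zQ : ∀ z r → μ (z * Q) r ≈ μ z r * Q ^ r
  μ-zQ z r = trans (*-congʳ (^-distrib-* z Q r)) (solve 3 (λ a b c → a :* b :* c := a :* c :* b) refl _ _ _)

  -- Induction on r: up to the scalar 1/((1 - zQ)(1 - zQ²)), the kernel b_{r+1} relative to z is the
  -- shift of b_r relative to zQ², and `D-shift` carries `D` through a shift with exactly this
  -- change of z.
  D-b : ∀ {z i} → IsInverseFamily z i → ∀ r M → D z (b i r) M ≈ μ z r * b i r M
  D-b inv zero M = trans (D-b0 inv M) (solve 1 (λ a → a := :1 :* :1 :* a) refl _)
  D-b {z} {i} inv (suc r) M = begin
    D z (b i (suc r)) M                               ≈⟨ D-cong′ z M (λ N _ → b⁺ N) ⟩
    D z (λ N → k * shift b″ N) M                      ≈⟨ D-*ˡ z k _ M ⟩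
    k * D z (shift b″) M                              ≈⟨ *-congˡ (D-shift z b″ M) ⟩
    k * (z * Q * shift (D (z * Q * Q) b″) M)          ≈⟨ *-congˡ (*-congˡ (shift-D M)) ⟩
    k * (z * Q * (μ (z * Q * Q) r * shift b″ M))      ≈⟨ solve 5 (λ k z q m b → k :* (z :* q :* (m :* b)) := z :* q :* m :* (k :* b)) refl _ _ _ _ _ ⟩
    z * Q * μ (z * Q * Q) r * (k * shift b″ M)        ≈⟨ *-cong μ-suc′ (sym (b⁺ M)) ⟩
    μ z (suc r) * b i (suc r) M ∎
    where
    k = i 0 * i 1
    b″ = b (i ∘ suc ∘ suc) r
    b⁺ : ∀ N → b i (suc r) N ≈ k * shift b″ N
    b⁺ zero = trans (zeroˡ _) (sym (zeroʳ _))
    b⁺ (suc N) = begin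
      ρ N r * (i 0 * recip (i ∘ suc) (N ℕ.+ suc r))
        ≈⟨ *-congˡ (*-congˡ (reflexive (≡.cong (recip (i ∘ suc)) (ℕₚ.+-suc N r)))) ⟩
      ρ N r * (i 0 * (i 1 * recip (i ∘ suc ∘ suc) (N ℕ.+ r)))
        ≈⟨ solve 4 (λ p a b c → p :* (a :* (b :* c)) := a :* b :* (p :* c)) refl _ _ _ _ ⟩
      k * b″ N ∎
    shift-D : ∀ M → shift (D (z * Q * Q) b″) M ≈ μ (z * Q * Q) r * shift b″ M
    shift-D zero    = sym (zeroʳ _)
    shift-D (suc M) = D-b (shift-inv (shift-inv inv)) r M
    μ-suc′ : z * Q * μ (z * Q * Q) r ≈ μ z (suc r)
    μ-suc′ = begin
      z * Q * μ (z * Q * Q) r                ≈⟨ *-congˡ (trans (μ-zQ (z * Q) r) (*-congʳ (μ-zQ z r))) ⟩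
      z * Q * (μ z r * Q ^ r * Q ^ r)        ≈⟨ solve 4 (λ z q m p → z :* q :* (m :* p :* p) := m :* (z :* (q :* (p :* p)))) refl _ _ _ _ ⟩
      μ z r * (z * (Q * (Q ^ r * Q ^ r)))    ≈⟨ μ-suc z r ⟨
      μ z (suc r) ∎

  -- The eigenvalue of `D (z * Q)` on the kernel c_r relative to z. Its factor Q^r is what permits
  -- the reduction modulo `∂`.
  l : Carrier → ℕ → Carrier
  l z r = μ z r * Q ^ r

  D-c : ∀ {z i} → IsInverseFamily z i → ∀ r M → D (z * Q) (c i r) M ≈ l z r * c i r M
  D-c {z} {i} inv r M = begin
    D (z * Q) (c i r) M                           ≈⟨ D-cong′ (z * Q) M (λ N _ → c≈b i r N) ⟩
    D (z * Q) (λ N → i 0 * b (i ∘ suc) r N) M     ≈⟨ D-*ˡ (z * Q) _ _ M ⟩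
    i 0 * D (z * Q) (b (i ∘ suc) r) M             ≈⟨ *-congˡ (D-b (shift-inv inv) r M) ⟩
    i 0 * (μ (z * Q) r * b (i ∘ suc) r M)         ≈⟨ *-congˡ (*-congʳ (μ-zQ z r)) ⟩
    i 0 * (l z r * b (i ∘ suc) r M)               ≈⟨ solve 3 (λ a b c → a :* (b :* c) := b :* (a :* c)) refl _ _ _ ⟩
    l z r * (i 0 * b (i ∘ suc) r M)         ≈⟨ *-congˡ (c≈b i r M) ⟨
    l z r * c i r M ∎

-- Expansions of the inner multisum and its recurrences modulo `∂`

module BaileyChain (R : CommutativeRing 0ℓ 0ℓ) (s : CommutativeRing.Carrier R)
              (iq : ℕ → CommutativeRing.Carrier R)
              (iq-inv : Base.IsInverseFamily R s (CommutativeRing.1# R) iq) where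
  open CommutativeRing R
  open import Relation.Binary.Reasoning.Setoid setoid
  open import Algebra.Properties.Semiring.Exp semiring using (_^_; ^-congˡ)
  open import Algebra.Properties.CommutativeSemiring.Exp commutativeSemiring using (^-distrib-*)
  open RingSolver R
  open BaileyBasis R s iq iq-inv public

  -- In closed form (-1)^r Q^(r(r-1)/2) (zQ;Q)_r / (Q;Q)_r. Multiplied by 1 - zQ^(2r+1) this is, up
  -- to normalisation, the unit Bailey pair relative to zQ.
  γ : Carrier → ℕ → Carrier
  γ z zero    = 1#
  γ z (suc r) = - (Q ^ r * (1# - z * (Q * Q ^ r))) * iq r * γ z r

  γ-step : ∀ z r → (1# - Q * Q ^ r) * γ z (suc r) ≈ - (Q ^ r * ((1# - z * (Q * Q ^ r)) * γ z r))
  γ-step z r = begin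
    (1# - Q * p) * (- (p * (1# - z * (Q * p))) * iq r * γ z r)
      ≈⟨ solve 5 (λ q z p i g → (:1 :- q :* p) :* ((:- (p :* (:1 :- z :* (q :* p)))) :* i :* g)
            := ((:1 :- :1 :* (q :* p)) :* i) :* (:- (p :* ((:1 :- z :* (q :* p)) :* g)))) refl Q z p (iq r) (γ z r) ⟩
    ((1# - 1# * (Q * p)) * iq r) * - (p * ((1# - z * (Q * p)) * γ z r))
      ≈⟨ *-congʳ (iq-inv r) ⟩
    1# * - (p * ((1# - z * (Q * p)) * γ z r))
      ≈⟨ *-identityˡ _ ⟩
    - (p * ((1# - z * (Q * p)) * γ z r)) ∎
    where p = Q ^ r

  -- In both products the z-dependent part is (zQ;Q)_{r+1}.
  γ-zQ : ∀ z r → γ (z * Q) r * (1# - z * Q) ≈ γ z r * (1# - z * (Q * Q ^ r))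
  γ-zQ z zero    = solve 2 (λ z q → :1 :* (:1 :- z :* q) := :1 :* (:1 :- z :* (q :* :1))) refl z Q
  γ-zQ z (suc r) = begin
    - (p * (1# - z * Q * (Q * p))) * iq r * γ (z * Q) r * (1# - z * Q)
      ≈⟨ *-assoc _ _ _ ⟩
    - (p * (1# - z * Q * (Q * p))) * iq r * (γ (z * Q) r * (1# - z * Q))
      ≈⟨ *-congˡ (γ-zQ z r) ⟩
    - (p * (1# - z * Q * (Q * p))) * iq r * (γ z r * (1# - z * (Q * p)))
      ≈⟨ solve 5 (λ q z p i g → (:- (p :* (:1 :- z :* q :* (q :* p)))) :* i :* (g :* (:1 :- z :* (q :* p)))
           := (:- (p :* (:1 :- z :* (q :* p)))) :* i :* g :* (:1 :- z :* (q :* (q :* p)))) refl Q z p (iq r) (γ z r) ⟩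
    γ z (suc r) * (1# - z * (Q * (Q * p))) ∎
    where p = Q ^ r

  -- The terms b_r and b_{r+1} that arise from the same c_r are kept together rather than collected
  -- by index, because both reduce to a multiple of that E c_r.
  comb : (ℕ → Carrier) → ℕ → (ℕ → Carrier) → (ℕ → Carrier) → ℕ → Carrier
  comb i R α β M = sum< R (λ r → α r * b i r M + β r * b i (suc r) M)

  combᶜ : (ℕ → Carrier) → ℕ → (ℕ → Carrier) → (ℕ → Carrier) → ℕ → Carrier
  combᶜ i R α β M = sum< R (λ r → α r * c i r M + β r * c i (suc r) M)

  module _ (i : ℕ → Carrier) (R : ℕ) where

    comb-+ : ∀ α β α′ β′ M → comb i R α β M + comb i R α′ β′ M
      ≈ comb i R (λ r → α r + α′ r) (λ r → β r + β′ r) M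
    comb-+ α β α′ β′ M = trans (sym (sum<-+ R _ _)) (sum<-cong R (λ r →
      solve 6 (λ a a′ b b′ x y → (a :* x :+ b :* y) :+ (a′ :* x :+ b′ :* y) := (a :+ a′) :* x :+ (b :+ b′) :* y)
        refl _ _ _ _ _ _))

    comb-neg : ∀ α β M → - comb i R α β M ≈ comb i R (λ r → - α r) (λ r → - β r) M
    comb-neg α β M = begin
      - comb i R α β M           ≈⟨ solve 1 (λ a → :- a := (:- :1) :* a) refl _ ⟩
      - 1# * comb i R α β M      ≈⟨ sum<-*ˡ R _ _ ⟩
      sum< R (λ r → - 1# * (α r * b i r M + β r * b i (suc r) M))
        ≈⟨ sum<-cong R (λ r → solve 4 (λ a b x y → (:- :1) :* (a :* x :+ b :* y) := (:- a) :* x :+ (:- b) :* y) refl _ _ _ _) ⟩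
      comb i R (λ r → - α r) (λ r → - β r) M ∎

    combᶜ-+ : ∀ {u v α β α′ β′} M → u ≈ combᶜ i R α β M → v ≈ combᶜ i R α′ β′ M →
      u + v ≈ combᶜ i R (λ r → α r + α′ r) (λ r → β r + β′ r) M
    combᶜ-+ M u≈ v≈ = trans (+-cong u≈ v≈) (trans (sym (sum<-+ R _ _)) (sum<-cong R (λ r →
      solve 6 (λ a a′ b b′ x y → (a :* x :+ b :* y) :+ (a′ :* x :+ b′ :* y) := (a :+ a′) :* x :+ (b :+ b′) :* y)
        refl _ _ _ _ _ _)))

    combᶜ-* : ∀ a {u α β} M → u ≈ combᶜ i R α β M →
      a * u ≈ combᶜ i R (λ r → a * α r) (λ r → a * β r) M
    combᶜ-* a M u≈ = trans (*-congˡ u≈) (trans (sum<-*ˡ R _ _) (sum<-cong R (λ r →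
      solve 5 (λ k a b x y → k :* (a :* x :+ b :* y) := (k :* a) :* x :+ (k :* b) :* y) refl _ _ _ _ _)))

    combᶜ-cong : ∀ {α β α′ β′} M → (∀ r → α r ≈ α′ r) → (∀ r → β r ≈ β′ r) →
      combᶜ i R α β M ≈ combᶜ i R α′ β′ M
    combᶜ-cong M h k = sum<-cong R (λ r → +-cong (*-congʳ (h r)) (*-congʳ (k r)))

    -- Reindexing the `X` half by r ↦ r + 1 loses nothing: `X 0` vanishes at one end, and c_R
    -- vanishes at M < R at the other.
    combᶜ-shift : ∀ X Y M → M ℕ.< R → X 0 ≈ 0# →
      sum< R (λ r → (X r + Y r) * c i r M) ≈ combᶜ i R Y (X ∘ suc) M
    combᶜ-shift X Y M M<R X0 = begin
      sum< R (λ r → (X r + Y r) * c i r M)                              ≈⟨ sum<-cong R (λ r → distribʳ _ _ _) ⟩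
      sum< R (λ r → X r * c i r M + Y r * c i r M)                      ≈⟨ sum<-+ R _ _ ⟩
      sum< R (λ r → X r * c i r M) + sum< R (λ r → Y r * c i r M)
        ≈⟨ +-congʳ (sum<-shift R _ (trans (*-congʳ X0) (zeroˡ _)) (trans (*-congˡ (c-zero i M<R)) (zeroʳ _))) ⟩
      sum< R (λ r → X (suc r) * c i (suc r) M) + sum< R (λ r → Y r * c i r M)  ≈⟨ +-comm _ _ ⟩
      sum< R (λ r → Y r * c i r M) + sum< R (λ r → X (suc r) * c i (suc r) M)  ≈⟨ sum<-+ R _ _ ⟨
      combᶜ i R Y (X ∘ suc) M ∎

  module _ {z : Carrier} {i : ℕ → Carrier} (inv : IsInverseFamily z i) where

    κ : ℕ → Carrier
    κ r = 1# - z * (Q * (Q ^ r * Q ^ r))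

    -- For M > 0 the sum is multiplied by the invertible 1 - Q^M, that is, 1 - E is applied. By the
    -- expansions of c_r and E c_r the terms then telescope; the boundary terms vanish because of 1
    -- - Q^0 = 0 and because b_R is zero at M < R.
    unit-expand : ∀ R M → M ℕ.< R → sum< R (λ r → γ z r * (κ r * c i r M)) ≈ unit M
    unit-expand (suc R) zero _ = begin
      sum< (suc R) (λ r → γ z r * (κ r * c i r 0))                ≈⟨ sum<-head R _ ⟩
      1# * (κ 0 * (1# * (i 0 * 1#))) + sum< R (λ r → γ z (suc r) * (κ (suc r) * c i (suc r) 0))
        ≈⟨ +-congˡ (sum<-zero R (λ r → solve 3 (λ a b d → a :* (b :* (:0 :* d)) := :0) refl _ _ _)) ⟩
      1# * (κ 0 * (1# * (i 0 * 1#))) + 0#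
        ≈⟨ solve 3 (λ z q i → :1 :* ((:1 :- z :* (q :* (:1 :* :1))) :* (:1 :* (i :* :1))) :+ :0 := (:1 :- z :* (q :* :1)) :* i) refl z Q (i 0) ⟩
      (1# - z * (Q * 1#)) * i 0 ≈⟨ inv 0 ⟩
      1# ∎
    unit-expand R (suc M) M<R = begin
      Σ                                              ≈⟨ *-identityˡ _ ⟨
      1# * Σ                                         ≈⟨ *-congʳ (iq-inv M) ⟨
      (1# - 1# * q) * iq M * Σ                       ≈⟨ solve 3 (λ q i a → (:1 :- :1 :* q) :* i :* a := i :* ((:1 :- q) :* a)) refl _ _ _ ⟩
      iq M * ((1# - q) * Σ)                          ≈⟨ *-congˡ (trans (sum<-*ˡ R _ _) (sum<-cong R tele)) ⟩
      iq M * sum< R (λ r → g r - g (suc r))          ≈⟨ *-congˡ (sum<-telescope R g) ⟩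
      iq M * (g 0 - g R)                             ≈⟨ *-congˡ (+-congˡ (-‿cong (trans (*-congˡ (b-zero i M<R)) (zeroʳ _)))) ⟩
      iq M * (γ z 0 * (1# - 1#) * b i 0 (suc M) - 0#) ≈⟨ solve 3 (λ a g x → a :* (g :* (:1 :- :1) :* x :- :0) := :0) refl _ _ _ ⟩
      0# ∎
      where
      q = Q ^ suc M
      Σ = sum< R (λ r → γ z r * (κ r * c i r (suc M)))
      g : ℕ → Carrier
      g r = γ z r * (1# - Q ^ r) * b i r (suc M)
      tele : ∀ r → (1# - q) * (γ z r * (κ r * c i r (suc M))) ≈ g r - g (suc r)
      tele r = begin
        (1# - q) * (γ z r * K)
          ≈⟨ solve 3 (λ q g k → (:1 :- q) :* (g :* k) := g :* (k :- q :* k)) refl _ _ _ ⟩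
        γ z r * (K - q * K)
          ≈⟨ *-congˡ (+-cong (c-expand inv r (suc M)) (-‿cong (Ec-expand inv r (suc M)))) ⟩
        γ z r * ((b i r (suc M) - z * (Q * p) * (p * b⁺)) - (p * b i r (suc M) - p * b⁺))
          ≈⟨ solve 6 (λ g x z q p y → g :* ((x :- z :* (q :* p) :* (p :* y)) :- (p :* x :- p :* y))
                := g :* (:1 :- p) :* x :- (:- (p :* ((:1 :- z :* (q :* p)) :* g))) :* y) refl (γ z r) _ z Q p b⁺ ⟩
        g r - - (p * ((1# - z * (Q * p)) * γ z r)) * b⁺
          ≈⟨ +-congˡ (-‿cong (*-congʳ (γ-step z r))) ⟨
        g r - (1# - Q * p) * γ z (suc r) * b⁺
          ≈⟨ +-congˡ (-‿cong (*-congʳ (*-comm _ _))) ⟩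
        g r - g (suc r) ∎
        where
        p = Q ^ r
        K = κ r * c i r (suc M)
        b⁺ = b i (suc r) (suc M)

    iterB-expand : ∀ n R M → M ℕ.< R →
      iter (z * Q) n unit M ≈ sum< R (λ r → γ z r * l z r ^ n * (κ r * c i r M))
    iterB-expand zero    R M M<R = sym (trans (sum<-cong R (λ r → *-congʳ (*-identityʳ _))) (unit-expand R M M<R))
    iterB-expand (suc n) R M M<R = begin
      D (z * Q) (iter (z * Q) n unit) M
        ≈⟨ D-cong′ (z * Q) M (λ N N≤M → iterB-expand n R N (ℕₚ.≤-<-trans N≤M M<R)) ⟩
      D (z * Q) (λ N → sum< R (λ r → γ z r * l z r ^ n * (κ r * c i r N))) M
        ≈⟨ D-sum< (z * Q) R _ M ⟩
      sum< R (λ r → D (z * Q) (λ N → γ z r * l z r ^ n * (κ r * c i r N)) M)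
        ≈⟨ sum<-cong R term ⟩
      sum< R (λ r → γ z r * l z r ^ suc n * (κ r * c i r M)) ∎
      where
      term : ∀ r → D (z * Q) (λ N → γ z r * l z r ^ n * (κ r * c i r N)) M
                 ≈ γ z r * l z r ^ suc n * (κ r * c i r M)
      term r = begin
        _ ≈⟨ D-*ˡ (z * Q) _ _ M ⟩
        γ z r * h ^ n * D (z * Q) (λ N → κ r * c i r N) M  ≈⟨ *-congˡ (D-*ˡ (z * Q) _ _ M) ⟩
        γ z r * h ^ n * (κ r * D (z * Q) (c i r) M)        ≈⟨ *-congˡ (*-congˡ (D-c inv r M)) ⟩
        γ z r * h ^ n * (κ r * (h * c i r M))
          ≈⟨ solve 5 (λ g a k l c → g :* a :* (k :* (l :* c)) := g :* (l :* a) :* (k :* c)) refl _ _ _ _ _ ⟩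
        γ z r * (h * h ^ n) * (κ r * c i r M) ∎
        where h = l z r

    iterA-comb : ∀ m R α β f M → (∀ N → N ℕ.≤ M → f N ≈ comb i R α β N) →
      iter z m f M ≈ comb i R (λ r → α r * μ z r ^ m) (λ r → β r * μ z (suc r) ^ m) M
    iterA-comb zero    R α β f M h = trans (h M ℕₚ.≤-refl)
      (sum<-cong R (λ r → +-cong (*-congʳ (sym (*-identityʳ _))) (*-congʳ (sym (*-identityʳ _)))))
    iterA-comb (suc m) R α β f M h = begin
      D z (iter z m f) M
        ≈⟨ D-cong′ z M (λ N N≤M → iterA-comb m R α β f N (λ L L≤N → h L (ℕₚ.≤-trans L≤N N≤M))) ⟩
      D z (comb i R _ _) M  ≈⟨ D-sum< z R _ M ⟩
      sum< R (λ r → D z (λ N → α r * μ z r ^ m * b i r N + β r * μ z (suc r) ^ m * b i (suc r) N) M)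
        ≈⟨ sum<-cong R (λ r → trans (D-+ z _ _ M) (+-cong (term (α r) r) (term (β r) (suc r)))) ⟩
      comb i R (λ r → α r * μ z r ^ suc m) (λ r → β r * μ z (suc r) ^ suc m) M ∎
      where
      term : ∀ a r → D z (λ N → a * μ z r ^ m * b i r N) M ≈ a * μ z r ^ suc m * b i r M
      term a r = begin
        _ ≈⟨ D-*ˡ z _ _ M ⟩
        a * μ z r ^ m * D z (b i r) M           ≈⟨ *-congˡ (D-b inv r M) ⟩
        a * μ z r ^ m * (μ z r * b i r M)       ≈⟨ solve 4 (λ a b c d → a :* b :* (c :* d) := a :* (c :* b) :* d) refl _ _ _ _ ⟩
        a * (μ z r * μ z r ^ m) * b i r M       ∎

    -- The operator 1 + E sends each multiple of c_r to a combination of b_r and b_{r+1}, by adding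
    -- `c-expand` and `Ec-expand`; before it the c_r and after it the b_r are eigenvectors.
    VG-expand : ∀ m n R M → M ℕ.< R → VG z m n M ≈ comb i R
      (λ r → γ z r * l z r ^ n * (1# + Q ^ r) * μ z r ^ m)
      (λ r → - (γ z r * l z r ^ n * (Q ^ r * (1# + z * (Q * Q ^ r)))) * μ z (suc r) ^ m) M
    VG-expand m n R M M<R = iterA-comb m R _ _ _ M (λ N N≤M → base N (ℕₚ.≤-<-trans N≤M M<R))
      where
      base : ∀ N → N ℕ.< R → onePlusE (iter (z * Q) n unit) N ≈ comb i R
        (λ r → γ z r * l z r ^ n * (1# + Q ^ r))
        (λ r → - (γ z r * l z r ^ n * (Q ^ r * (1# + z * (Q * Q ^ r))))) N
      base N N<R = begin
        (1# + Q ^ N) * iter (z * Q) n unit N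
          ≈⟨ *-congˡ (iterB-expand n R N N<R) ⟩
        (1# + Q ^ N) * sum< R (λ r → γ z r * l z r ^ n * (κ r * c i r N))
          ≈⟨ sum<-*ˡ R _ _ ⟩
        sum< R (λ r → (1# + Q ^ N) * (γ z r * l z r ^ n * (κ r * c i r N)))
          ≈⟨ sum<-cong R (λ r → trans (solve 3 (λ q g k → (:1 :+ q) :* (g :* k) := g :* (k :+ q :* k)) refl _ _ _)
              (trans (*-congˡ (+-cong (c-expand inv r N) (Ec-expand inv r N)))
                 (solve 6 (λ g x z q p y → g :* ((x :- z :* (q :* p) :* (p :* y)) :+ (p :* x :- p :* y))
                    := g :* (:1 :+ p) :* x :+ (:- (g :* (p :* (:1 :+ z :* (q :* p))))) :* y) refl _ _ z Q (Q ^ r) _))) ⟩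
        comb i R _ _ N ∎

    -- Since E u = u, the sequence VG z m 0 has a second expansion, whose
    -- coefficients are all divisible by Q ^ r.
    VG₀-expand : ∀ m R M → M ℕ.< R → VG z m 0 M ≈ comb i R
      (λ r → γ z r * (1# + 1#) * Q ^ r * μ z r ^ m)
      (λ r → - (γ z r * (1# + 1#) * Q ^ r) * μ z (suc r) ^ m) M
    VG₀-expand m R M M<R = iterA-comb m R _ _ _ M (λ N N≤M → base N (ℕₚ.≤-<-trans N≤M M<R))
      where
      double : ∀ N → onePlusE unit N ≈ (1# + 1#) * Q ^ N * unit N
      double zero    = *-congʳ (sym (*-identityʳ _))
      double (suc N) = trans (zeroʳ _) (sym (zeroʳ _))
      base : ∀ N → N ℕ.< R → onePlusE unit N ≈ comb i R
        (λ r → γ z r * (1# + 1#) * Q ^ r) (λ r → - (γ z r * (1# + 1#) * Q ^ r)) N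
      base N N<R = begin
        onePlusE unit N                     ≈⟨ double N ⟩
        (1# + 1#) * Q ^ N * unit N          ≈⟨ *-congˡ (unit-expand R N N<R) ⟨
        (1# + 1#) * Q ^ N * sum< R (λ r → γ z r * (κ r * c i r N))
          ≈⟨ sum<-*ˡ R _ _ ⟩
        sum< R (λ r → (1# + 1#) * Q ^ N * (γ z r * (κ r * c i r N)))
          ≈⟨ sum<-cong R (λ r → trans (solve 3 (λ q g k → (:1 :+ :1) :* q :* (g :* k) := g :* (:1 :+ :1) :* (q :* k)) refl _ _ _)
              (trans (*-congˡ (Ec-expand inv r N))
                 (solve 4 (λ g x p y → g :* (:1 :+ :1) :* (p :* x :- p :* y)
                    := g :* (:1 :+ :1) :* p :* x :+ (:- (g :* (:1 :+ :1) :* p)) :* y) refl _ _ _ _))) ⟩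
        comb i R _ _ N ∎

  module _ {z : Carrier} {i : ℕ → Carrier} (inv : IsInverseFamily z i) where

    b-shifted : ∀ r M → b (i ∘ suc) r M ≈ (1# - z * Q) * c i r M
    b-shifted r M = begin
      b (i ∘ suc) r M                                  ≈⟨ *-identityˡ _ ⟨
      1# * b (i ∘ suc) r M                             ≈⟨ *-congʳ (inv 0) ⟨
      (1# - z * (Q * 1#)) * i 0 * b (i ∘ suc) r M      ≈⟨ solve 4 (λ z q a b → (:1 :- z :* (q :* :1)) :* a :* b := (:1 :- z :* q) :* (a :* b)) refl _ _ _ _ ⟩
      (1# - z * Q) * (i 0 * b (i ∘ suc) r M)           ≈⟨ *-congˡ (c≈b i r M) ⟨
      (1# - z * Q) * c i r M                           ∎

    ν : ℕ → Carrier
    ν r = l (z * Q) r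

    ω ω′ : ℕ → ℕ → ℕ → Carrier
    ω  m n r = γ z r * (1# - z * (Q * Q ^ r)) * (1# + Q ^ r) * (ν r ^ n * l z r ^ m)
    ω′ m n r = γ z (suc r) * (1# - Q ^ suc r) * (1# + z * (Q * Q ^ suc r)) * (ν r ^ n * l z (suc r) ^ m)

    -- The kernels b relative to zQ are (1 - zQ) times the kernels c relative to z, and `γ-zQ`
    -- absorbs this scalar. The multisum at zQ thus lives on the same c_r as the reduction modulo
    -- `∂`.
    W-expand : ∀ m n R M → M ℕ.< R → VG (z * Q) m n M ≈ combᶜ i R (ω m n) (ω′ m n) M
    W-expand m n R M M<R = trans (VG-expand (shift-inv inv) m n R M M<R) (sum<-cong R (λ r → +-cong (fst r) (snd r)))
      where
      fst : ∀ r → γ (z * Q) r * ν r ^ n * (1# + Q ^ r) * μ (z * Q) r ^ m * b (i ∘ suc) r M ≈ ω m n r * c i r M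
      fst r = begin
        γ (z * Q) r * N * (1# + p) * μ (z * Q) r ^ m * b (i ∘ suc) r M
          ≈⟨ *-cong (*-congˡ (^-congˡ m (μ-zQ z r))) (b-shifted r M) ⟩
        γ (z * Q) r * N * (1# + p) * L * ((1# - z * Q) * c i r M)
          ≈⟨ solve 6 (λ g n p l k c → g :* n :* (:1 :+ p) :* l :* (k :* c) := (g :* k) :* (:1 :+ p) :* (n :* l) :* c) refl _ _ _ _ _ _ ⟩
        (γ (z * Q) r * (1# - z * Q)) * (1# + p) * (N * L) * c i r M
          ≈⟨ *-congʳ (*-congʳ (*-congʳ (γ-zQ z r))) ⟩
        ω m n r * c i r M ∎
        where
        p = Q ^ r
        N = ν r ^ n
        L = l z r ^ m
      snd : ∀ r → - (γ (z * Q) r * ν r ^ n * (Q ^ r * (1# + z * Q * (Q * Q ^ r)))) * μ (z * Q) (suc r) ^ m * b (i ∘ suc) (suc r) M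
                  ≈ ω′ m n r * c i (suc r) M
      snd r = begin
        - (γ (z * Q) r * N * (p * (1# + z * Q * (Q * p)))) * μ (z * Q) (suc r) ^ m * b (i ∘ suc) (suc r) M
          ≈⟨ *-cong (*-congˡ (^-congˡ m (μ-zQ z (suc r)))) (b-shifted (suc r) M) ⟩
        - (γ (z * Q) r * N * (p * (1# + z * Q * (Q * p)))) * L * ((1# - z * Q) * c i (suc r) M)
          ≈⟨ solve 8 (λ g n p z q l k c → (:- (g :* n :* (p :* (:1 :+ z :* q :* (q :* p))))) :* l :* (k :* c)
               := (:- (p :* (g :* k))) :* (:1 :+ z :* (q :* (q :* p))) :* (n :* l) :* c) refl (γ (z * Q) r) N p z Q L _ _ ⟩
        - (p * (γ (z * Q) r * (1# - z * Q))) * (1# + z * (Q * (Q * p))) * (N * L) * c i (suc r) M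
          ≈⟨ *-congʳ (*-congʳ (*-congʳ γ≈)) ⟩
        ω′ m n r * c i (suc r) M ∎
        where
        p = Q ^ r
        N = ν r ^ n
        L = l z (suc r) ^ m
        γ≈ : - (p * (γ (z * Q) r * (1# - z * Q))) ≈ γ z (suc r) * (1# - Q * p)
        γ≈ = begin
          - (p * (γ (z * Q) r * (1# - z * Q)))      ≈⟨ -‿cong (*-congˡ (trans (γ-zQ z r) (*-comm _ _))) ⟩
          - (p * ((1# - z * (Q * p)) * γ z r))      ≈⟨ γ-step z r ⟨
          (1# - Q * p) * γ z (suc r)                ≈⟨ *-comm _ _ ⟩
          γ z (suc r) * (1# - Q * p)                ∎

    ∂-sum : ∀ R (ψ : ℕ → Carrier) M → ∂ z (λ N → sum< R (λ r → ψ r * c i r N)) M ≈ sum< R (λ r → ψ r * ∂ z (c i r) M)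
    ∂-sum R ψ M = begin
      shift (λ N → sum< R (λ r → ψ r * c i r N)) M - k * sum< R (λ r → ψ r * c i r M)
        ≈⟨ +-cong (sh M) (trans (solve 2 (λ a b → :- (a :* b) := (:- a) :* b) refl _ _) (sum<-*ˡ R _ _)) ⟩
      sum< R (λ r → ψ r * shift (c i r) M) + sum< R (λ r → - k * (ψ r * c i r M))
        ≈⟨ sum<-+ R _ _ ⟨
      sum< R (λ r → ψ r * shift (c i r) M + - k * (ψ r * c i r M))
        ≈⟨ sum<-cong R (λ r → solve 4 (λ a b k c → a :* b :+ (:- k) :* (a :* c) := a :* (b :- k :* c)) refl _ _ _ _) ⟩
      sum< R (λ r → ψ r * ∂ z (c i r) M) ∎
      where
      k = z * s * ((1# + Q ^ M) * (1# + s * Q ^ M))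
      sh : ∀ M → shift (λ N → sum< R (λ r → ψ r * c i r N)) M ≈ sum< R (λ r → ψ r * shift (c i r) M)
      sh zero    = sym (sum<-zero R (λ r → zeroʳ _))
      sh (suc M) = refl

    -- Lowering M by one removes the last factors 1 - Q^(M-r) and 1 - zQ^(M+r+1) of the two
    -- denominators; at M = 0 both sides vanish.
    shift-c : ∀ r M → Q ^ r * shift (c i r) M ≈ (Q ^ r - Q ^ M) * (1# - z * (Q * (Q ^ M * Q ^ r))) * c i r M
    shift-c r zero = begin
      Q ^ r * 0#   ≈⟨ zeroʳ _ ⟩
      0#           ≈⟨ zeroʳ _ ⟨
      _ * 0#       ≈⟨ *-congˡ (trans (*-congʳ (trans (sym (ρ-step 0 r)) (zeroʳ _))) (zeroˡ _)) ⟨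
      (1# - z * (Q * (1# * Q ^ r))) * ((Q ^ r - 1#) * ρ 0 r * recip i (suc r))
        ≈⟨ solve 4 (λ a b c d → a :* (b :* c :* d) := b :* a :* (c :* d)) refl _ _ _ _ ⟩
      (Q ^ r - 1#) * (1# - z * (Q * (1# * Q ^ r))) * c i r 0 ∎
    shift-c r (suc M) = begin
      Q ^ r * (ρ (suc M) (suc r) * recip i (suc M ℕ.+ r))
        ≈⟨ *-congˡ (*-congˡ (recip-step inv (suc M ℕ.+ r))) ⟩
      Q ^ r * (ρ (suc M) (suc r) * ((1# - z * Q ^ suc (suc M ℕ.+ r)) * recip i (suc (suc M ℕ.+ r))))
        ≈⟨ *-congˡ (*-congˡ (*-congʳ (+-congˡ (-‿cong (*-congˡ (Q^suc+ (suc M) r)))))) ⟩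
      Q ^ r * (ρ (suc M) (suc r) * (k * recip i (suc (suc M ℕ.+ r))))
        ≈⟨ solve 4 (λ a b c d → a :* (b :* (c :* d)) := (a :* b) :* c :* d) refl _ _ _ _ ⟩
      Q ^ r * ρ (suc M) (suc r) * k * recip i (suc (suc M ℕ.+ r))
        ≈⟨ *-congʳ (*-congʳ (ρ-step (suc M) r)) ⟩
      (Q ^ r - Q ^ suc M) * ρ (suc M) r * k * recip i (suc (suc M ℕ.+ r))
        ≈⟨ solve 4 (λ a b c d → a :* b :* c :* d := a :* c :* (b :* d)) refl _ _ _ _ ⟩
      (Q ^ r - Q ^ suc M) * k * c i r (suc M) ∎
      where k = 1# - z * (Q * (Q ^ suc M * Q ^ r))

    -- By `shift-c`, Q^r ∂c_r is a quadratic polynomial in E applied to c_r. Its E²-terms are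
    -- zQ^(r+1) and -zs²Q^r, which cancel, and its constant term is Q^r(1 - zs). Subtracting it from
    -- (1 - zs)Q^r b_r therefore leaves a multiple of E c_r alone.
    ∂-b : ∀ r M → (1# - z * s) * (Q ^ r * b i r M)
      ≈ Q ^ M * ((1# + z * (Q * Q ^ r)) * (1# + z * s * Q ^ r) * c i r M) + Q ^ r * ∂ z (c i r) M
    ∂-b r M = begin
      (1# - z * s) * (p * b i r M)
        ≈⟨ *-congˡ (*-congˡ (b≈c inv r M)) ⟩
      (1# - z * s) * (p * ((1# - z * (Q * (m * p))) * k))
        ≈⟨ solve 5 (λ z s m p k → (:1 :- z :* s) :* (p :* ((:1 :- z :* (s :* s :* (m :* p))) :* k))
             := m :* ((:1 :+ z :* (s :* s :* p)) :* (:1 :+ z :* s :* p) :* k)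
                :+ ((p :- m) :* (:1 :- z :* (s :* s :* (m :* p))) :* k
                    :- p :* (z :* s :* ((:1 :+ m) :* (:1 :+ s :* m)) :* k))) refl z s m p k ⟩
      m * ((1# + z * (Q * p)) * (1# + z * s * p) * k)
        + ((p - m) * (1# - z * (Q * (m * p))) * k - p * (z * s * ((1# + m) * (1# + s * m)) * k))
        ≈⟨ +-congˡ (+-congʳ (shift-c r M)) ⟨
      m * ((1# + z * (Q * p)) * (1# + z * s * p) * k)
        + (p * shift (c i r) M - p * (z * s * ((1# + m) * (1# + s * m)) * k))
        ≈⟨ +-congˡ (solve 3 (λ p a b → p :* a :- p :* b := p :* (a :- b)) refl _ _ _) ⟩
      m * ((1# + z * (Q * p)) * (1# + z * s * p) * k) + p * ∂ z (c i r) M ∎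
      where
      m = Q ^ M
      p = Q ^ r
      k = c i r M

    ∂-b⁺ : ∀ r M → (1# - z * s) * (Q ^ r * b i (suc r) M)
      ≈ Q ^ M * (z * s * (1# + Q ^ r) * (1# + s * Q ^ r) * c i r M) + Q ^ r * ∂ z (c i r) M
    ∂-b⁺ r M = begin
      (1# - z * s) * (p * b i (suc r) M)
        ≈⟨ *-congˡ (b⁺≈c inv r M) ⟩
      (1# - z * s) * ((p - m) * k)
        ≈⟨ solve 5 (λ z s m p k → (:1 :- z :* s) :* ((p :- m) :* k)
             := m :* (z :* s :* (:1 :+ p) :* (:1 :+ s :* p) :* k)
                :+ ((p :- m) :* (:1 :- z :* (s :* s :* (m :* p))) :* k
                    :- p :* (z :* s :* ((:1 :+ m) :* (:1 :+ s :* m)) :* k))) refl z s m p k ⟩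
      m * (z * s * (1# + p) * (1# + s * p) * k)
        + ((p - m) * (1# - z * (Q * (m * p))) * k - p * (z * s * ((1# + m) * (1# + s * m)) * k))
        ≈⟨ +-congˡ (+-congʳ (shift-c r M)) ⟨
      m * (z * s * (1# + p) * (1# + s * p) * k)
        + (p * shift (c i r) M - p * (z * s * ((1# + m) * (1# + s * m)) * k))
        ≈⟨ +-congˡ (solve 3 (λ p a b → p :* a :- p :* b := p :* (a :- b)) refl _ _ _) ⟩
      m * (z * s * (1# + p) * (1# + s * p) * k) + p * ∂ z (c i r) M ∎
      where
      m = Q ^ M
      p = Q ^ r
      k = c i r M

    Xᶜ Yᶜ : (ℕ → Carrier) → ℕ → Carrier
    Xᶜ a r = a r * ((1# + z * (Q * Q ^ r)) * (1# + z * s * Q ^ r))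
    Yᶜ d r = d r * (z * s * (1# + Q ^ r) * (1# + s * Q ^ r))

    -- The factor Q^r demanded of the coefficients is the one on the left of `∂-b` and `∂-b⁺`; it
    -- cannot be divided out.
    reduce : ∀ R M → M ℕ.< R → ∀ {α β} a d →
      (∀ r → α r ≈ a r * Q ^ r) → (∀ r → β r ≈ d r * Q ^ r) →
      (1# - z * s) * comb i R α β M
        ≈ Q ^ M * sum< R (λ r → (Xᶜ a r + Yᶜ d r) * c i r M)
          + ∂ z (λ N → sum< R (λ r → (a r + d r) * Q ^ r * c i r N)) M
    reduce R M M<R {α} {β} a d α≈ β≈ = begin
      (1# - z * s) * comb i R α β M
        ≈⟨ sum<-*ˡ R _ _ ⟩
      sum< R (λ r → (1# - z * s) * (α r * b i r M + β r * b i (suc r) M))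
        ≈⟨ sum<-cong R term ⟩
      sum< R (λ r → Q ^ M * ((Xᶜ a r + Yᶜ d r) * c i r M) + (a r + d r) * Q ^ r * ∂ z (c i r) M)
        ≈⟨ sum<-+ R _ _ ⟩
      sum< R (λ r → Q ^ M * ((Xᶜ a r + Yᶜ d r) * c i r M)) + sum< R (λ r → (a r + d r) * Q ^ r * ∂ z (c i r) M)
        ≈⟨ +-cong (sym (sum<-*ˡ R _ _)) (sym (∂-sum R _ M)) ⟩
      _ ∎
      where
      term : ∀ r → (1# - z * s) * (α r * b i r M + β r * b i (suc r) M)
           ≈ Q ^ M * ((Xᶜ a r + Yᶜ d r) * c i r M) + (a r + d r) * Q ^ r * ∂ z (c i r) M
      term r = begin
        (1# - z * s) * (α r * b i r M + β r * b i (suc r) M)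
          ≈⟨ *-congˡ (+-cong (*-congʳ (α≈ r)) (*-congʳ (β≈ r))) ⟩
        (1# - z * s) * (a r * Q ^ r * b i r M + d r * Q ^ r * b i (suc r) M)
          ≈⟨ solve 6 (λ k a d p x y → k :* (a :* p :* x :+ d :* p :* y) := a :* (k :* (p :* x)) :+ d :* (k :* (p :* y))) refl _ _ _ _ _ _ ⟩
        a r * ((1# - z * s) * (Q ^ r * b i r M)) + d r * ((1# - z * s) * (Q ^ r * b i (suc r) M))
          ≈⟨ +-cong (*-congˡ (∂-b r M)) (*-congˡ (∂-b⁺ r M)) ⟩
        a r * (Q ^ M * (u * c i r M) + Q ^ r * ∂ z (c i r) M) + d r * (Q ^ M * (v * c i r M) + Q ^ r * ∂ z (c i r) M)
          ≈⟨ solve 8 (λ a d q p u v c e → a :* (q :* (u :* c) :+ p :* e) :+ d :* (q :* (v :* c) :+ p :* e)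
               := q :* ((a :* u :+ d :* v) :* c) :+ (a :+ d) :* p :* e) refl _ _ _ _ _ _ _ _ ⟩
        _ ∎
        where
        u = (1# + z * (Q * Q ^ r)) * (1# + z * s * Q ^ r)
        v = z * s * (1# + Q ^ r) * (1# + s * Q ^ r)

    y : Carrier
    y = z * Q

    -- Completes the square r² + 2r + 1. At zQ the outer exponent belongs to `l` and the inner one
    -- to `ν`, whereas at z they belong to `μ` and `l`; hence the two indices trade places in the
    -- recurrences.
    yν : ∀ r → y * ν r ≈ μ z (suc r)
    yν r = begin
      z * Q * (μ (z * Q) r * Q ^ r)          ≈⟨ *-congˡ (*-congʳ (μ-zQ z r)) ⟩
      z * Q * (μ z r * Q ^ r * Q ^ r)        ≈⟨ solve 4 (λ z q m p → z :* q :* (m :* p :* p) := m :* (z :* (q :* (p :* p)))) refl _ _ _ _ ⟩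
      μ z r * (z * (Q * (Q ^ r * Q ^ r)))    ≈⟨ μ-suc z r ⟨
      μ z (suc r) ∎

    yν^ : ∀ n r → y ^ n * ν r ^ n ≈ μ z (suc r) ^ n
    yν^ n r = trans (sym (^-distrib-* y (ν r) n)) (^-congˡ n (yν r))

    -- Modulo ∂ both b_r and b_{r+1} become multiples of E c_r; the multiples of
    -- the former (X), after a shift of r, and of the latter (Y) match the two
    -- halves of W-expand.
    recurrence : ∀ R M → M ℕ.< R → ∀ {v w α β} a d {ζ ζ′} →
      v ≈ comb i R α β M → (∀ r → α r ≈ a r * Q ^ r) → (∀ r → β r ≈ d r * Q ^ r) →
      w ≈ combᶜ i R ζ ζ′ M → a 0 ≈ 0# → (∀ r → Yᶜ d r ≈ ζ r) → (∀ r → Xᶜ a (suc r) ≈ ζ′ r) →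
      (1# - z * s) * v ≈ Q ^ M * w + ∂ z (λ N → sum< R (λ r → (a r + d r) * Q ^ r * c i r N)) M
    recurrence R M M<R a d v≈ α≈ β≈ w≈ a0 Y≈ X≈ =
      trans (*-congˡ v≈) (trans (reduce R M M<R a d α≈ β≈) (+-congʳ (*-congˡ
        (trans (combᶜ-shift i R (Xᶜ a) (Yᶜ d) M M<R (trans (*-congʳ a0) (zeroˡ _)))
               (trans (combᶜ-cong i R M Y≈ X≈) (sym w≈))))))

    private
      -- The four terms on the right of the recurrence combine into a product. It is used for `ω`
      -- with λ′ = l_r and for `ω′` with λ′ = l_{r+1}, so that both halves are compared in the same
      -- shape.
      y-powers : ∀ G L λ′ m r →
        y ^ m * (y * (G * (ν r * ν r ^ m * (λ′ * L)) + y * (G * (ν r * (ν r * ν r ^ m) * L)))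
                 + z * s * (G * (ν r ^ m * (λ′ * (λ′ * L))) + y * (G * (ν r * ν r ^ m * (λ′ * L)))))
          ≈ G * L * μ z (suc r) ^ m * ((λ′ + μ z (suc r)) * (μ z (suc r) + z * s * λ′))
      y-powers G L λ′ m r = begin
        _ ≈⟨ solve 8 (λ G L l Y y n N k →
               Y :* (y :* (G :* (n :* N :* (l :* L)) :+ y :* (G :* (n :* (n :* N) :* L)))
                     :+ k :* (G :* (N :* (l :* (l :* L))) :+ y :* (G :* (n :* N :* (l :* L)))))
               := G :* L :* (Y :* N) :* ((l :+ y :* n) :* (y :* n :+ k :* l))) refl G L λ′ (y ^ m) y (ν r) (ν r ^ m) (z * s) ⟩
        G * L * (y ^ m * ν r ^ m) * ((λ′ + y * ν r) * (y * ν r + z * s * λ′))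
          ≈⟨ *-cong (*-congˡ (yν^ m r)) (*-cong (+-congˡ (yν r)) (+-congʳ (yν r))) ⟩
        G * L * μ z (suc r) ^ m * ((λ′ + μ z (suc r)) * (μ z (suc r) + z * s * λ′)) ∎

    -- Taking the difference of neighbouring i gives the b_r-coefficient the factor μ_r - l_r =
    -- μ_r(1 - Q^r), which vanishes at r = 0 as the shift requires, and the b_{r+1}-coefficient the
    -- factor l_r - μ_{r+1} = l_r(1 - zQ^(r+1)), which occurs in `ω`.
    recurrence-middle : ∀ m n → ∃ λ (ψ : ℕ → Carrier) → ∀ R M → M ℕ.< R →
      (1# - z * s) * (VG z (suc m) (suc n) M - VG z m (suc (suc n)) M)
        ≈ Q ^ M * (y ^ m * (y * (VG y (suc n) (suc m) M + y * VG y n (suc (suc m)) M)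
                            + z * s * (VG y (suc (suc n)) m M + y * VG y (suc n) (suc m) M)))
          + ∂ z (λ N → sum< R (λ r → ψ r * c i r N)) M
    recurrence-middle m n = _ , λ R M M<R → recurrence R M M<R a d
      (trans (+-cong (VG-expand inv (suc m) (suc n) R M M<R)
                     (trans (-‿cong (VG-expand inv m (suc (suc n)) R M M<R)) (comb-neg i R _ _ M)))
             (comb-+ i R _ _ _ _ M))
      (λ r → solve 5 (λ g u p L N → g :* (u :* p :* L) :* (:1 :+ p) :* (u :* N) :- g :* (u :* p :* (u :* p :* L)) :* (:1 :+ p) :* N
               := g :* (:1 :+ p) :* u :* L :* N :* (u :- u :* p) :* p) refl (γ z r) (μ z r) (Q ^ r) (l z r ^ n) (μ z r ^ m))
      (λ r → solve 7 (λ g λ′ L x p v N → (:- (g :* (λ′ :* L) :* (p :* (:1 :+ x)))) :* (v :* N)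
                          :+ (:- ((:- (g :* (λ′ :* (λ′ :* L)) :* (p :* (:1 :+ x)))) :* N))
               := g :* (λ′ :* L) :* (:1 :+ x) :* N :* (λ′ :- v) :* p) refl (γ z r) (l z r) (l z r ^ n) (z * (Q * Q ^ r)) (Q ^ r) (μ z (suc r)) (μ z (suc r) ^ m))
      (combᶜ-* i R (y ^ m) M (combᶜ-+ i R M
        (combᶜ-* i R y M (combᶜ-+ i R M (W-expand (suc n) (suc m) R M M<R)
                                        (combᶜ-* i R y M (W-expand n (suc (suc m)) R M M<R))))
        (combᶜ-* i R (z * s) M (combᶜ-+ i R M (W-expand (suc (suc n)) m R M M<R)
                                        (combᶜ-* i R y M (W-expand (suc n) (suc m) R M M<R))))))
      (solve 5 (λ g p u L N → g :* (:1 :+ p) :* u :* L :* N :* (u :- u :* :1) := :0) refl _ _ (μ z 0) _ _)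
      (λ r → trans (Y-id r) (sym (y-powers _ _ _ m r)))
      (λ r → trans (X-id r) (sym (y-powers _ _ _ m r)))
      where
      a d : ℕ → Carrier
      a r = γ z r * (1# + Q ^ r) * μ z r * l z r ^ n * μ z r ^ m * (μ z r - μ z r * Q ^ r)
      d r = γ z r * (l z r * l z r ^ n) * (1# + z * (Q * Q ^ r)) * μ z (suc r) ^ m * (l z r - μ z (suc r))
      Y-id : ∀ r → Yᶜ d r ≈ γ z r * (1# - z * (Q * Q ^ r)) * (1# + Q ^ r) * l z r ^ n * μ z (suc r) ^ m
                             * ((l z r + μ z (suc r)) * (μ z (suc r) + z * s * l z r))
      Y-id r = begin
        Yᶜ d r
          ≈⟨ *-congʳ (*-congˡ (+-congˡ (-‿cong (μ-suc z r)))) ⟩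
        γ z r * (u * p * L) * (1# + z * (Q * p)) * N * (u * p - u * (z * (Q * (p * p)))) * (z * s * (1# + p) * (1# + s * p))
          ≈⟨ solve 7 (λ g u p L z s N → g :* (u :* p :* L) :* (:1 :+ z :* (s :* s :* p)) :* N :* (u :* p :- u :* (z :* (s :* s :* (p :* p)))) :* (z :* s :* (:1 :+ p) :* (:1 :+ s :* p))
              := g :* (:1 :- z :* (s :* s :* p)) :* (:1 :+ p) :* L :* N :* ((u :* p :+ u :* (z :* (s :* s :* (p :* p)))) :* (u :* (z :* (s :* s :* (p :* p))) :+ z :* s :* (u :* p))))
              refl (γ z r) u p L z s N ⟩
        γ z r * (1# - z * (Q * p)) * (1# + p) * L * N * ((u * p + u * (z * (Q * (p * p)))) * (u * (z * (Q * (p * p))) + z * s * (u * p)))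
          ≈⟨ *-congˡ (*-cong (+-congˡ (μ-suc z r)) (+-congʳ (μ-suc z r))) ⟨
        _ ∎
        where
        p = Q ^ r
        u = μ z r
        L = l z r ^ n
        N = μ z (suc r) ^ m
      X-id : ∀ r → Xᶜ a (suc r) ≈ γ z (suc r) * (1# - Q ^ suc r) * (1# + z * (Q * Q ^ suc r)) * l z (suc r) ^ n * μ z (suc r) ^ m
                             * ((l z (suc r) + μ z (suc r)) * (μ z (suc r) + z * s * l z (suc r)))
      X-id r = solve 8 (λ g u p L z s N q → g :* (:1 :+ p) :* u :* L :* N :* (u :- u :* p) :* ((:1 :+ z :* (q :* p)) :* (:1 :+ z :* s :* p))
          := g :* (:1 :- p) :* (:1 :+ z :* (q :* p)) :* L :* N :* ((u :* p :+ u) :* (u :+ z :* s :* (u :* p))))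
          refl (γ z (suc r)) (μ z (suc r)) (Q ^ suc r) (l z (suc r) ^ n) z s (μ z (suc r) ^ m) Q

    -- With n = 0 no eigenvalue `l` supplies the factor Q^r in the first term, so `VG₀-expand` is
    -- used for it. The difference again carries 1 - Q^r.
    recurrence-last : ∀ m → ∃ λ (ψ : ℕ → Carrier) → ∀ R M → M ℕ.< R →
      (1# - z * s) * (VG z (suc m) 0 M - VG z m 1 M)
        ≈ Q ^ M * (y ^ m * (y * VG y 0 (suc m) M + z * s * VG y 1 m M))
          + ∂ z (λ N → sum< R (λ r → ψ r * c i r N)) M
    recurrence-last m = _ , λ R M M<R → recurrence R M M<R a d
      (trans (+-cong (VG₀-expand inv (suc m) R M M<R)
                     (trans (-‿cong (VG-expand inv m 1 R M M<R)) (comb-neg i R _ _ M)))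
             (comb-+ i R _ _ _ _ M))
      (λ r → solve 4 (λ g u p N → g :* (:1 :+ :1) :* p :* (u :* N) :- g :* (u :* p :* :1) :* (:1 :+ p) :* N
               := g :* u :* N :* (:1 :- p) :* p) refl (γ z r) (μ z r) (Q ^ r) (μ z r ^ m))
      β≈
      (combᶜ-* i R (y ^ m) M (combᶜ-+ i R M
        (combᶜ-* i R y M (W-expand 0 (suc m) R M M<R))
        (combᶜ-* i R (z * s) M (W-expand 1 m R M M<R))))
      (solve 3 (λ g u N → g :* u :* N :* (:1 :- :1) := :0) refl _ (μ z 0) _)
      (λ r → trans (Y-id r) (sym (y-powers₀ _ _ r)))
      (λ r → trans (X-id r) (sym (y-powers₀ _ _ r)))
      where
      a d : ℕ → Carrier
      a r = γ z r * μ z r * μ z r ^ m * (1# - Q ^ r)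
      d r = γ z r * μ z (suc r) ^ m * l z r * (1# - z * (Q * Q ^ r))
      y-powers₀ : ∀ G λ′ r →
        y ^ m * (y * (G * (ν r * ν r ^ m * 1#)) + z * s * (G * (ν r ^ m * (λ′ * 1#))))
          ≈ G * μ z (suc r) ^ m * (μ z (suc r) + z * s * λ′)
      y-powers₀ G λ′ r = begin
        _ ≈⟨ solve 7 (λ G l Y y n N k →
               Y :* (y :* (G :* (n :* N :* :1)) :+ k :* (G :* (N :* (l :* :1))))
               := G :* (Y :* N) :* (y :* n :+ k :* l)) refl G λ′ (y ^ m) y (ν r) (ν r ^ m) (z * s) ⟩
        G * (y ^ m * ν r ^ m) * (y * ν r + z * s * λ′)
          ≈⟨ *-cong (*-congˡ (yν^ m r)) (+-congʳ (yν r)) ⟩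
        G * μ z (suc r) ^ m * (μ z (suc r) + z * s * λ′) ∎
      β≈ : ∀ r → - (γ z r * (1# + 1#) * Q ^ r) * (μ z (suc r) * μ z (suc r) ^ m)
                 + - (- (γ z r * (l z r * 1#) * (Q ^ r * (1# + z * (Q * Q ^ r)))) * μ z (suc r) ^ m) ≈ d r * Q ^ r
      β≈ r = begin
        _ ≈⟨ +-congʳ (*-congˡ (*-congʳ (μ-suc z r))) ⟩
        - (γ z r * (1# + 1#) * p) * (u * (z * (Q * (p * p))) * N) + - (- (γ z r * (u * p * 1#) * (p * (1# + z * (Q * p)))) * N)
          ≈⟨ solve 6 (λ g u p z q N → (:- (g :* (:1 :+ :1) :* p)) :* (u :* (z :* (q :* (p :* p))) :* N)
                  :+ (:- ((:- (g :* (u :* p :* :1) :* (p :* (:1 :+ z :* (q :* p))))) :* N))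
                 := g :* N :* (u :* p) :* (:1 :- z :* (q :* p)) :* p) refl (γ z r) u p z Q N ⟩
        d r * p ∎
        where
        p = Q ^ r
        u = μ z r
        N = μ z (suc r) ^ m
      Y-id : ∀ r → Yᶜ d r ≈ γ z r * (1# - z * (Q * Q ^ r)) * (1# + Q ^ r) * μ z (suc r) ^ m
                             * (μ z (suc r) + z * s * l z r)
      Y-id r = begin
        Yᶜ d r
          ≈⟨ solve 6 (λ g u p z s N → g :* N :* (u :* p) :* (:1 :- z :* (s :* s :* p)) :* (z :* s :* (:1 :+ p) :* (:1 :+ s :* p))
              := g :* (:1 :- z :* (s :* s :* p)) :* (:1 :+ p) :* N :* (u :* (z :* (s :* s :* (p :* p))) :+ z :* s :* (u :* p)))
              refl (γ z r) u p z s N ⟩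
        γ z r * (1# - z * (Q * p)) * (1# + p) * N * (u * (z * (Q * (p * p))) + z * s * (u * p))
          ≈⟨ *-congˡ (+-congʳ (μ-suc z r)) ⟨
        _ ∎
        where
        p = Q ^ r
        u = μ z r
        N = μ z (suc r) ^ m
      X-id : ∀ r → Xᶜ a (suc r) ≈ γ z (suc r) * (1# - Q ^ suc r) * (1# + z * (Q * Q ^ suc r)) * μ z (suc r) ^ m
                             * (μ z (suc r) + z * s * l z (suc r))
      X-id r = solve 7 (λ g u p z s N q → g :* u :* N :* (:1 :- p) :* ((:1 :+ z :* (q :* p)) :* (:1 :+ z :* s :* p))
          := g :* (:1 :- p) :* (:1 :+ z :* (q :* p)) :* N :* (u :+ z :* s :* (u :* p)))
          refl (γ z (suc r)) (μ z (suc r)) (Q ^ suc r) z s (μ z (suc r) ^ m) Q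

    -- There is no neighbour to subtract and the b_r-coefficient does not vanish at r = 0, so
    -- `recurrence` does not apply; the multiples of E c_r are regrouped before the shift instead.
    recurrence-first : ∀ n → ∃ λ (ψ : ℕ → Carrier) → ∀ R M → M ℕ.< R →
      (1# - z * s) * VG z 0 (suc n) M
        ≈ Q ^ M * (VG y (suc n) 0 M + y * VG y n 1 M)
          + ∂ z (λ N → sum< R (λ r → ψ r * c i r N)) M
    recurrence-first n = _ , λ R M M<R →
      trans (*-congˡ (VG-expand inv 0 (suc n) R M M<R))
        (trans (reduce R M M<R a d
           (λ r → solve 4 (λ g u p L → g :* (u :* p :* L) :* (:1 :+ p) :* :1 := g :* (u :* L) :* (:1 :+ p) :* p)
                    refl (γ z r) (μ z r) (Q ^ r) (l z r ^ n))
           (λ r → solve 4 (λ g L p x → (:- (g :* L :* (p :* (:1 :+ x)))) :* :1 := (:- (g :* L :* (:1 :+ x))) :* p)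
                    refl (γ z r) (l z r * l z r ^ n) (Q ^ r) (z * (Q * Q ^ r))))
          (+-congʳ (*-congˡ (begin
            sum< R (λ r → (Xᶜ a r + Yᶜ d r) * c i r M)
              ≈⟨ sum<-cong R (λ r → *-congʳ (split r)) ⟩
            sum< R (λ r → (X r + Y r) * c i r M)
              ≈⟨ combᶜ-shift i R X Y M M<R (solve 4 (λ g u L x → g :* (u :* L) :* (:1 :- :1) :* (:1 :+ :1) :* x := :0) refl _ (μ z 0) _ _) ⟩
            combᶜ i R Y (X ∘ suc) M
              ≈⟨ combᶜ-cong i R M Y-id X-id ⟩
            combᶜ i R (λ r → ω (suc n) 0 r + y * ω n 1 r) (λ r → ω′ (suc n) 0 r + y * ω′ n 1 r) M
              ≈⟨ combᶜ-+ i R M (W-expand (suc n) 0 R M M<R) (combᶜ-* i R y M (W-expand n 1 R M M<R)) ⟨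
            VG y (suc n) 0 M + y * VG y n 1 M ∎))))
      where
      a d X Y : ℕ → Carrier
      a r = γ z r * (μ z r * l z r ^ n) * (1# + Q ^ r)
      d r = - (γ z r * (l z r * l z r ^ n) * (1# + z * (Q * Q ^ r)))
      X r = γ z r * (μ z r * l z r ^ n) * (1# - Q ^ r) * (1# + Q ^ r) * (1# + z * (Q * Q ^ r))
      Y r = γ z r * (l z r * l z r ^ n) * (1# + Q ^ r) * (1# + z * (Q * Q ^ r)) * (1# - z * (Q * Q ^ r))
      -- Up to common factors the sum is (1 + zsQ^r) - zsQ^r(1 + sQ^r) = 1 - zQ^(2r+1), written as
      -- (1 - Q^r) + Q^r(1 - zQ^(r+1)); the first part vanishes at r = 0.
      split : ∀ r → Xᶜ a r + Yᶜ d r ≈ X r + Y r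
      split r = solve 6 (λ g u p L z s →
          g :* (u :* L) :* (:1 :+ p) :* ((:1 :+ z :* (s :* s :* p)) :* (:1 :+ z :* s :* p))
            :+ (:- (g :* (u :* p :* L) :* (:1 :+ z :* (s :* s :* p)))) :* (z :* s :* (:1 :+ p) :* (:1 :+ s :* p))
          := g :* (u :* L) :* (:1 :- p) :* (:1 :+ p) :* (:1 :+ z :* (s :* s :* p))
            :+ g :* (u :* p :* L) :* (:1 :+ p) :* (:1 :+ z :* (s :* s :* p)) :* (:1 :- z :* (s :* s :* p)))
          refl (γ z r) (μ z r) (Q ^ r) (l z r ^ n) z s
      y-powers₁ : ∀ G L λ′ r → G * (1# * (λ′ * L)) + y * (G * (ν r * 1# * L)) ≈ G * L * (λ′ + μ z (suc r))
      y-powers₁ G L λ′ r = trans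
        (solve 5 (λ G L l y n → G :* (:1 :* (l :* L)) :+ y :* (G :* (n :* :1 :* L)) := G :* L :* (l :+ y :* n)) refl G L λ′ y (ν r))
        (*-congˡ (+-congˡ (yν r)))
      Y-id : ∀ r → Y r ≈ ω (suc n) 0 r + y * ω n 1 r
      Y-id r = sym (begin
        _ ≈⟨ y-powers₁ _ _ _ r ⟩
        _ ≈⟨ *-congˡ (+-congˡ (μ-suc z r)) ⟩
        γ z r * (1# - z * (Q * Q ^ r)) * (1# + Q ^ r) * l z r ^ n * (l z r + μ z r * (z * (Q * (Q ^ r * Q ^ r))))
          ≈⟨ solve 6 (λ g u p L z q → g :* (:1 :- z :* (q :* p)) :* (:1 :+ p) :* L :* (u :* p :+ u :* (z :* (q :* (p :* p))))
               := g :* (u :* p :* L) :* (:1 :+ p) :* (:1 :+ z :* (q :* p)) :* (:1 :- z :* (q :* p)))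
             refl (γ z r) (μ z r) (Q ^ r) (l z r ^ n) z Q ⟩
        Y r ∎)
      X-id : ∀ r → X (suc r) ≈ ω′ (suc n) 0 r + y * ω′ n 1 r
      X-id r = sym (trans (y-powers₁ _ _ _ r)
        (solve 5 (λ g u p L x → g :* (:1 :- p) :* (:1 :+ x) :* L :* (u :* p :+ u)
             := g :* (u :* L) :* (:1 :- p) :* (:1 :+ p) :* (:1 :+ x))
           refl (γ z (suc r)) (μ z (suc r)) (Q ^ suc r) (l z (suc r) ^ n) (z * (Q * Q ^ suc r))))

-- Formal power series

module PowerSeries (A : CommutativeRing 0ℓ 0ℓ) where
  open CommutativeRing A
  open import Relation.Binary.Reasoning.Setoid setoid
  open RingSolver A

  Series : Set
  Series = ℕ → Carrier

  infix  4 _≋_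
  infixl 6 _⊹_
  infixl 7 _·_ _⋆_

  _≋_ : Series → Series → Set
  f ≋ g = ∀ n → f n ≈ g n

  _⊹_ : Series → Series → Series
  (f ⊹ g) n = f n + g n

  ⊟_ : Series → Series
  (⊟ f) n = - f n

  _⋆_ : Carrier → Series → Series
  (a ⋆ f) n = a * f n

  const : Carrier → Series
  const a zero    = a
  const a (suc _) = 0#

  _·_ : Series → Series → Series
  (f · g) zero    = f 0 * g 0
  (f · g) (suc n) = f 0 * g (suc n) + ((f ∘ suc) · g) n

  ·-cong : ∀ {f f′ g g′} → f ≋ f′ → g ≋ g′ → f · g ≋ f′ · g′
  ·-cong p q zero    = *-cong (p 0) (q 0)
  ·-cong p q (suc n) = +-cong (*-cong (p 0) (q (suc n))) (·-cong (p ∘ suc) q n)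

  ·-zeroˡ : ∀ g → (λ _ → 0#) · g ≋ (λ _ → 0#)
  ·-zeroˡ g zero    = zeroˡ _
  ·-zeroˡ g (suc n) = trans (+-cong (zeroˡ _) (·-zeroˡ g n)) (+-identityˡ _)

  const-· : ∀ a g → const a · g ≋ a ⋆ g
  const-· a g zero    = refl
  const-· a g (suc n) = trans (+-congˡ (·-zeroˡ g n)) (+-identityʳ _)

  ·-distribʳ : ∀ h f g → (f ⊹ g) · h ≋ f · h ⊹ g · h
  ·-distribʳ h f g zero    = distribʳ _ _ _
  ·-distribʳ h f g (suc n) = trans (+-congˡ (·-distribʳ h (f ∘ suc) (g ∘ suc) n))
    (solve 5 (λ a b h x y → (a :+ b) :* h :+ (x :+ y) := (a :* h :+ x) :+ (b :* h :+ y)) refl _ _ _ _ _)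

  ⋆-· : ∀ a f g → (a ⋆ f) · g ≋ a ⋆ (f · g)
  ⋆-· a f g zero    = *-assoc _ _ _
  ⋆-· a f g (suc n) = trans (+-congˡ (⋆-· a (f ∘ suc) g n))
    (solve 4 (λ a b h x → a :* b :* h :+ a :* x := a :* (b :* h :+ x)) refl _ _ _ _)

  ·-assoc : ∀ f g h → (f · g) · h ≋ f · (g · h)
  ·-assoc f g h zero    = *-assoc _ _ _
  ·-assoc f g h (suc n) = begin
    f 0 * g 0 * h (suc n) + ((f 0 ⋆ (g ∘ suc) ⊹ (f ∘ suc) · g) · h) n
      ≈⟨ +-congˡ (·-distribʳ h _ _ n) ⟩
    f 0 * g 0 * h (suc n) + (((f 0 ⋆ (g ∘ suc)) · h) n + (((f ∘ suc) · g) · h) n)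
      ≈⟨ +-congˡ (+-cong (⋆-· (f 0) (g ∘ suc) h n) (·-assoc (f ∘ suc) g h n)) ⟩
    f 0 * g 0 * h (suc n) + (f 0 * ((g ∘ suc) · h) n + ((f ∘ suc) · (g · h)) n)
      ≈⟨ solve 5 (λ a b c x y → a :* b :* c :+ (a :* x :+ y) := a :* (b :* c :+ x) :+ y) refl _ _ _ _ _ ⟩
    f 0 * (g 0 * h (suc n) + ((g ∘ suc) · h) n) + ((f ∘ suc) · (g · h)) n ∎

  ·-sucʳ : ∀ f g n → (f · g) (suc n) ≈ f (suc n) * g 0 + (f · (g ∘ suc)) n
  ·-sucʳ f g zero    = +-comm _ _
  ·-sucʳ f g (suc n) = trans (+-congˡ (·-sucʳ (f ∘ suc) g n))
    (solve 3 (λ a b c → a :+ (b :+ c) := b :+ (a :+ c)) refl _ _ _)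

  ·-comm : ∀ f g → f · g ≋ g · f
  ·-comm f g zero    = *-comm _ _
  ·-comm f g (suc n) = trans (+-cong (*-comm _ _) (·-comm (f ∘ suc) g n)) (sym (·-sucʳ g f n))

  ·-identityˡ : ∀ f → const 1# · f ≋ f
  ·-identityˡ f n = trans (const-· 1# f n) (*-identityˡ _)

  series-isCommutativeRing : IsCommutativeRing _≋_ _⊹_ _·_ ⊟_ (λ _ → 0#) (const 1#)
  series-isCommutativeRing = record
    { isRing = record
      { +-isAbelianGroup = record
        { isGroup = record
          { isMonoid = record
            { isSemigroup = record
              { isMagma = record
                { isEquivalence = record
                  { refl = λ _ → refl ; sym = λ p n → sym (p n) ; trans = λ p q n → trans (p n) (q n) }
                ; ∙-cong = λ p q n → +-cong (p n) (q n) }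
              ; assoc = λ f g h n → +-assoc _ _ _ }
            ; identity = (λ f n → +-identityˡ _) , (λ f n → +-identityʳ _) }
          ; inverse = (λ f n → -‿inverseˡ _) , (λ f n → -‿inverseʳ _)
          ; ⁻¹-cong = λ p n → -‿cong (p n) }
        ; comm = λ f g n → +-comm _ _ }
      ; *-cong = ·-cong
      ; *-assoc = ·-assoc
      ; *-identity = ·-identityˡ , (λ f n → trans (·-comm f _ n) (·-identityˡ f n))
      ; distrib = (λ f g h n → trans (·-comm f _ n) (trans (·-distribʳ f g h n) (+-cong (·-comm g f n) (·-comm h f n))))
                , ·-distribʳ }
    ; *-comm = ·-comm }

  seriesRing : CommutativeRing 0ℓ 0ℓ
  seriesRing = record { isCommutativeRing = series-isCommutativeRing }

  module S = CommutativeRing seriesRing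
  open import Algebra.Properties.Semiring.Exp S.semiring using () renaming (_^_ to _^ˢ_)
  open import Algebra.Properties.Semiring.Exp semiring using (_^_)

  X : Series
  X zero          = 0#
  X (suc zero)    = 1#
  X (suc (suc _)) = 0#

  X-·-suc : ∀ f n → (X · f) (suc n) ≈ f n
  X-·-suc f n = begin
    0# * f (suc n) + ((X ∘ suc) · f) n  ≈⟨ +-cong (zeroˡ _) (·-cong {X ∘ suc} {const 1#} X∘suc (λ _ → refl) n) ⟩
    0# + (const 1# · f) n               ≈⟨ trans (+-identityˡ _) (·-identityˡ f n) ⟩
    f n                                 ∎
    where
    X∘suc : X ∘ suc ≋ const 1#
    X∘suc zero    = refl
    X∘suc (suc _) = refl

  X^-below : ∀ n f m → m ℕ.< n → (X ^ˢ n · f) m ≈ 0#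
  X^-below (suc n) f zero    _       = trans (*-congʳ (zeroˡ _)) (zeroˡ _)
  X^-below (suc n) f (suc m) (s≤s h) = begin
    (X · X ^ˢ n · f) (suc m)      ≈⟨ ·-assoc X (X ^ˢ n) f (suc m) ⟩
    (X · (X ^ˢ n · f)) (suc m)    ≈⟨ X-·-suc _ m ⟩
    (X ^ˢ n · f) m                ≈⟨ X^-below n f m h ⟩
    0#                            ∎

  X^-above : ∀ n f m → (X ^ˢ n · f) (n ℕ.+ m) ≈ f m
  X^-above zero    f m = ·-identityˡ f m
  X^-above (suc n) f m = begin
    (X · X ^ˢ n · f) (suc (n ℕ.+ m))      ≈⟨ ·-assoc X (X ^ˢ n) f (suc (n ℕ.+ m)) ⟩
    (X · (X ^ˢ n · f)) (suc (n ℕ.+ m))    ≈⟨ X-·-suc _ (n ℕ.+ m) ⟩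
    (X ^ˢ n · f) (n ℕ.+ m)                ≈⟨ X^-above n f m ⟩
    f m                                   ∎

  const-cong : ∀ {a b} → a ≈ b → const a ≋ const b
  const-cong p zero    = p
  const-cong p (suc _) = refl

  const-+ : ∀ a b → const (a + b) ≋ const a ⊹ const b
  const-+ a b zero    = refl
  const-+ a b (suc _) = sym (+-identityˡ _)

  const-* : ∀ a b → const (a * b) ≋ const a · const b
  const-* a b zero    = refl
  const-* a b (suc n) = sym (trans (const-· a (const b) (suc n)) (zeroʳ a))

  const-neg : ∀ a → const (- a) ≋ ⊟ const a
  const-neg a zero    = refl
  const-neg a (suc n) = solve 0 (:0 := :- :0) refl

  const-^ : ∀ a n → const (a ^ n) ≋ const a ^ˢ n
  const-^ a zero    = λ _ → refl
  const-^ a (suc n) = S.trans (const-* a (a ^ n)) (·-cong {const a} (λ _ → refl) (const-^ a n))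

  geometric : Carrier → Series
  geometric a n = a ^ n

  geometric-inverse : ∀ a → (const 1# S.- X · const a) · geometric a ≋ const 1#
  geometric-inverse a n = trans (S.trans {(const 1# S.- X · const a) · geometric a}
      (S.distribʳ (geometric a) (const 1#) (S.- (X · const a)))
      (S.+-cong (·-identityˡ (geometric a)) (S.sym (-‿distribˡ-* (X · const a) (geometric a)))) n) (coef n)
    where
    open import Algebra.Properties.Ring S.ring using (-‿distribˡ-*)
    coef : ∀ n → geometric a n - (X · const a · geometric a) n ≈ const 1# n
    coef zero = trans (+-congˡ (-‿cong (*-congʳ (zeroˡ a)))) (solve 1 (λ a → :1 :- :0 :* a := :1) refl 1#)
    coef (suc n) = begin
      a * a ^ n - (X · const a · geometric a) (suc n)
        ≈⟨ +-congˡ (-‿cong (·-assoc X (const a) (geometric a) (suc n))) ⟩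
      a * a ^ n - (X · (const a · geometric a)) (suc n)
        ≈⟨ +-congˡ (-‿cong (trans (X-·-suc _ n) (const-· a (geometric a) n))) ⟩
      a * a ^ n - a * a ^ n
        ≈⟨ -‿inverseʳ _ ⟩
      0# ∎

  -- The substitution X ↦ aX; for a = q² it is the map x ↦ xQ.
  dilate : Carrier → Series → Series
  dilate a f n = a ^ n * f n

  dilate-· : ∀ a f g → dilate a (f · g) ≋ dilate a f · dilate a g
  dilate-· a f g zero    = solve 2 (λ f g → :1 :* (f :* g) := (:1 :* f) :* (:1 :* g)) refl _ _
  dilate-· a f g (suc n) = begin
    a * a ^ n * (f 0 * g (suc n) + ((f ∘ suc) · g) n)
      ≈⟨ solve 5 (λ a p f g x → a :* p :* (f :* g :+ x) := :1 :* f :* (a :* p :* g) :+ a :* (p :* x)) refl _ _ _ _ _ ⟩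
    1# * f 0 * (a * a ^ n * g (suc n)) + a * (a ^ n * ((f ∘ suc) · g) n)
      ≈⟨ +-congˡ (*-congˡ (dilate-· a (f ∘ suc) g n)) ⟩
    1# * f 0 * (a * a ^ n * g (suc n)) + a * (dilate a (f ∘ suc) · dilate a g) n
      ≈⟨ +-congˡ (trans (sym (⋆-· a (dilate a (f ∘ suc)) (dilate a g) n))
           (·-cong {a ⋆ dilate a (f ∘ suc)} {dilate a f ∘ suc} {dilate a g} (λ m → sym (*-assoc a (a ^ m) (f (suc m)))) (λ _ → refl) n)) ⟩
    (dilate a f · dilate a g) (suc n) ∎

  dilate-cong : ∀ a {f g} → f ≋ g → dilate a f ≋ dilate a g
  dilate-cong a p n = *-congˡ (p n)

  dilate-+ : ∀ a f g → dilate a (f ⊹ g) ≋ dilate a f ⊹ dilate a g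
  dilate-+ a f g n = distribˡ _ _ _

  dilate-const : ∀ a b → dilate a (const b) ≋ const b
  dilate-const a b zero    = *-identityˡ b
  dilate-const a b (suc n) = zeroʳ _

  dilate-X : ∀ a → dilate a X ≋ X · const a
  dilate-X a n = sym (trans (·-comm X (const a) n) (trans (const-· a X n) (eq n)))
    where
    eq : ∀ n → a * X n ≈ a ^ n * X n
    eq zero          = trans (zeroʳ _) (sym (zeroʳ _))
    eq (suc zero)    = *-congʳ (sym (*-identityʳ a))
    eq (suc (suc n)) = trans (zeroʳ _) (sym (zeroʳ _))

  -- Σ_M w_M X^M f_M
  L : (ℕ → Carrier) → (ℕ → Series) → Series
  L w f zero    = w 0 * f 0 0
  L w f (suc m) = w 0 * f 0 (suc m) + L (w ∘ suc) (f ∘ suc) m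

  L-cong′ : ∀ {w w′ f g} m → (∀ M → w M ≈ w′ M) → (∀ M → M ℕ.≤ m → f M ≋ g M) → L w f m ≈ L w′ g m
  L-cong′ zero    p q = *-cong (p 0) (q 0 z≤n 0)
  L-cong′ (suc m) p q = +-cong (*-cong (p 0) (q 0 z≤n (suc m))) (L-cong′ m (p ∘ suc) (λ M M≤m → q (suc M) (s≤s M≤m)))

  L-cong : ∀ {w f g} → (∀ M → f M ≋ g M) → L w f ≋ L w g
  L-cong q m = L-cong′ m (λ _ → refl) (λ M _ → q M)

  L-unfold : ∀ w f → L w f ≋ const (w 0) · f 0 ⊹ X · L (w ∘ suc) (f ∘ suc)
  L-unfold w f zero = sym (trans (+-congˡ (zeroˡ _)) (+-identityʳ _))
  L-unfold w f (suc m) = sym (+-cong (const-· (w 0) (f 0) (suc m)) (X-·-suc _ m))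

  L-+ : ∀ w f g → L w (λ M → f M ⊹ g M) ≋ L w f ⊹ L w g
  L-+ w f g zero    = distribˡ _ _ _
  L-+ w f g (suc m) = trans (+-cong (distribˡ _ _ _) (L-+ (w ∘ suc) (f ∘ suc) (g ∘ suc) m))
    (solve 4 (λ a b c d → (a :+ b) :+ (c :+ d) := (a :+ c) :+ (b :+ d)) refl _ _ _ _)

  L-· : ∀ w a f → L w (λ M → a · f M) ≋ a · L w f
  L-· w a f m = trans (go m) (sym (unfolded m))
    where
    unfolded : a · L w f ≋ const (w 0) · (a · f 0) ⊹ X · (a · L (w ∘ suc) (f ∘ suc))
    unfolded = S.trans (·-cong {a} (λ _ → refl) (L-unfold w f))
      (SS.solve 5 (λ a c f x l → a SS.:* (c SS.:* f SS.:+ x SS.:* l) SS.:= c SS.:* (a SS.:* f) SS.:+ x SS.:* (a SS.:* l)) (λ _ → refl)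
         a (const (w 0)) (f 0) X (L (w ∘ suc) (f ∘ suc)))
      where module SS = RingSolver seriesRing
    go : L w (λ M → a · f M) ≋ const (w 0) · (a · f 0) ⊹ X · (a · L (w ∘ suc) (f ∘ suc))
    go zero    = sym (trans (+-congˡ (zeroˡ _)) (+-identityʳ _))
    go (suc m) = trans (+-congˡ (L-· (w ∘ suc) a (f ∘ suc) m))
      (sym (+-cong (const-· (w 0) (a · f 0) (suc m)) (X-·-suc _ m)))

  L-neg : ∀ w f → L w (λ M → ⊟ f M) ≋ ⊟ L w f
  L-neg w f zero    = solve 2 (λ w f → w :* (:- f) := :- (w :* f)) refl _ _
  L-neg w f (suc m) = trans (+-congˡ (L-neg (w ∘ suc) (f ∘ suc) m))
    (solve 3 (λ w f l → w :* (:- f) :+ (:- l) := :- (w :* f :+ l)) refl _ _ _)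

  L-const : ∀ w (κ : ℕ → Carrier) f → L w (λ M → const (κ M) · f M) ≋ L (λ M → w M * κ M) f
  L-const w κ f zero    = sym (*-assoc _ _ _)
  L-const w κ f (suc m) = +-cong (trans (*-congˡ (const-· (κ 0) (f 0) (suc m))) (sym (*-assoc _ _ _)))
                                 (L-const (w ∘ suc) (κ ∘ suc) (f ∘ suc) m)

  dilate-L : ∀ a w f → dilate a (L w f) ≋ L (λ M → w M * a ^ M) (λ M → dilate a (f M))
  dilate-L a w f zero    = solve 2 (λ w f → :1 :* (w :* f) := w :* :1 :* (:1 :* f)) refl _ _
  dilate-L a w f (suc m) = begin
    a * a ^ m * (w 0 * f 0 (suc m) + L (w ∘ suc) (f ∘ suc) m)
      ≈⟨ solve 5 (λ a p w f l → a :* p :* (w :* f :+ l) := w :* :1 :* (a :* p :* f) :+ a :* (p :* l)) refl _ _ _ _ _ ⟩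
    w 0 * 1# * (a * a ^ m * f 0 (suc m)) + a * (a ^ m * L (w ∘ suc) (f ∘ suc) m)
      ≈⟨ +-congˡ (trans (*-congˡ (dilate-L a (w ∘ suc) (f ∘ suc) m)) (pull m (λ M → w (suc M) * a ^ M) _)) ⟩
    w 0 * 1# * (a * a ^ m * f 0 (suc m)) + L (λ M → a * (w (suc M) * a ^ M)) (λ M → dilate a (f (suc M))) m
      ≈⟨ +-congˡ (L-cong′ m (λ M → solve 3 (λ a w p → a :* (w :* p) := w :* (a :* p)) refl _ _ _)
                  (λ _ _ _ → refl)) ⟩
    w 0 * 1# * (a * a ^ m * f 0 (suc m)) + L (λ M → w (suc M) * (a * a ^ M)) (λ M → dilate a (f (suc M))) m ∎
    where
    pull : ∀ m v g → a * L v g m ≈ L (λ M → a * v M) g m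
    pull zero    v g = sym (*-assoc _ _ _)
    pull (suc m) v g = trans (distribˡ _ _ _) (+-cong (sym (*-assoc _ _ _)) (pull m (v ∘ suc) (g ∘ suc)))

module WeightStep (A : CommutativeRing 0ℓ 0ℓ) (s : CommutativeRing.Carrier A) where
  open CommutativeRing A
  open import Algebra.Properties.Semiring.Exp semiring using (_^_)
  open Base A s

  -- The ratio of consecutive values of (-1;q²)_M (-q;q²)_M q^M / 2, to which the
  -- factor of the summand depending on N_1 = M alone simplifies.
  ratio : ℕ → Carrier
  ratio M = s * ((1# + Q ^ M) * (1# + s * Q ^ M))

  IsWeight : (ℕ → Carrier) → Set
  IsWeight w = ∀ M → w (suc M) ≈ w M * ratio M

-- The weighted sum over N_1 and the substitution x ↦ xQ

module GeneratingFunction (A : CommutativeRing 0ℓ 0ℓ) (s : CommutativeRing.Carrier A)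
  (iq : ℕ → CommutativeRing.Carrier A)
  (iq-inv : Base.IsInverseFamily A s (CommutativeRing.1# A) iq)
  (w : ℕ → CommutativeRing.Carrier A) (w-step : WeightStep.IsWeight A s w) where

  private
    module A = CommutativeRing A
  open import Algebra.Properties.Semiring.Exp A.semiring using () renaming (_^_ to _^ᴬ_)
  open Base A s using () renaming (Q to q²)
  open WeightStep A s using (ratio)
  open PowerSeries A hiding (module S)
  open CommutativeRing seriesRing
  open import Relation.Binary.Reasoning.Setoid setoid
  open import Algebra.Properties.Semiring.Exp semiring using (_^_; ^-congˡ)
  open RingSolver seriesRing

  𝕤 : Carrier
  𝕤 = const s

  const-pow : ∀ n → const (q² ^ᴬ n) ≈ (𝕤 * 𝕤) ^ n
  const-pow n = trans (const-^ q² n) (^-congˡ n (const-* s s))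

  const-sub : ∀ a b → const (a A.- b) ≈ const a - const b
  const-sub a b = trans (const-+ a (A.- b)) (+-congˡ (const-neg b))

  iq-inv′ : Base.IsInverseFamily seriesRing 𝕤 1# (const ∘ iq)
  iq-inv′ j = begin
    (1# - 1# * (𝕤 * 𝕤) ^ suc j) * const (iq j)
      ≈⟨ *-congʳ (+-congˡ (-‿cong (*-congˡ (const-pow (suc j))))) ⟨
    (1# - 1# * const (q² ^ᴬ suc j)) * const (iq j)
      ≈⟨ *-congʳ (+-congˡ (-‿cong (const-* A.1# _))) ⟨
    (1# - const (A.1# A.* q² ^ᴬ suc j)) * const (iq j)
      ≈⟨ *-congʳ (const-sub A.1# _) ⟨
    const (A.1# A.- A.1# A.* q² ^ᴬ suc j) * const (iq j)
      ≈⟨ const-* _ (iq j) ⟨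
    const ((A.1# A.- A.1# A.* q² ^ᴬ suc j) A.* iq j)
      ≈⟨ const-cong (iq-inv j) ⟩
    1# ∎

  open BaileyChain seriesRing 𝕤 (const ∘ iq) iq-inv′

  ix : ℕ → Carrier
  ix j = geometric (q² ^ᴬ suc j)

  ix-inv : IsInverseFamily X ix
  ix-inv j = begin
    (1# - X * Q ^ suc j) * ix j                 ≈⟨ *-congʳ (+-congˡ (-‿cong (*-congˡ {X} (const-pow (suc j))))) ⟨
    (1# - X * const (q² ^ᴬ suc j)) * ix j       ≈⟨ geometric-inverse (q² ^ᴬ suc j) ⟩
    1# ∎

  G : ℕ → ℕ → Carrier
  G m n = L w (VG X m n)

  σ : Carrier → Carrier
  σ = dilate q²

  Y : Carrier
  Y = X * Q

  σX : σ X ≈ Y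
  σX = trans (dilate-X q²) (*-congˡ {X} (const-* s s))

  σ-^ : ∀ f n → σ (f ^ n) ≈ σ f ^ n
  σ-^ f zero    = dilate-const q² A.1#
  σ-^ f (suc n) = trans (dilate-· q² f (f ^ n)) (*-congˡ {σ f} (σ-^ f n))

  σ𝕤 : σ 𝕤 ≈ 𝕤
  σ𝕤 = dilate-const q² s

  σQ : σ Q ≈ Q
  σQ = trans (dilate-· q² 𝕤 𝕤) (*-cong σ𝕤 σ𝕤)

  σQ^ : ∀ n → σ (Q ^ n) ≈ Q ^ n
  σQ^ n = trans (σ-^ Q n) (^-congˡ n σQ)

  σ-recip : ∀ i n → σ (recip (const ∘ i) n) ≈ recip (const ∘ i) n
  σ-recip i zero    = dilate-const q² A.1#
  σ-recip i (suc n) = trans (dilate-· q² (const (i 0)) _) (*-cong (dilate-const q² (i 0)) (σ-recip (i ∘ suc) n))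

  σ-ρ : ∀ M r → σ (ρ M r) ≈ ρ M r
  σ-ρ M       zero    = σ-recip iq M
  σ-ρ zero    (suc r) = λ _ → A.zeroʳ _
  σ-ρ (suc M) (suc r) = σ-ρ M r

  σ-sum< : ∀ n f → σ (sum< n f) ≈ sum< n (σ ∘ f)
  σ-sum< zero    f = λ _ → A.zeroʳ _
  σ-sum< (suc n) f = trans (dilate-+ q² (sum< n f) (f n)) (+-congʳ {σ (f n)} (σ-sum< n f))

  σ-D : ∀ {z z′ f g} → σ z ≈ z′ → (∀ N → σ (f N) ≈ g N) → ∀ M → σ (D z f M) ≈ D z′ g M
  σ-D {z} {z′} {f} {g} p h M = trans (σ-sum< (suc M) _) (sum<-cong (suc M) (λ N →
    trans (dilate-· q² (z ^ N * Q ^ (N ℕ.* N) * ρ M N) (f N)) (*-cong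
      (trans (dilate-· q² (z ^ N * Q ^ (N ℕ.* N)) (ρ M N)) (*-cong
        (trans (dilate-· q² (z ^ N) (Q ^ (N ℕ.* N))) (*-cong (trans (σ-^ z N) (^-congˡ N p)) (σQ^ (N ℕ.* N))))
        (σ-ρ M N)))
      (h N))))

  σ-iter : ∀ {z z′ f g} n → σ z ≈ z′ → (∀ N → σ (f N) ≈ g N) → ∀ M → σ (iter z n f M) ≈ iter z′ n g M
  σ-iter zero    p h = h
  σ-iter (suc n) p h = σ-D p (σ-iter n p h)

  σ-unit : ∀ N → σ (unit N) ≈ unit N
  σ-unit zero    = dilate-const q² A.1#
  σ-unit (suc N) = λ _ → A.zeroʳ _

  σ-VG : ∀ m n M → σ (VG X m n M) ≈ VG Y m n M
  σ-VG m n = σ-iter m σX (λ N → trans (dilate-· q² (1# + Q ^ N) (iter (X * Q) n unit N)) (*-cong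
      (trans (dilate-+ q² 1# (Q ^ N)) (+-cong (dilate-const q² A.1#) (σQ^ N)))
      (σ-iter n (trans (dilate-· q² X Q) (*-cong σX σQ)) σ-unit N)))

  Lσ : (ℕ → Carrier) → Carrier
  Lσ f = L w (λ M → Q ^ M * f M)

  -- The substitution x ↦ xQ multiplies X^M by Q^M, which is the operator E in front of the
  -- sequence; inside the sequence it replaces X by XQ.
  Lσ-VG : ∀ m n → Lσ (VG Y m n) ≈ σ (G m n)
  Lσ-VG m n = begin
    L w (λ M → Q ^ M * VG Y m n M)
      ≈⟨ L-cong (λ M → *-cong (sym (const-pow M)) (sym (σ-VG m n M))) ⟩
    L w (λ M → const (q² ^ᴬ M) * σ (VG X m n M))
      ≈⟨ L-const w (q² ^ᴬ_) _ ⟩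
    L (λ M → w M A.* q² ^ᴬ M) (λ M → σ (VG X m n M))
      ≈⟨ dilate-L q² w (VG X m n) ⟨
    σ (G m n) ∎

  Lσ-+ : ∀ f g → Lσ (λ M → f M + g M) ≈ Lσ f + Lσ g
  Lσ-+ f g = trans (L-cong (λ M → distribˡ (Q ^ M) (f M) (g M))) (L-+ w _ _)

  Lσ-* : ∀ a f → Lσ (λ M → a * f M) ≈ a * Lσ f
  Lσ-* a f = trans (L-cong (λ M → solve 3 (λ q a f → q :* (a :* f) := a :* (q :* f)) refl (Q ^ M) a (f M))) (L-· w a _)

  -- Shifting the sequence by one index gives a factor X and the weights w_{M+1} = w_M `ratio M`,
  -- which is precisely the subtracted term.
  L-∂ : ∀ f → L w (∂ X f) ≈ 0#
  L-∂ f = begin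
    L w (∂ X f)
      ≈⟨ L-+ w (shift f) (λ M → - (X * 𝕤 * ((1# + Q ^ M) * (1# + 𝕤 * Q ^ M)) * f M)) ⟩
    L w (shift f) + L w (λ M → - (X * 𝕤 * ((1# + Q ^ M) * (1# + 𝕤 * Q ^ M)) * f M))
      ≈⟨ +-cong L-shift (L-neg w _) ⟩
    X * L (w ∘ suc) f - L w (λ M → X * 𝕤 * ((1# + Q ^ M) * (1# + 𝕤 * Q ^ M)) * f M)
      ≈⟨ +-congˡ {X * L (w ∘ suc) f} (-‿cong L-ratio) ⟩
    X * L (w ∘ suc) f - X * L (w ∘ suc) f
      ≈⟨ -‿inverseʳ (X * L (w ∘ suc) f) ⟩
    0# ∎
    where
    L-shift : L w (shift f) ≈ X * L (w ∘ suc) f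
    L-shift zero    = A.trans (A.zeroʳ _) (A.sym (A.zeroˡ _))
    L-shift (suc m) = A.trans (A.trans (A.+-congʳ (A.zeroʳ _)) (A.+-identityˡ _)) (A.sym (X-·-suc (L (w ∘ suc) f) m))
    ratio≈ : ∀ M → 𝕤 * ((1# + Q ^ M) * (1# + 𝕤 * Q ^ M)) ≈ const (ratio M)
    ratio≈ M = sym (begin
      const (ratio M)
        ≈⟨ const-* s _ ⟩
      𝕤 * const ((A.1# A.+ q² ^ᴬ M) A.* (A.1# A.+ s A.* q² ^ᴬ M))
        ≈⟨ *-congˡ {𝕤} (const-* _ _) ⟩
      𝕤 * (const (A.1# A.+ q² ^ᴬ M) * const (A.1# A.+ s A.* q² ^ᴬ M))
        ≈⟨ *-congˡ {𝕤} (*-cong (trans (const-+ A.1# _) (+-congˡ {1#} (const-pow M)))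
             (trans (const-+ A.1# _) (+-congˡ {1#} (trans (const-* s _) (*-congˡ {𝕤} (const-pow M)))))) ⟩
      𝕤 * ((1# + Q ^ M) * (1# + 𝕤 * Q ^ M)) ∎)
    L-ratio : L w (λ M → X * 𝕤 * ((1# + Q ^ M) * (1# + 𝕤 * Q ^ M)) * f M) ≈ X * L (w ∘ suc) f
    L-ratio = begin
      L w (λ M → X * 𝕤 * ((1# + Q ^ M) * (1# + 𝕤 * Q ^ M)) * f M)
        ≈⟨ L-cong (λ M → trans (solve 4 (λ x s k f → x :* s :* k :* f := x :* (s :* k :* f)) refl X 𝕤 _ (f M))
             (*-congˡ {X} (*-congʳ {f M} (ratio≈ M)))) ⟩
      L w (λ M → X * (const (ratio M) * f M))
        ≈⟨ L-· w X _ ⟩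
      X * L w (λ M → const (ratio M) * f M)
        ≈⟨ *-congˡ {X} (L-const w ratio f) ⟩
      X * L (λ M → w M A.* ratio M) f
        ≈⟨ *-congˡ {X} (λ m → L-cong′ m (λ M → A.sym (w-step M)) (λ _ _ _ → A.refl)) ⟩
      X * L (w ∘ suc) f ∎

  -- A sequence identity that only holds for M < R suffices for the coefficients of x^m with m < R.
  L-recurrence : ∀ v f (ψ : ℕ → Carrier) →
    (∀ R M → M ℕ.< R → (1# - X * 𝕤) * v M ≈ Q ^ M * f M + ∂ X (λ N → sum< R (λ r → ψ r * c ix r N)) M) →
    (1# - X * 𝕤) * L w v ≈ Lσ f
  L-recurrence v f ψ h m = A.trans (A.sym (L-· w (1# - X * 𝕤) v m))
    (A.trans (L-cong′ {w} {w} m (λ _ → A.refl) (λ M M≤m → h (suc m) M (s≤s M≤m)))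
      (A.trans (L-+ w (λ M → Q ^ M * f M) _ m)
        (A.trans (A.+-congˡ (L-∂ (λ N → sum< (suc m) (λ r → ψ r * c ix r N)) m)) (A.+-identityʳ _))))

  L-minus : ∀ v u → L w (λ M → v M - u M) ≈ L w v - L w u
  L-minus v u = trans (L-+ w v (λ M → - u M)) (+-congˡ {L w v} (L-neg w u))

  G-first : ∀ n → (1# - X * 𝕤) * G 0 (suc n) ≈ σ (G (suc n) 0) + Y * σ (G n 1)
  G-first n = trans (L-recurrence (VG X 0 (suc n)) (λ M → VG Y (suc n) 0 M + Y * VG Y n 1 M) (proj₁ rec) (proj₂ rec))
    (trans (Lσ-+ _ _) (+-cong (Lσ-VG (suc n) 0) (trans (Lσ-* Y _) (*-congˡ {Y} (Lσ-VG n 1)))))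
    where rec = recurrence-first ix-inv n

  G-middle : ∀ m n → (1# - X * 𝕤) * (G (suc m) (suc n) - G m (suc (suc n)))
    ≈ Y ^ m * (Y * (σ (G (suc n) (suc m)) + Y * σ (G n (suc (suc m))))
               + X * 𝕤 * (σ (G (suc (suc n)) m) + Y * σ (G (suc n) (suc m))))
  G-middle m n = trans (*-congˡ {1# - X * 𝕤} (sym (L-minus (VG X (suc m) (suc n)) (VG X m (suc (suc n))))))
    (trans (L-recurrence (λ M → VG X (suc m) (suc n) M - VG X m (suc (suc n)) M)
       (λ M → Y ^ m * (Y * (VG Y (suc n) (suc m) M + Y * VG Y n (suc (suc m)) M)
                            + X * 𝕤 * (VG Y (suc (suc n)) m M + Y * VG Y (suc n) (suc m) M)))
       (proj₁ rec) (proj₂ rec))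
    (trans (Lσ-* (Y ^ m) _) (*-congˡ {Y ^ m} (trans (Lσ-+ _ _) (+-cong
      (trans (Lσ-* Y _) (*-congˡ {Y} (trans (Lσ-+ _ _) (+-cong (Lσ-VG (suc n) (suc m))
        (trans (Lσ-* Y _) (*-congˡ {Y} (Lσ-VG n (suc (suc m)))))))))
      (trans (Lσ-* (X * 𝕤) _) (*-congˡ {X * 𝕤} (trans (Lσ-+ _ _) (+-cong (Lσ-VG (suc (suc n)) m)
        (trans (Lσ-* Y _) (*-congˡ {Y} (Lσ-VG (suc n) (suc m)))))))))))))
    where rec = recurrence-middle ix-inv m n

  G-last : ∀ m → (1# - X * 𝕤) * (G (suc m) 0 - G m 1)
    ≈ Y ^ m * (Y * σ (G 0 (suc m)) + X * 𝕤 * σ (G 1 m))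
  G-last m = trans (*-congˡ {1# - X * 𝕤} (sym (L-minus (VG X (suc m) 0) (VG X m 1))))
    (trans (L-recurrence (λ M → VG X (suc m) 0 M - VG X m 1 M)
       (λ M → Y ^ m * (Y * VG Y 0 (suc m) M + X * 𝕤 * VG Y 1 m M)) (proj₁ rec) (proj₂ rec))
    (trans (Lσ-* (Y ^ m) _) (*-congˡ {Y ^ m} (trans (Lσ-+ _ _) (+-cong
      (trans (Lσ-* Y _) (*-congˡ {Y} (Lσ-VG 0 (suc m))))
      (trans (Lσ-* (X * 𝕤) _) (*-congˡ {X * 𝕤} (Lσ-VG 1 m))))))))
    where rec = recurrence-last ix-inv m

-- Overpartitions

module Conditions where
  open import Data.Nat using (_+_; _*_; _<_)
  open ≡

  good : ℕ → ℕ → Overpartition → Bool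
  good k i ov = if cond1 i ov then (if cond2 k ov then cond3 k ov else false) else false

  ⌊⌋-sound : ∀ {P : Set} (d : Dec P) → ⌊ d ⌋ ≡ true → P
  ⌊⌋-sound (yes p) _ = p

  ⌊⌋-complete : ∀ {P : Set} (d : Dec P) → P → ⌊ d ⌋ ≡ true
  ⌊⌋-complete (yes _) _ = refl
  ⌊⌋-complete (no ¬p) p = ⊥-elim (¬p p)

  if-∧ : ∀ {a b} → (if a then b else false) ≡ true → a ≡ true × b ≡ true
  if-∧ {true} p = refl , p

  ∧-if : ∀ {a b} → a ≡ true → b ≡ true → (if a then b else false) ≡ true
  ∧-if refl p = p

  if-imp : ∀ {P Q : Set} {q : Dec Q} (p : Dec P) → (P → Q) → (if ⌊ p ⌋ then ⌊ q ⌋ else true) ≡ true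
  if-imp {q = q} (yes p) f = ⌊⌋-complete q (f p)
  if-imp         (no _)  f = refl

  ∧-true : ∀ {a b} → a ∧ b ≡ true → a ≡ true × b ≡ true
  ∧-true {true} p = refl , p

  allUpTo-sound : ∀ n P → allUpTo n P ≡ true → ∀ t → t ≤ n → P t ≡ true
  allUpTo-sound zero    P h zero    z≤n = h
  allUpTo-sound (suc n) P h t t≤ with t ℕ.≟ suc n
  ... | yes refl = proj₁ (if-∧ h)
  ... | no  t≢   = allUpTo-sound n P (proj₂ (if-∧ {P (suc n)} h)) t (ℕₚ.≤-pred (ℕₚ.≤∧≢⇒< t≤ t≢))

  allUpTo-complete : ∀ n P → (∀ t → P t ≡ true) → allUpTo n P ≡ true
  allUpTo-complete zero    P h = h 0
  allUpTo-complete (suc n) P h = ∧-if (h (suc n)) (allUpTo-complete n P h)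

  fNon-beyond : ∀ ov t → length ov < t → fNon ov t ≡ 0
  fNon-beyond []       (suc t)       _       = refl
  fNon-beyond (x ∷ ov) (suc (suc t)) (s≤s h) = fNon-beyond ov (suc t) h

  fOv-beyond : ∀ ov t → length ov < t → fOv ov t ≡ 0
  fOv-beyond []       (suc t)       _       = refl
  fOv-beyond (x ∷ ov) (suc (suc t)) (s≤s h) = fOv-beyond ov (suc t) h

  -- Stated at a position rather than at `t`, so that after removing two entries position j + 2
  -- becomes j by computation for j ≥ 1.
  Window2 : ℕ → Overpartition → ℕ → Set
  Window2 k ov j = fOv ov j + fNon ov j + fOv ov (j + 1) + fNon ov (j + 2) + 1 ≤ k

  Window3 : ℕ → Overpartition → ℕ → Set
  Window3 k ov j = 1 ≤ fNon ov (j + 1) → fNon ov (j + 2) + 2 ≤ k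

  Cond2 : ℕ → Overpartition → ℕ → Set
  Cond2 k ov t = Window2 k ov (2 * t)

  Cond3 : ℕ → Overpartition → ℕ → Set
  Cond3 k ov t = Window3 k ov (2 * t)

  Good : ℕ → ℕ → Overpartition → Set
  Good k i ov = (fOv ov 1 + fNon ov 2 + 1 ≤ i) × (∀ t → Cond2 k ov t) × (∀ t → Cond3 k ov t)

  private
    beyond : ∀ {n t} → ¬ (t ≤ n) → n < 2 * t
    beyond {n} {t} t≰n = ℕₚ.<-≤-trans (ℕₚ.≰⇒> t≰n) (ℕₚ.m≤m+n t (t + 0))

  -- The decision procedure stops at the length of the list; beyond it all frequencies are 0 and the
  -- conditions reduce to k ≥ 1 or to a false premise.
  good-sound : ∀ k i ov → good k i ov ≡ true → Good k i ov
  good-sound k i ov h = c1 , c2 , c3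
    where
    h₁ = if-∧ {cond1 i ov} h
    h₂ = if-∧ {cond2 k ov} (proj₂ h₁)
    c1 = ⌊⌋-sound (fOv ov 1 + fNon ov 2 + 1 ≤? i) (proj₁ h₁)
    -- Condition (2) at t = 0 already forces k ≥ 1.
    k≥1 : 1 ≤ k
    k≥1 = ℕₚ.≤-trans (ℕₚ.m≤n+m 1 _) (⌊⌋-sound (_ ≤? k) (allUpTo-sound (length ov) _ (proj₁ h₂) 0 z≤n))
    c2 : ∀ t → Cond2 k ov t
    c2 t with t ≤? length ov
    ... | yes t≤ = ⌊⌋-sound (_ ≤? k) (allUpTo-sound (length ov) _ (proj₁ h₂) t t≤)
    ... | no  t≰
      rewrite fOv-beyond ov (2 * t) (beyond t≰) | fNon-beyond ov (2 * t) (beyond t≰)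
            | fOv-beyond ov (2 * t + 1) (ℕₚ.<-≤-trans (beyond t≰) (ℕₚ.m≤m+n _ 1))
            | fNon-beyond ov (2 * t + 2) (ℕₚ.<-≤-trans (beyond t≰) (ℕₚ.m≤m+n _ 2)) = k≥1
    c3 : ∀ t → Cond3 k ov t
    c3 t f≥1 with t ≤? length ov
    ... | yes t≤ = ⌊⌋-sound (_ ≤? k) (subst (λ b → (if b then ⌊ fNon ov (2 * t + 2) + 2 ≤? k ⌋ else true) ≡ true)
                     (⌊⌋-complete (1 ≤? fNon ov (2 * t + 1)) f≥1) (allUpTo-sound (length ov) _ (proj₂ h₂) t t≤))
    ... | no  t≰ = ⊥-elim (ℕₚ.n≮0 (subst (1 ≤_) (fNon-beyond ov (2 * t + 1) (ℕₚ.<-≤-trans (beyond t≰) (ℕₚ.m≤m+n _ 1))) f≥1))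

  good-complete : ∀ k i ov → Good k i ov → good k i ov ≡ true
  good-complete k i ov (c1 , c2 , c3) = ∧-if (⌊⌋-complete (_ ≤? i) c1)
    (∧-if (allUpTo-complete (length ov) _ (λ t → ⌊⌋-complete (_ ≤? k) (c2 t)))
          (allUpTo-complete (length ov) _ (λ t → if-imp (1 ≤? fNon ov (2 * t + 1)) (c3 t))))

  size : ℕ × Bool → ℕ
  size c = proj₁ c + bit (proj₂ c)

  implies : ℕ → ℕ → ℕ → Bool
  implies k f₁ f₂ = if ⌊ 1 ≤? f₁ ⌋ then ⌊ f₂ + 2 ≤? k ⌋ else true

  -- What concerns the parts 1 and 2 alone: condition (1), and condition (3) at t = 0.
  local : ℕ → ℕ → ℕ × Bool → ℕ × Bool → Bool
  local k i (f₁ , b₁) (f₂ , _) = ⌊ bit b₁ + f₂ + 1 ≤? i ⌋ ∧ implies k f₁ f₂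

  private
    fNon-tail : ∀ c₁ c₂ ov j → 1 ≤ j → fNon (c₁ ∷ c₂ ∷ ov) (2 + j) ≡ fNon ov j
    fNon-tail c₁ c₂ ov (suc j) _ = refl

    -- Starts one step later than its analogue for (3): (2) reads the frequencies at 2t itself, and
    -- at position 0 these are 0 by convention, while those of the removed part 2 need not be.
    cond2-tail : ∀ k c₁ c₂ ov t → Cond2 k (c₁ ∷ c₂ ∷ ov) (2 + t) ≡ Cond2 k ov (1 + t)
    cond2-tail k c₁ c₂ ov t = cong (Window2 k (c₁ ∷ c₂ ∷ ov)) (ℕₚ.*-suc 2 (suc t))

    cond3-tail : ∀ k c₁ c₂ ov t → Cond3 k (c₁ ∷ c₂ ∷ ov) (1 + t) ≡ Cond3 k ov t
    cond3-tail k c₁ c₂ ov t = trans (cong (Window3 k (c₁ ∷ c₂ ∷ ov)) (ℕₚ.*-suc 2 t))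
      (cong₂ (λ a b → (1 ≤ a → b + 2 ≤ k))
        (fNon-tail c₁ c₂ ov (2 * t + 1) (ℕₚ.m≤n+m 1 _))
        (fNon-tail c₁ c₂ ov (2 * t + 2) (ℕₚ.≤-trans (s≤s z≤n) (ℕₚ.m≤n+m 2 _))))

    -- Truncated subtraction is harmless because `a + 1` is positive, which forces c ≤ k.
    ∸-to : ∀ a k c → a + 1 ≤ k ∸ c → a + 1 + c ≤ k
    ∸-to a k c h = subst (a + 1 + c ≤_) (ℕₚ.m∸n+n≡m c≤k) (ℕₚ.+-monoˡ-≤ c h)
      where
      c≤k : c ≤ k
      c≤k with c ≤? k
      ... | yes p = p
      ... | no ¬p = ⊥-elim (ℕₚ.n≮0 (ℕₚ.≤-trans (ℕₚ.m≤n+m 1 a) (subst (a + 1 ≤_) (ℕₚ.m≤n⇒m∸n≡0 (ℕₚ.<⇒≤ (ℕₚ.≰⇒> ¬p))) h)))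

    rearrange : ∀ b f x y → b + f + x + y + 1 ≡ x + y + 1 + (f + b)
    rearrange = solve-∀ where open import Data.Nat.Tactic.RingSolver using (solve-∀)

  -- Condition (2) at t = 1 bounds the parts 2 together with the next overlined odd and
  -- non-overlined even part; for the remaining overpartition this is condition (1) with i replaced
  -- by k minus the number of parts 2. Condition (2) at t = 0 follows from (1) and i ≤ k, and all
  -- others only move down by 2.
  good-peel : ∀ k i c₁ c₂ ov → i ≤ k →
    good k i (c₁ ∷ c₂ ∷ ov) ≡ local k i c₁ c₂ ∧ good k (k ∸ size c₂) ov
  good-peel k i c₁@(f₁ , b₁) c₂@(f₂ , b₂) ov i≤k = ⇔→≡ {z = true} (mk⇔ to from)
    where
    to : good k i (c₁ ∷ c₂ ∷ ov) ≡ true → local k i c₁ c₂ ∧ good k (k ∸ size c₂) ov ≡ true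
    to h with good-sound k i (c₁ ∷ c₂ ∷ ov) h
    ... | p , q , r = cong₂ _∧_
      (cong₂ _∧_ (⌊⌋-complete (_ ≤? i) p) (if-imp (1 ≤? f₁) (r 0)))
      (good-complete k (k ∸ size c₂) ov
        ( ℕₚ.m+n≤o⇒m≤o∸n (fOv ov 1 + fNon ov 2 + 1)
            (subst (_≤ k) (rearrange (bit b₂) f₂ (fOv ov 1) (fNon ov 2)) (q 1))
        , q′
        , λ t → subst (λ A → A) (cond3-tail k c₁ c₂ ov t) (r (1 + t))))
      where
      q′ : ∀ t → Cond2 k ov t
      -- The remaining list has no parts at position 0, so its condition at t = 0 is weaker than the
      -- original one at t = 1.
      q′ zero    = ℕₚ.≤-trans (ℕₚ.+-monoˡ-≤ 1 (ℕₚ.+-monoˡ-≤ (fNon ov 2) (ℕₚ.m≤n+m (fOv ov 1) (bit b₂ + f₂)))) (q 1)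
      q′ (suc t) = subst (λ A → A) (cond2-tail k c₁ c₂ ov t) (q (2 + t))
    from : local k i c₁ c₂ ∧ good k (k ∸ size c₂) ov ≡ true → good k i (c₁ ∷ c₂ ∷ ov) ≡ true
    from h with ∧-true {local k i c₁ c₂} h
    ... | l , g with ∧-true {⌊ bit b₁ + f₂ + 1 ≤? i ⌋} {implies k f₁ f₂} l | good-sound k (k ∸ size c₂) ov g
    ... | l₁ , l₂ | p , q , r = good-complete k i (c₁ ∷ c₂ ∷ ov) (c1 , q′ , r′)
      where
      c1 = ⌊⌋-sound (bit b₁ + f₂ + 1 ≤? i) l₁
      q′ : ∀ t → Cond2 k (c₁ ∷ c₂ ∷ ov) t
      q′ zero          = ℕₚ.≤-trans c1 i≤k
      q′ (suc zero)    = subst (_≤ k) (sym (rearrange (bit b₂) f₂ (fOv ov 1) (fNon ov 2))) (∸-to (fOv ov 1 + fNon ov 2) k (size c₂) p)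
      q′ (suc (suc t)) = subst (λ A → A) (sym (cond2-tail k c₁ c₂ ov t)) (q (1 + t))
      r′ : ∀ t → Cond3 k (c₁ ∷ c₂ ∷ ov) t
      r′ zero f≥1 = ⌊⌋-sound (_ ≤? k) (subst (λ b → (if b then ⌊ f₂ + 2 ≤? k ⌋ else true) ≡ true) (⌊⌋-complete (1 ≤? f₁) f≥1) l₂)
      r′ (suc t)  = subst (λ A → A) (sym (cond3-tail k c₁ c₂ ov t)) (r t)

  good-[] : ∀ k i → 1 ≤ k → 1 ≤ i → good k i [] ≡ true
  good-[] k i k≥1 i≥1 = good-complete k i [] (i≥1 , c2 , c3)
    where
    c2 : ∀ t → Cond2 k [] t
    c2 zero    = k≥1
    c2 (suc t) = subst (Window2 k []) (sym (ℕₚ.*-suc 2 t)) k≥1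
    c3 : ∀ t → Cond3 k [] t
    c3 t h rewrite ℕₚ.+-comm (2 * t) 1 = ⊥-elim (ℕₚ.n≮0 h)

  -- The index i = 0 arises when the parts 2 use up the whole bound; such terms must contribute
  -- nothing.
  good-zero : ∀ k ov → good k 0 ov ≡ false
  good-zero k ov with fOv ov 1 + fNon ov 2 + 1 ≤? 0
  ... | yes p = ⊥-elim (ℕₚ.n≮0 (ℕₚ.≤-trans (ℕₚ.m≤n+m 1 _) p))
  ... | no _  = refl

open Conditions

-- The recursion for overpartitions with bounded frequencies

module Recursion (R : CommutativeRing 0ℓ 0ℓ) (s : CommutativeRing.Carrier R) (k : ℕ) where
  open CommutativeRing R
  open import Algebra.Properties.Semiring.Exp semiring using (_^_)
  open FiniteSums R

  -- The two values of `F` are the cases without and with an overlined part 2, which lowers the next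
  -- bound by one more.
  term : (ℕ → Carrier) → Carrier → (ℕ → Carrier) → ℕ → Carrier
  term ε y F j = ε j * (y ^ j * (F (k ∸ j) + y * F (k ∸ suc j)))

  -- The two sums distinguish whether the part 1 is overlined; j counts the
  -- non-overlined parts 2, and ε accounts for the non-overlined parts 1.
  recSum : Carrier → (ℕ → Carrier) → Carrier → (ℕ → Carrier) → ℕ → Carrier
  recSum x ε y F i = sum< i (term ε y F) + x * s * sum< (i ∸ 1) (term ε y F)

  -- 1 - xs times the sum of (xs)^f over the numbers f of non-overlined parts 1 allowed by (3): any
  -- f if j + 2 ≤ k, otherwise only f = 0. The value `e` is 1 for unbounded f and 1 - (xs)^(B+1) for
  -- f ≤ B.
  cutoff : Carrier → Carrier → ℕ → Carrier
  cutoff x e j = if ⌊ j ℕ.+ 2 ≤? k ⌋ then e else 1# - x * s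

module BoxSums (R : CommutativeRing 0ℓ 0ℓ) (s : CommutativeRing.Carrier R) (B : ℕ) where
  open CommutativeRing R
  open import Relation.Binary.Reasoning.Setoid setoid
  open import Algebra.Properties.Semiring.Exp semiring using (_^_; ^-homo-*)
  open RingSolver R
  open FiniteSums R

  cellSum : (ℕ × Bool → Carrier) → Carrier
  cellSum f = sum< (suc B) (λ j → f (j , false) + f (j , true))

  -- Bounding part sizes by `n` and frequencies by `B` makes the generating function a finite sum
  -- over any commutative ring.
  boxSum : ℕ → (Overpartition → Carrier) → Carrier
  boxSum zero    f = f []
  boxSum (suc n) f = cellSum (λ c → boxSum n (λ l → f (c ∷ l)))

  ind : Bool → Carrier
  ind b = if b then 1# else 0#

  -- x ^ (number of parts) * s ^ weight: a part of size j contributes x s^j.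
  mon : Carrier → Overpartition → Carrier
  mon x []      = 1#
  mon x (c ∷ l) = (x * s) ^ size c * mon (x * s) l

  P : ℕ → ℕ → ℕ → Carrier → Carrier
  P n k i x = boxSum n (λ l → ind (good k i l) * mon x l)

  cellSum-cong : ∀ {f g} → (∀ c → f c ≈ g c) → cellSum f ≈ cellSum g
  cellSum-cong h = sum<-cong (suc B) (λ j → +-cong (h _) (h _))

  cellSum-*ˡ : ∀ a f → a * cellSum f ≈ cellSum (λ c → a * f c)
  cellSum-*ˡ a f = trans (sum<-*ˡ (suc B) a _) (sum<-cong (suc B) (λ j → distribˡ _ _ _))

  boxSum-cong : ∀ n {f g} → (∀ l → f l ≈ g l) → boxSum n f ≈ boxSum n g
  boxSum-cong zero    h = h []
  boxSum-cong (suc n) h = cellSum-cong (λ c → boxSum-cong n (λ l → h (c ∷ l)))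

  boxSum-*ˡ : ∀ n a f → a * boxSum n f ≈ boxSum n (λ l → a * f l)
  boxSum-*ˡ zero    a f = refl
  boxSum-*ˡ (suc n) a f = trans (cellSum-*ˡ a (λ c → boxSum n (λ l → f (c ∷ l)))) (cellSum-cong (λ c → boxSum-*ˡ n a (λ l → f (c ∷ l))))

  cellSum-swap : ∀ (f : ℕ × Bool → ℕ × Bool → Carrier) →
    cellSum (λ c → cellSum (f c)) ≈ cellSum (λ d → cellSum (λ c → f c d))
  cellSum-swap f = begin
    sum< (suc B) (λ j → sum< (suc B) (g j false) + sum< (suc B) (g j true))
      ≈⟨ sum<-cong (suc B) (λ j → sum<-+ (suc B) _ _) ⟨
    sum< (suc B) (λ j → sum< (suc B) (λ j′ → g j false j′ + g j true j′))
      ≈⟨ sum<-swap (suc B) (suc B) _ ⟩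
    sum< (suc B) (λ j′ → sum< (suc B) (λ j → g j false j′ + g j true j′))
      ≈⟨ sum<-cong (suc B) (λ j′ → trans (sum<-cong (suc B) (λ j →
           solve 4 (λ a b c d → (a :+ b) :+ (c :+ d) := (a :+ c) :+ (b :+ d)) refl _ _ _ _)) (sum<-+ (suc B) _ _)) ⟩
    cellSum (λ d → cellSum (λ c → f c d)) ∎
    where
    g : ℕ → Bool → ℕ → Carrier
    g j b j′ = f (j , b) (j′ , false) + f (j , b) (j′ , true)

  -- `genOP` appends the largest part at the end of the list, whereas the recursion removes the
  -- smallest parts at its head; this reconciles the two orders.
  boxSum-last : ∀ n f → boxSum (suc n) f ≈ cellSum (λ c → boxSum n (λ l → f (l ++ c ∷ [])))
  boxSum-last zero    f = refl
  boxSum-last (suc n) f = trans (cellSum-cong (λ c → boxSum-last n (λ l → f (c ∷ l)))) (swap n)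
    where
    swap : ∀ n → cellSum (λ c → cellSum (λ d → boxSum n (λ l → f (c ∷ l ++ d ∷ []))))
         ≈ cellSum (λ d → cellSum (λ c → boxSum n (λ l → f (c ∷ l ++ d ∷ []))))
    swap n = cellSum-swap (λ c d → boxSum n (λ l → f (c ∷ l ++ d ∷ [])))

  ind-∧ : ∀ a b → ind (a ∧ b) ≈ ind a * ind b
  ind-∧ true  b = sym (*-identityˡ _)
  ind-∧ false b = sym (zeroˡ _)

  P-peel : ∀ n k i x → i ℕ.≤ k → P (2 ℕ.+ n) k i x ≈ cellSum (λ c₁ → cellSum (λ c₂ →
    ind (local k i c₁ c₂) * ((x * s) ^ size c₁ * (x * s * s) ^ size c₂) * P n k (k ∸ size c₂) (x * s * s)))
  P-peel n k i x i≤k = cellSum-cong (λ c₁ → cellSum-cong (λ c₂ → trans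
    (boxSum-cong n (λ l → begin
      ind (good k i (c₁ ∷ c₂ ∷ l)) * ((x * s) ^ size c₁ * ((x * s * s) ^ size c₂ * mon (x * s * s) l))
        ≈⟨ *-congʳ (reflexive (≡.cong ind (good-peel k i c₁ c₂ l i≤k))) ⟩
      ind (local k i c₁ c₂ ∧ good k (k ∸ size c₂) l) * ((x * s) ^ size c₁ * ((x * s * s) ^ size c₂ * mon (x * s * s) l))
        ≈⟨ *-congʳ (ind-∧ (local k i c₁ c₂) _) ⟩
      ind (local k i c₁ c₂) * ind (good k (k ∸ size c₂) l) * ((x * s) ^ size c₁ * ((x * s * s) ^ size c₂ * mon (x * s * s) l))
        ≈⟨ solve 5 (λ a b c d e → a :* b :* (c :* (d :* e)) := a :* (c :* d) :* (b :* e)) refl _ _ _ _ _ ⟩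
      ind (local k i c₁ c₂) * ((x * s) ^ size c₁ * (x * s * s) ^ size c₂) * (ind (good k (k ∸ size c₂) l) * mon (x * s * s) l) ∎))
    (sym (boxSum-*ˡ n _ _))))

  geometric-sum : ∀ a n → (1# - a) * sum< n (a ^_) ≈ 1# - a ^ n
  geometric-sum a zero    = trans (zeroʳ _) (sym (-‿inverseʳ 1#))
  geometric-sum a (suc n) = trans (distribˡ _ _ _) (trans (+-congʳ (geometric-sum a n))
    (solve 2 (λ a p → (:1 :- p) :+ (:1 :- a) :* p := :1 :- a :* p) refl _ _))

  sum<-ind : ∀ n i (g : ℕ → Carrier) → i ℕ.≤ n → sum< n (λ j → ind ⌊ j ℕ.+ 1 ≤? i ⌋ * g j) ≈ sum< i g
  sum<-ind n zero g _ = sum<-zero n (λ j → trans (*-congʳ (reflexive (≡.cong ind (no≤ j)))) (zeroˡ _))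
    where
    no≤ : ∀ j → ⌊ j ℕ.+ 1 ≤? 0 ⌋ ≡ false
    no≤ zero    = ≡.refl
    no≤ (suc _) = ≡.refl
  sum<-ind (suc n) (suc i) g (s≤s i≤n) = begin
    sum< (suc n) (λ j → ind ⌊ j ℕ.+ 1 ≤? suc i ⌋ * g j)    ≈⟨ sum<-head n _ ⟩
    1# * g 0 + sum< n (λ j → ind ⌊ suc j ℕ.+ 1 ≤? suc i ⌋ * g (suc j))
      ≈⟨ +-cong (*-identityˡ _) (trans (sum<-cong n (λ j → *-congʳ (reflexive (≡.cong ind (pred≤ (j ℕ.+ 1)))))) (sum<-ind n i (g ∘ suc) i≤n)) ⟩
    g 0 + sum< i (g ∘ suc)                                 ≈⟨ sum<-head i g ⟨
    sum< (suc i) g ∎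
    where
    pred≤ : ∀ a → ⌊ suc a ≤? suc i ⌋ ≡ ⌊ a ≤? i ⌋
    pred≤ a with suc a ≤? suc i | a ≤? i
    ... | yes _ | yes _ = ≡.refl
    ... | no _  | no _  = ≡.refl
    ... | yes p | no ¬q = ⊥-elim (¬q (ℕₚ.≤-pred p))
    ... | no ¬p | yes q = ⊥-elim (¬p (s≤s q))

  module _ (k : ℕ) (x : Carrier) (k≤B : k ℕ.≤ suc B) where
    open Recursion R s k

    private
      ε : ℕ → Carrier
      ε = cutoff x (1# - (x * s) ^ suc B)

    ones : ∀ f₂ → (1# - x * s) * sum< (suc B) (λ f₁ → ind (implies k f₁ f₂) * (x * s) ^ f₁) ≈ ε f₂
    ones f₂ with ⌊ f₂ ℕ.+ 2 ≤? k ⌋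
    ... | true  = trans (*-congˡ (sum<-cong (suc B) (λ { zero → *-identityˡ _ ; (suc f₁) → *-identityˡ _ })))
                        (geometric-sum (x * s) (suc B))
    ... | false = begin
      (1# - x * s) * sum< (suc B) (λ f₁ → ind (if ⌊ 1 ≤? f₁ ⌋ then false else true) * (x * s) ^ f₁)
        ≈⟨ *-congˡ (trans (sum<-head B _) (+-cong (*-identityˡ _) (sum<-zero B (λ f₁ → zeroˡ _)))) ⟩
      (1# - x * s) * (1# + 0#)
        ≈⟨ trans (*-congˡ (+-identityʳ _)) (*-identityʳ _) ⟩
      1# - x * s ∎

    P-rec : ∀ n i → i ℕ.≤ k →
      (1# - x * s) * P (2 ℕ.+ n) k i x ≈ recSum x ε (x * s * s) (λ j → P n k j (x * s * s)) i
    P-rec n i i≤k = begin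
      (1# - x * s) * P (2 ℕ.+ n) k i x
        ≈⟨ *-congˡ (P-peel n k i x i≤k) ⟩
      (1# - x * s) * cellSum (λ c₁ → cellSum (λ c₂ → body c₁ c₂))
        ≈⟨ *-congˡ (cellSum-cong (λ c₁ → sum<-cong (suc B) (both c₁))) ⟩
      (1# - x * s) * sum< (suc B) (λ f₁ → sum< (suc B) (λ f₂ → K f₁ false f₂) + sum< (suc B) (λ f₂ → K f₁ true f₂))
        ≈⟨ *-congˡ (trans (sum<-+ (suc B) _ _) (+-cong (sum<-swap (suc B) (suc B) _) (sum<-swap (suc B) (suc B) _))) ⟩
      (1# - x * s) * (sum< (suc B) (λ f₂ → sum< (suc B) (λ f₁ → K f₁ false f₂)) + sum< (suc B) (λ f₂ → sum< (suc B) (λ f₁ → K f₁ true f₂)))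
        ≈⟨ trans (distribˡ _ _ _) (+-cong (inner false) (inner true)) ⟩
      sum< (suc B) (λ f₂ → ind ⌊ f₂ ℕ.+ 1 ≤? i ⌋ * (1# * H f₂)) + sum< (suc B) (λ f₂ → ind ⌊ suc f₂ ℕ.+ 1 ≤? i ⌋ * (x * s * 1# * H f₂))
        -- The cap on the number of parts 2 is invisible, as condition (1) keeps it below i ≤ k ≤ B
        -- + 1. An overlined part 1 uses up one unit of i.
        ≈⟨ +-cong (trans (sum<-ind (suc B) i _ (ℕₚ.≤-trans i≤k k≤B)) (sum<-cong i (λ j → *-identityˡ _)))
                  (trans (sum<-cong (suc B) (λ j → *-congʳ (reflexive (≡.cong ind (shift≤ i j)))))
                    (trans (sum<-ind (suc B) (i ∸ 1) _ (ℕₚ.≤-trans (ℕₚ.m∸n≤m i 1) (ℕₚ.≤-trans i≤k k≤B)))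
                      (trans (sum<-cong (i ∸ 1) (λ j → *-congʳ (*-identityʳ _))) (sym (sum<-*ˡ (i ∸ 1) _ _))))) ⟩
      recSum x ε y F i ∎
      where
      y = x * s * s
      F : ℕ → Carrier
      F j = P n k j y
      H : ℕ → Carrier
      H = term ε y F
      body : ℕ × Bool → ℕ × Bool → Carrier
      body c₁ c₂ = ind (local k i c₁ c₂) * ((x * s) ^ size c₁ * y ^ size c₂) * F (k ∸ size c₂)
      h : ℕ → Carrier
      h f₂ = y ^ f₂ * (F (k ∸ f₂) + y * F (k ∸ suc f₂))
      K : ℕ → Bool → ℕ → Carrier
      K f₁ b₁ f₂ = ind (local k i (f₁ , b₁) (f₂ , false)) * (x * s) ^ (f₁ ℕ.+ bit b₁) * h f₂
      both : ∀ c₁ f₂ → body c₁ (f₂ , false) + body c₁ (f₂ , true) ≈ K (proj₁ c₁) (proj₂ c₁) f₂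
      both c₁ f₂ rewrite ℕₚ.+-identityʳ f₂ | ℕₚ.+-comm f₂ 1 =
        solve 6 (λ i a p y F F′ → i :* (a :* p) :* F :+ i :* (a :* (y :* p)) :* F′ := i :* a :* (p :* (F :+ y :* F′))) refl _ _ _ _ _ _
      inner : ∀ b₁ → (1# - x * s) * sum< (suc B) (λ f₂ → sum< (suc B) (λ f₁ → K f₁ b₁ f₂))
        ≈ sum< (suc B) (λ f₂ → ind ⌊ bit b₁ ℕ.+ f₂ ℕ.+ 1 ≤? i ⌋ * ((x * s) ^ bit b₁ * H f₂))
      inner b₁ = trans (sum<-*ˡ (suc B) _ _) (sum<-cong (suc B) (λ f₂ → begin
        (1# - x * s) * sum< (suc B) (λ f₁ → K f₁ b₁ f₂)
          ≈⟨ *-congˡ (sum<-cong (suc B) (λ f₁ → trans (*-congʳ (*-cong (ind-∧ ⌊ bit b₁ ℕ.+ f₂ ℕ.+ 1 ≤? i ⌋ (implies k f₁ f₂)) (^-homo-* (x * s) f₁ (bit b₁))))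
               (solve 5 (λ a b p r h → a :* b :* (p :* r) :* h := a :* (r :* h) :* (b :* p)) refl _ _ _ _ _))) ⟩
        (1# - x * s) * sum< (suc B) (λ f₁ → a₁ f₂ * ((x * s) ^ bit b₁ * h f₂) * (ind (implies k f₁ f₂) * (x * s) ^ f₁))
          ≈⟨ *-congˡ (sum<-*ˡ (suc B) _ _) ⟨
        (1# - x * s) * (a₁ f₂ * ((x * s) ^ bit b₁ * h f₂) * sum< (suc B) (λ f₁ → ind (implies k f₁ f₂) * (x * s) ^ f₁))
          ≈⟨ solve 5 (λ e a p h z → e :* (a :* (p :* h) :* z) := a :* (p :* ((e :* z) :* h))) refl _ _ _ _ _ ⟩
        a₁ f₂ * ((x * s) ^ bit b₁ * ((1# - x * s) * sum< (suc B) (λ f₁ → ind (implies k f₁ f₂) * (x * s) ^ f₁) * h f₂))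
          ≈⟨ *-congˡ (*-congˡ (*-congʳ (ones f₂))) ⟩
        a₁ f₂ * ((x * s) ^ bit b₁ * H f₂) ∎))
        where
        a₁ : ℕ → Carrier
        a₁ f₂ = ind ⌊ bit b₁ ℕ.+ f₂ ℕ.+ 1 ≤? i ⌋
      shift≤ : ∀ i j → ⌊ suc j ℕ.+ 1 ≤? i ⌋ ≡ ⌊ j ℕ.+ 1 ≤? i ∸ 1 ⌋
      shift≤ i j with suc j ℕ.+ 1 ≤? i | j ℕ.+ 1 ≤? i ∸ 1
      ... | yes _ | yes _ = ≡.refl
      ... | no _  | no _  = ≡.refl
      ... | yes (s≤s p) | no ¬q = ⊥-elim (¬q p)
      shift≤ zero    j | no ¬p | yes q = ⊥-elim (ℕₚ.n≮0 (ℕₚ.≤-trans (ℕₚ.m≤n+m 1 j) q))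
      shift≤ (suc i) j | no ¬p | yes q = ⊥-elim (¬p (s≤s q))

-- The recurrences of the multisums in the form of the overpartition recursion

module GRecursion (A : CommutativeRing 0ℓ 0ℓ) (s : CommutativeRing.Carrier A)
  (iq : ℕ → CommutativeRing.Carrier A)
  (iq-inv : Base.IsInverseFamily A s (CommutativeRing.1# A) iq)
  (w : ℕ → CommutativeRing.Carrier A) (w-step : WeightStep.IsWeight A s w) where

  private
    module A = CommutativeRing A
  open PowerSeries A using (seriesRing; X)
  open GeneratingFunction A s iq iq-inv w w-step
  open CommutativeRing seriesRing
  open import Relation.Binary.Reasoning.Setoid setoid
  open import Algebra.Properties.Semiring.Exp semiring using (_^_)
  open RingSolver seriesRing
  open FiniteSums seriesRing

  -- the multisum for k = K + 1 and i
  family : ℕ → ℕ → Carrier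
  family K zero    = 0#
  family K (suc a) = G a (K ∸ a)

  family-at : ∀ {K} a b → a ℕ.+ b ≡ K → family K (suc a) ≡ G a b
  family-at a b ≡.refl = ≡.cong (G a) (ℕₚ.m+n∸m≡n a b)

  private
    σ-reflexive : ∀ {f g} → f ≡ g → σ f ≈ σ g
    σ-reflexive ≡.refl = refl

    cut-in : ∀ j {k} {e f : Carrier} → j ℕ.+ 2 ℕ.≤ k → (if ⌊ j ℕ.+ 2 ≤? k ⌋ then e else f) ≡ e
    cut-in j {k} {e} {f} h = ≡.cong (λ b → if b then e else f) (⌊⌋-complete (j ℕ.+ 2 ≤? k) h)

    cut-out : ∀ j {k} {e f : Carrier} → ¬ (j ℕ.+ 2 ℕ.≤ k) → (if ⌊ j ℕ.+ 2 ≤? k ⌋ then e else f) ≡ f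
    cut-out j {k} h with j ℕ.+ 2 ≤? k
    ... | yes p = ⊥-elim (h p)
    ... | no _  = ≡.refl

    xs : Carrier
    xs = X * 𝕤

  module _ (K : ℕ) (G₀₀ : σ (G 0 0) ≈ G 0 0) where
    open Recursion seriesRing 𝕤 (suc K)

    F : ℕ → Carrier
    F = σ ∘ family K

    H : ℕ → Carrier
    H = term (cutoff X 1#) Y F

    private
      F-at : ∀ {c} a b → c ≡ suc a → a ℕ.+ b ≡ K → F c ≈ σ (G a b)
      F-at a b ≡.refl eq = σ-reflexive (family-at a b eq)

      F0 : ∀ {c} → c ≡ 0 → F c ≈ 0#
      F0 ≡.refl n = A.zeroʳ _

      H-at : ∀ {e u v} j → cutoff X 1# j ≡ e → F (suc K ∸ j) ≈ u → F (suc K ∸ suc j) ≈ v →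
        H j ≈ e * (Y ^ j * (u + Y * v))
      H-at j ≡.refl p q = *-congˡ {cutoff X 1# j} (*-congˡ {Y ^ j} (+-cong p (*-congˡ {Y} q)))

      first : (1# - xs) * family K 1 ≈ recSum X (cutoff X 1#) Y F 1
      first = trans (go K ≡.refl) (solve 2 (λ h x → h := (:0 :+ h) :+ x :* :0) refl (H 0) xs)
        where
        go : ∀ K′ → K′ ≡ K → (1# - xs) * family K 1 ≈ H 0
        -- For k = 1 the cutoff at j = 0 is already 1 - xs, and the equation only says that `G 0 0`
        -- is invariant under `σ`.
        go zero ≡.refl = trans (*-congˡ {1# - xs} (sym G₀₀)) (sym (trans (H-at 0 ≡.refl (F-at 0 0 ≡.refl ≡.refl) (F0 ≡.refl))
          (solve 3 (λ e g y → e :* (:1 :* (g :+ y :* :0)) := e :* g) refl (1# - xs) _ Y)))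
        go (suc n) ≡.refl = trans (G-first n) (sym (trans (H-at 0 ≡.refl (F-at (suc n) 0 ≡.refl (ℕₚ.+-identityʳ _)) (F-at n 1 ≡.refl (ℕₚ.+-comm n 1)))
          (solve 3 (λ g y h → :1 :* (:1 :* (g :+ y :* h)) := g :+ y :* h) refl _ Y _)))

      -- The right-hand side is the increment of `recSum` when i grows by one; this is why the
      -- recurrences are stated for differences of neighbouring multisums.
      step : ∀ m n → suc m ℕ.+ n ≡ K →
        (1# - xs) * (G (suc m) n - G m (suc n)) ≈ H (suc m) + xs * H m
      -- At the top index j = K the cutoff is 1 - xs instead of 1; its part -xs cancels the second
      -- summand of `xs * H m`.
      step m zero eq = trans (G-last m) (sym (trans
        (+-cong (H-at (suc m) (cut-out (suc m) (λ p → ℕₚ.1+n≰n (≡.subst (ℕ._≤ suc K) e₁ p)))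
                   (F-at 0 (suc m) (≡.trans (≡.cong (suc K ∸_) sm≡K) (ℕₚ.m+n∸n≡m 1 K)) sm≡K)
                   (F0 (≡.trans (≡.cong (K ∸_) sm≡K) (ℕₚ.n∸n≡0 K))))
                (*-congˡ {xs} (H-at m (cut-in m (ℕₚ.≤-reflexive e₂))
                   (F-at 1 m (≡.trans (≡.cong (λ z → suc z ∸ m) (≡.sym sm≡K)) (ℕₚ.m+n∸n≡m 2 m)) sm≡K)
                   (F-at 0 (suc m) (≡.trans (≡.cong (λ z → z ∸ m) (≡.sym sm≡K)) (ℕₚ.m+n∸n≡m 1 m)) sm≡K))))
        (solve 5 (λ k y p g h → (:1 :- k) :* (y :* p :* (g :+ y :* :0)) :+ k :* (:1 :* (p :* (h :+ y :* g)))
             := p :* (y :* g :+ k :* h)) refl xs Y (Y ^ m) (σ (G 0 (suc m))) (σ (G 1 m)))))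
        where
        sm≡K : suc m ≡ K
        sm≡K = ≡.trans (≡.sym (ℕₚ.+-identityʳ (suc m))) eq
        e₂ : m ℕ.+ 2 ≡ suc K
        e₂ = ≡.trans (ℕₚ.+-comm m 2) (≡.cong suc sm≡K)
        e₁ : suc m ℕ.+ 2 ≡ suc (suc K)
        e₁ = ≡.cong suc e₂
      step m (suc n) eq = trans (G-middle m n) (sym (trans
        (+-cong (H-at (suc m) (cut-in (suc m) le₁) (F-at (suc n) (suc m) k₁ c₁) (F-at n (suc (suc m)) k₂ c₂))
                (*-congˡ {xs} (H-at m (cut-in m (ℕₚ.≤-trans (ℕₚ.n≤1+n _) le₁)) (F-at (suc (suc n)) m k₀ c₀) (F-at (suc n) (suc m) k₁ c₁))))
        (solve 6 (λ k y p g h f → :1 :* (y :* p :* (g :+ y :* h)) :+ k :* (:1 :* (p :* (f :+ y :* g)))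
             := p :* (y :* (g :+ y :* h) :+ k :* (f :+ y :* g))) refl xs Y (Y ^ m) (σ (G (suc n) (suc m))) (σ (G n (suc (suc m)))) (σ (G (suc (suc n)) m)))))
        where
        le₁ : suc m ℕ.+ 2 ℕ.≤ suc K
        le₁ = ≡.subst (λ z → suc m ℕ.+ 2 ℕ.≤ suc z) eq
                (≡.subst (ℕ._≤ suc (suc m ℕ.+ suc n)) (ℕₚ.+-comm 2 (suc m)) (s≤s (s≤s (ℕₚ.≤-trans (ℕₚ.m≤m+n (suc m) n) (ℕₚ.≤-reflexive (≡.sym (ℕₚ.+-suc m n)))))))
        c₁ : suc n ℕ.+ suc m ≡ K
        c₁ = ≡.trans (ℕₚ.+-comm (suc n) (suc m)) eq
        c₂ : n ℕ.+ suc (suc m) ≡ K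
        c₂ = ≡.trans (ℕₚ.+-suc n (suc m)) c₁
        c₀ : suc (suc n) ℕ.+ m ≡ K
        c₀ = ≡.trans (≡.sym (ℕₚ.+-suc (suc n) m)) c₁
        k₁ : K ∸ m ≡ suc (suc n)
        k₁ = ≡.trans (≡.cong (_∸ m) (≡.sym c₀)) (ℕₚ.m+n∸n≡m (suc (suc n)) m)
        k₂ : K ∸ suc m ≡ suc n
        k₂ = ≡.trans (≡.cong (_∸ suc m) (≡.sym c₁)) (ℕₚ.m+n∸n≡m (suc n) (suc m))
        k₀ : suc K ∸ m ≡ suc (suc (suc n))
        k₀ = ≡.trans (≡.cong (λ z → suc z ∸ m) (≡.sym c₀)) (ℕₚ.m+n∸n≡m (suc (suc (suc n))) m)

    G-rec : ∀ m → m ℕ.≤ K → (1# - xs) * family K (suc m) ≈ recSum X (cutoff X 1#) Y F (suc m)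
    G-rec zero    _ = first
    G-rec (suc m) m<K = begin
      (1# - xs) * family K (suc (suc m))
        ≈⟨ solve 3 (λ e g h → e :* g := e :* h :+ e :* (g :- h)) refl (1# - xs) _ (family K (suc m)) ⟩
      (1# - xs) * family K (suc m) + (1# - xs) * (family K (suc (suc m)) - family K (suc m))
        ≈⟨ +-cong (G-rec m (ℕₚ.<⇒≤ m<K))
             (trans (*-congˡ {1# - xs} (+-congˡ (-‿cong (reflexive (family-at m (suc (K ∸ suc m)) eq′)))))
                    (step m (K ∸ suc m) eq)) ⟩
      (sum< (suc m) H + xs * sum< m H) + (H (suc m) + xs * H m)
        ≈⟨ solve 5 (λ a b c d x → (a :+ x :* b) :+ (c :+ x :* d) := (a :+ c) :+ x :* (b :+ d)) refl _ (sum< m H) _ _ xs ⟩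
      recSum X (cutoff X 1#) Y F (suc (suc m)) ∎
      where
      eq : suc m ℕ.+ (K ∸ suc m) ≡ K
      eq = ℕₚ.m+[n∸m]≡n m<K
      eq′ : m ℕ.+ suc (K ∸ suc m) ≡ K
      eq′ = ≡.trans (ℕₚ.+-suc m _) eq

-- Comparison of the two recursions modulo powers of q

module TruncatedComparison (F : CommutativeRing 0ℓ 0ℓ) (half : CommutativeRing.Carrier F)
  (half-inverse : CommutativeRing._≈_ F (CommutativeRing._*_ F half (CommutativeRing._+_ F (CommutativeRing.1# F) (CommutativeRing.1# F))) (CommutativeRing.1# F))
  (iq : ℕ → PowerSeries.Series F)
  (iq-inv : Base.IsInverseFamily (PowerSeries.seriesRing F) (PowerSeries.X F) (CommutativeRing.1# (PowerSeries.seriesRing F)) iq) where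

  private
    module F = CommutativeRing F

  module F⟦q⟧ = PowerSeries F

  A : CommutativeRing 0ℓ 0ℓ
  A = F⟦q⟧.seriesRing

  module A = CommutativeRing A
  open import Algebra.Properties.Semiring.Exp A.semiring using () renaming (_^_ to _^ᴬ_)

  q : A.Carrier
  q = F⟦q⟧.X

  open Base A q using () renaming (Q to q²) public

  open WeightStep A q using (ratio)

  -- The initial value 1/2 is the Pochhammer symbol of index -1 that occurs at N_1 = 0; it is
  -- compensated by 1 + q^(2N_i) = 2.
  weightᴹ : ℕ → A.Carrier
  weightᴹ zero    = F⟦q⟧.const half
  weightᴹ (suc M) = weightᴹ M A.* ratio M

  weightᴹ-step : WeightStep.IsWeight A q weightᴹ
  weightᴹ-step M = A.refl

  open PowerSeries A using (X; const; const-·; const-cong; const-*; const-+; const-^; dilate-cong; dilate-·; dilate-+; dilate-const; L; geometric; geometric-inverse)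
  open GeneratingFunction A q iq iq-inv weightᴹ weightᴹ-step public
  open GRecursion A q iq iq-inv weightᴹ weightᴹ-step using (family; G-rec) public

  R : CommutativeRing 0ℓ 0ℓ
  R = PowerSeries.seriesRing A

  open CommutativeRing R hiding (zero)
  open import Algebra.Properties.Semiring.Exp semiring using (_^_; ^-congˡ)
  open import Algebra.Properties.CommutativeSemiring.Exp commutativeSemiring using (^-distrib-*)
  open RingSolver R
  open FiniteSums R
  open Chain R 𝕤 (const ∘ iq)

  D-at-0 : ∀ z f → D z f 0 ≈ f 0
  D-at-0 z f = solve 1 (λ a → :0 :+ :1 :* :1 :* :1 :* a := a) refl (f 0)

  iter-at-0 : ∀ z n f → iter z n f 0 ≈ f 0
  iter-at-0 z zero    f = refl
  iter-at-0 z (suc n) f = trans (D-at-0 z (iter z n f)) (iter-at-0 z n f)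

  VG-at-0 : ∀ z m n → VG z m n 0 ≈ 1# + 1#
  VG-at-0 z m n = trans (iter-at-0 z m (onePlusE (iter (z * (𝕤 * 𝕤)) n unit)))
    (trans (*-congˡ {1# + 1#} (iter-at-0 (z * (𝕤 * 𝕤)) n unit)) (*-identityʳ (1# + 1#)))

  half-double : const (F⟦q⟧.const half) * (1# + 1#) ≈ 1#
  half-double = trans (sym (trans (const-* (F⟦q⟧.const half) (A.1# A.+ A.1#)) (*-congˡ {const (F⟦q⟧.const half)} (const-+ A.1# A.1#))))
    (const-cong (A.trans (A.sym (A.trans (F⟦q⟧.const-* half (F.1# F.+ F.1#)) (A.*-congˡ {F⟦q⟧.const half} (F⟦q⟧.const-+ F.1# F.1#))))
      (F⟦q⟧.const-cong half-inverse)))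

  G-at-0 : ∀ m n → G m n 0 A.≈ A.1#
  G-at-0 m n = A.trans (A.*-congˡ {weightᴹ 0} (VG-at-0 X m n 0)) (half-double 0)

  L-zero : ∀ w f → (∀ M → f M ≈ 0#) → L w f ≈ 0#
  L-zero w f h zero    = A.trans (A.*-congˡ {w 0} (h 0 0)) (A.zeroʳ (w 0))
  L-zero w f h (suc m) = A.trans (A.+-cong (A.trans (A.*-congˡ {w 0} (h 0 (suc m))) (A.zeroʳ (w 0))) (L-zero (w ∘ suc) (f ∘ suc) (h ∘ suc) m)) (A.+-identityˡ A.0#)

  -- For k = 1 no `D` is applied, so `unit` leaves only N_1 = 0, where 1/2 meets 1 + Q^0.
  G₀₀ : G 0 0 ≈ 1#
  G₀₀ zero    = G-at-0 0 0
  G₀₀ (suc m) = A.trans (A.+-cong (A.trans (A.*-congˡ {weightᴹ 0} (A.trans (VG-at-0 X 0 0 (suc m)) (A.+-identityˡ A.0#))) (A.zeroʳ (weightᴹ 0)))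
      (L-zero (weightᴹ ∘ suc) (VG X 0 0 ∘ suc) (λ M → zeroʳ (1# + (𝕤 * 𝕤) ^ suc M)) m))
    (A.+-identityˡ A.0#)

  σG₀₀ : σ (G 0 0) ≈ G 0 0
  σG₀₀ = trans (dilate-cong q² {G 0 0} {1#} G₀₀) (trans (dilate-const q² A.1#) (sym G₀₀))

  L-q⁰ : ∀ w f → (∀ M → w M 0 F.≈ F.0#) → ∀ m → L w f m 0 F.≈ F.0#
  L-q⁰ w f h zero    = F.trans (F.*-congʳ (h 0)) (F.zeroˡ _)
  L-q⁰ w f h (suc m) = F.trans (F.+-cong (F.trans (F.*-congʳ (h 0)) (F.zeroˡ _)) (L-q⁰ (w ∘ suc) (f ∘ suc) (h ∘ suc) m)) (F.+-identityˡ F.0#)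

  -- The weights for N_1 ≥ 1 are divisible by q, and the term N_1 = 0 is constant in x.
  G-q⁰ : ∀ m n M → G m n (suc M) 0 F.≈ F.0#
  G-q⁰ m n M = F.trans (F.+-cong
    (A.trans (A.*-congˡ {weightᴹ 0} (A.trans (VG-at-0 X m n (suc M)) (A.+-identityˡ A.0#))) (A.zeroʳ (weightᴹ 0)) 0)
    (L-q⁰ (weightᴹ ∘ suc) (VG X m n ∘ suc) (λ N → F.trans (F.*-congˡ (F.zeroˡ _)) (F.zeroʳ _)) M))
    (F.+-identityˡ F.0#)

  -- Agreement modulo q^{N+1}, and of the coefficients of x^0 to all orders: the
  -- second condition is what lets σ raise the precision N by 2.
  infix 4 _≈[_]_

  _≈[_]_ : Carrier → ℕ → Carrier → Set
  f ≈[ N ] g = f 0 A.≈ g 0 × (∀ m n → n ℕ.≤ N → f m n F.≈ g m n)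

  ≈⇒≈[] : ∀ {N f g} → f ≈ g → f ≈[ N ] g
  ≈⇒≈[] h = h 0 , λ m n _ → h m n

  ≈[]-trans : ∀ {N f g h} → f ≈[ N ] g → g ≈[ N ] h → f ≈[ N ] h
  ≈[]-trans (a , b) (c , d) = A.trans a c , λ m n n≤N → F.trans (b m n n≤N) (d m n n≤N)

  ≈[]-+ : ∀ {N f f′ g g′} → f ≈[ N ] f′ → g ≈[ N ] g′ → f + g ≈[ N ] f′ + g′
  ≈[]-+ (a , b) (c , d) = A.+-cong a c , λ m n n≤N → F.+-cong (b m n n≤N) (d m n n≤N)

  *ᴬ-truncated : ∀ n {f f′ g g′ : A.Carrier} → (∀ j → j ℕ.≤ n → f j F.≈ f′ j) → (∀ j → j ℕ.≤ n → g j F.≈ g′ j) →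
    (f A.* g) n F.≈ (f′ A.* g′) n
  *ᴬ-truncated zero    p r = F.*-cong (p 0 z≤n) (r 0 z≤n)
  *ᴬ-truncated (suc n) p r = F.+-cong (F.*-cong (p 0 z≤n) (r (suc n) ℕₚ.≤-refl))
    (*ᴬ-truncated n (λ j j≤n → p (suc j) (s≤s j≤n)) (λ j j≤n → r j (ℕₚ.m≤n⇒m≤1+n j≤n)))

  *-truncated : ∀ {N f f′ g g′} → (∀ m n → n ℕ.≤ N → f m n F.≈ f′ m n) → (∀ m n → n ℕ.≤ N → g m n F.≈ g′ m n) →
    ∀ m n → n ℕ.≤ N → (f * g) m n F.≈ (f′ * g′) m n
  *-truncated p r zero    n n≤N = *ᴬ-truncated n (λ j j≤n → p 0 j (ℕₚ.≤-trans j≤n n≤N)) (λ j j≤n → r 0 j (ℕₚ.≤-trans j≤n n≤N))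
  *-truncated p r (suc m) n n≤N = F.+-cong
    (*ᴬ-truncated n (λ j j≤n → p 0 j (ℕₚ.≤-trans j≤n n≤N)) (λ j j≤n → r (suc m) j (ℕₚ.≤-trans j≤n n≤N)))
    (*-truncated (p ∘ suc) r m n n≤N)

  ≈[]-* : ∀ {N f f′ g g′} → f ≈[ N ] f′ → g ≈[ N ] g′ → f * g ≈[ N ] f′ * g′
  ≈[]-* (a , b) (c , d) = A.*-cong a c , *-truncated b d

  ≈[]-refl : ∀ {N f} → f ≈[ N ] f
  ≈[]-refl = A.refl , λ _ _ _ → F.refl

  ≈[]-sum< : ∀ {N f g} n → (∀ j → j ℕ.< n → f j ≈[ N ] g j) → sum< n f ≈[ N ] sum< n g
  ≈[]-sum< zero    h = ≈[]-refl
  ≈[]-sum< (suc n) h = ≈[]-+ (≈[]-sum< n (λ j j<n → h j (ℕₚ.m≤n⇒m≤1+n j<n))) (h n ℕₚ.≤-refl)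

  σ-≈[] : ∀ {N f g} → f ≈[ N ] g → σ f ≈[ 2 ℕ.+ N ] σ g
  σ-≈[] {N} {f} {g} (a , b) = A.*-congˡ {A.1#} a , go
    where
    q-up : ∀ {N} {f g : A.Carrier} → (∀ n → n ℕ.≤ N → f n F.≈ g n) → ∀ n → n ℕ.≤ suc N → (q A.* f) n F.≈ (q A.* g) n
    q-up h zero    _       = F.trans (F.zeroˡ _) (F.sym (F.zeroˡ _))
    q-up {f = f} {g} h (suc n) (s≤s p) = F.trans (F⟦q⟧.X-·-suc f n) (F.trans (h n p) (F.sym (F⟦q⟧.X-·-suc g n)))
    q²-up : ∀ {N} {f g : A.Carrier} → (∀ n → n ℕ.≤ N → f n F.≈ g n) → ∀ n → n ℕ.≤ 2 ℕ.+ N → (q² A.* f) n F.≈ (q² A.* g) n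
    q²-up {f = f} {g} h n p = F.trans (A.*-assoc q q f n) (F.trans (q-up (q-up h) n p) (F.sym (A.*-assoc q q g n)))
    go : ∀ m n → n ℕ.≤ 2 ℕ.+ N → σ f m n F.≈ σ g m n
    go zero    n _ = A.*-congˡ {A.1#} a n
    go (suc m) n p = F.trans (A.*-assoc q² (q² ^ᴬ m) (f (suc m)) n)
      (F.trans (q²-up (λ j j≤N → *ᴬ-truncated j {q² ^ᴬ m} {q² ^ᴬ m} {f (suc m)} {g (suc m)} (λ _ _ → F.refl) (λ i i≤j → b (suc m) i (ℕₚ.≤-trans i≤j j≤N))) n p)
        (F.sym (A.*-assoc q² (q² ^ᴬ m) (g (suc m)) n)))

  -- The power equals q^(B+1) x^(B+1): it has neither a term of degree 0 in x nor one of degree at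
  -- most B in q.
  xs^-small : ∀ {B N} → N ℕ.≤ B → (X * 𝕤) ^ suc B ≈[ N ] 0#
  xs^-small {B} {N} N≤B = A.trans (expand 0) (A.trans (A.*-congˡ {q ^ᴬ suc B} (A.zeroˡ ((X ^ B) 0))) (A.zeroʳ (q ^ᴬ suc B)))
    , λ m n n≤N → F.trans (expand m n) (F⟦q⟧.X^-below (suc B) ((X ^ suc B) m) n (s≤s (ℕₚ.≤-trans n≤N N≤B)))
    where
    expand : ∀ m → ((X * 𝕤) ^ suc B) m A.≈ q ^ᴬ suc B A.* (X ^ suc B) m
    expand m = A.trans (trans (^-distrib-* X 𝕤 (suc B)) (trans (*-comm (X ^ suc B) (𝕤 ^ suc B)) (*-congʳ {X ^ suc B} (sym (const-^ q (suc B))))) m)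
                       (const-· (q ^ᴬ suc B) (X ^ suc B) m)

  module Comparison (B K : ℕ) (K≤B : K ℕ.≤ B) where
    private k = suc K
    open Recursion R 𝕤 k
    open BoxSums R 𝕤 B

    σ-mon : ∀ {z z′} l → σ z ≈ z′ → σ (mon z l) ≈ mon z′ l
    σ-mon []      h = dilate-const q² A.1#
    σ-mon {z} {z′} (c ∷ l) h = trans (dilate-· q² ((z * 𝕤) ^ size c) (mon (z * 𝕤) l))
      (*-cong (trans (σ-^ (z * 𝕤) (size c)) (^-congˡ (size c) h′)) (σ-mon l h′))
      where
      h′ : σ (z * 𝕤) ≈ z′ * 𝕤
      h′ = trans (dilate-· q² z 𝕤) (*-cong h σ𝕤)

    σ-ind : ∀ b → σ (ind b) ≈ ind b
    σ-ind true  = dilate-const q² A.1#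
    σ-ind false = λ _ → A.zeroʳ _

    σ-boxSum : ∀ n f → σ (boxSum n f) ≈ boxSum n (σ ∘ f)
    σ-boxSum zero    f = refl
    σ-boxSum (suc n) f = trans (σ-sum< (suc B) (λ j → boxSum n (λ l → f ((j , false) ∷ l)) + boxSum n (λ l → f ((j , true) ∷ l))))
      (sum<-cong (suc B) (λ j → trans (dilate-+ q² (boxSum n (λ l → f ((j , false) ∷ l))) (boxSum n (λ l → f ((j , true) ∷ l))))
        (+-cong (σ-boxSum n (λ l → f ((j , false) ∷ l))) (σ-boxSum n (λ l → f ((j , true) ∷ l))))))

    y≈ : X * 𝕤 * 𝕤 ≈ Y
    y≈ = *-assoc X 𝕤 𝕤

    σ-P : ∀ n i → P n k i (X * 𝕤 * 𝕤) ≈ σ (P n k i X)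
    σ-P n i = sym (trans (σ-boxSum n _) (boxSum-cong n (λ l → trans (dilate-· q² (ind (good k i l)) (mon X l))
      (*-cong (σ-ind (good k i l)) (σ-mon l (trans σX (sym y≈)))))))

    P-zero : ∀ n x → P n k 0 x ≈ 0#
    P-zero n x = trans (boxSum-cong n (λ l → *-congʳ {mon x l} (reflexive (≡.cong ind (good-zero k l)))))
      (trans (sym (boxSum-*ˡ n 0# (mon x))) (zeroˡ (boxSum n (mon x))))

    recSum-≈[] : ∀ {N ε ε′ y y′ F F′} i → i ℕ.≤ k → (∀ j → ε j ≈[ N ] ε′ j) → y ≈ y′ →
      (∀ j → j ℕ.≤ k → F j ≈[ N ] F′ j) → recSum X ε y F i ≈[ N ] recSum X ε′ y′ F′ i
    recSum-≈[] {N} {ε} {ε′} {y} {y′} {F} {F′} i i≤k hε hy hF =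
      ≈[]-+ (≈[]-sum< i (λ j _ → terms j)) (≈[]-* (≈[]-refl {f = X * 𝕤}) (≈[]-sum< (i ∸ 1) (λ j _ → terms j)))
      where
      terms : ∀ j → term ε y F j ≈[ N ] term ε′ y′ F′ j
      terms j = ≈[]-* (hε j) (≈[]-* (≈⇒≈[] (^-congˡ j hy)) (≈[]-+ (hF (k ∸ j) (ℕₚ.m∸n≤m k j)) (≈[]-* (≈⇒≈[] hy) (hF (k ∸ suc j) (ℕₚ.m∸n≤m k (suc j))))))

    cancel-1-xs : ∀ {N f g} → (1# - X * 𝕤) * f ≈[ N ] (1# - X * 𝕤) * g → f ≈[ N ] g
    cancel-1-xs {N} {f} {g} h = ≈[]-trans (≈⇒≈[] (sym (e f))) (≈[]-trans (≈[]-* (≈[]-refl {f = geometric q}) h) (≈⇒≈[] (e g)))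
      where
      e : ∀ f → geometric q * ((1# - X * 𝕤) * f) ≈ f
      e f = trans (solve 3 (λ a b f → a :* (b :* f) := (b :* a) :* f) refl (geometric q) (1# - X * 𝕤) f)
        (trans (*-congʳ {f} (geometric-inverse q)) (*-identityˡ f))

    cutoff-≈[] : ∀ {N} → N ℕ.≤ B → ∀ j → cutoff X (1# - (X * 𝕤) ^ suc B) j ≈[ N ] cutoff X 1# j
    cutoff-≈[] {N} N≤B j with ⌊ j ℕ.+ 2 ≤? k ⌋
    ... | false = ≈[]-refl
    ... | true  = ≈[]-trans (≈[]-+ (≈[]-refl {f = 1#}) (neg (xs^-small N≤B))) (≈⇒≈[] (solve 0 (:1 :- :0 := :1) refl))
      where
      neg : ∀ {f g} → f ≈[ N ] g → - f ≈[ N ] - g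
      neg (a , b) = A.-‿cong a , λ m n n≤N → F.-‿cong (b m n n≤N)

    -- Each step adds two part sizes and gains two orders in q: both sides satisfy the same
    -- recursion up to the error (xs)^(B+1), and `σ` raises the precision by 2. At h = 0 the empty
    -- overpartition faces a multisum that is 1 modulo q.
    P≈family : ∀ h → h ℕ.* 2 ℕ.≤ B → ∀ i → i ℕ.≤ k → P (h ℕ.* 2) k i X ≈[ h ℕ.* 2 ] family K i
    P≈family h       _  zero    _   = ≈⇒≈[] (P-zero (h ℕ.* 2) X)
    P≈family zero    _  (suc m) _   = ≈[]-trans (≈⇒≈[] (trans (*-congʳ {1#} (reflexive (≡.cong ind (good-[] k (suc m) (s≤s z≤n) (s≤s z≤n))))) (*-identityˡ 1#)))
      ( A.sym (G-at-0 m (K ∸ m))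
      , λ { zero    .0 z≤n → F.sym (G-at-0 m (K ∸ m) 0)
          ; (suc M) .0 z≤n → F.sym (G-q⁰ m (K ∸ m) M) })
    P≈family (suc h) le (suc m) i≤k = cancel-1-xs (≈[]-trans (≈⇒≈[] (P-rec k X (s≤s K≤B) (h ℕ.* 2) (suc m) i≤k))
      (≈[]-trans (recSum-≈[] (suc m) i≤k (cutoff-≈[] le) y≈
          (λ j j≤k → ≈[]-trans (≈⇒≈[] (σ-P (h ℕ.* 2) j)) (σ-≈[] (P≈family h (ℕₚ.≤-trans (ℕₚ.m≤n+m (h ℕ.* 2) 2) le) j j≤k))))
        (≈⇒≈[] (sym (G-rec K σG₀₀ m (ℕₚ.≤-pred i≤k))))))

-- From coefficients of box sums to counts of overpartitions

⌊⌋-false : ∀ {P : Set} (d : Dec P) → ¬ P → ⌊ d ⌋ ≡ false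
⌊⌋-false (yes p) ¬p = ⊥-elim (¬p p)
⌊⌋-false (no _)  _  = ≡.refl

numParts-++ : ∀ l c → numParts (l ++ c ∷ []) ≡ numParts l ℕ.+ size c
numParts-++ []       c = ℕₚ.+-identityʳ _
numParts-++ (d ∷ l)  c = ≡.trans (≡.cong (size d ℕ.+_) (numParts-++ l c)) (≡.sym (ℕₚ.+-assoc (size d) _ _))

module ListSums (F : CommutativeRing 0ℓ 0ℓ) where
  open CommutativeRing F
  open FiniteSums F

  lsum : ∀ {X : Set} → (X → Carrier) → List X → Carrier
  lsum φ []       = 0#
  lsum φ (x ∷ xs) = φ x + lsum φ xs

  lsum-cong : ∀ {X : Set} {φ ψ : X → Carrier} xs → (∀ x → φ x ≈ ψ x) → lsum φ xs ≈ lsum ψ xs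
  lsum-cong []       h = refl
  lsum-cong (x ∷ xs) h = +-cong (h x) (lsum-cong xs h)

  lsum-zero : ∀ {X : Set} {φ : X → Carrier} xs → (∀ x → φ x ≈ 0#) → lsum φ xs ≈ 0#
  lsum-zero []       h = refl
  lsum-zero (x ∷ xs) h = trans (+-cong (h x) (lsum-zero xs h)) (+-identityˡ 0#)

  lsum-++ : ∀ {X : Set} (φ : X → Carrier) xs ys → lsum φ (xs ++ ys) ≈ lsum φ xs + lsum φ ys
  lsum-++ φ []       ys = sym (+-identityˡ _)
  lsum-++ φ (x ∷ xs) ys = trans (+-congˡ (lsum-++ φ xs ys)) (sym (+-assoc _ _ _))

  lsum-map : ∀ {X Y : Set} (φ : Y → Carrier) (g : X → Y) xs → lsum φ (map g xs) ≈ lsum (φ ∘ g) xs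
  lsum-map φ g []       = refl
  lsum-map φ g (x ∷ xs) = +-congˡ (lsum-map φ g xs)

  lsum-concatMap : ∀ {X Y : Set} (φ : Y → Carrier) (g : X → List Y) xs →
    lsum φ (concatMap g xs) ≈ lsum (λ x → lsum φ (g x)) xs
  lsum-concatMap φ g []       = refl
  lsum-concatMap φ g (x ∷ xs) = trans (lsum-++ φ (g x) _) (+-congˡ (lsum-concatMap φ g xs))

  lsum-filter : ∀ {X : Set} {P : X → Set} (P? : Decidable P) (φ : X → Carrier) xs →
    lsum φ (filter P? xs) ≈ lsum (λ x → if ⌊ P? x ⌋ then φ x else 0#) xs
  lsum-filter P? φ [] = refl
  lsum-filter P? φ (x ∷ xs) with P? x
  ... | yes _ = +-congˡ (lsum-filter P? φ xs)
  ... | no _  = trans (lsum-filter P? φ xs) (sym (+-identityˡ _))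

  lsum-upTo : ∀ (φ : ℕ → Carrier) n → lsum φ (upTo n) ≈ sum< n φ
  lsum-upTo φ n = go id n
    where
    go : ∀ (g : ℕ → ℕ) n → lsum φ (applyUpTo g n) ≈ sum< n (φ ∘ g)
    go g zero    = refl
    go g (suc n) = trans (+-congˡ (go (g ∘ suc) n)) (sym (sum<-head n (φ ∘ g)))

  if-cong : ∀ b {u v} → u ≈ v → (if b then u else 0#) ≈ (if b then v else 0#)
  if-cong true  h = h
  if-cong false h = refl

  indᶠ : Bool → Carrier
  indᶠ b = if b then 1# else 0#

  sum<-extend : ∀ {n} m (f : ℕ → Carrier) → n ℕ.≤ m → (∀ j → n ℕ.≤ j → f j ≈ 0#) → sum< m f ≈ sum< n f
  sum<-extend zero    f z≤n h = refl
  sum<-extend {n} (suc m) f n≤m h with n ℕ.≟ suc m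
  ... | yes ≡.refl = refl
  ... | no  n≢     = trans (+-cong (sum<-extend m f n≤m′ h) (h m n≤m′)) (+-identityʳ _)
    where n≤m′ = ℕₚ.≤-pred (ℕₚ.≤∧≢⇒< n≤m n≢)

  private
    cells : (ℕ × Bool → Carrier) → ℕ → Carrier
    cells f j = f (j , false) + f (j , true)

    lsum-cells : ∀ (φ : ℕ × Bool → Carrier) n →
      lsum φ (concatMap (λ f → (f , false) ∷ (f , true) ∷ []) (upTo n)) ≈ sum< n (cells φ)
    lsum-cells φ n = trans (lsum-concatMap φ _ (upTo n))
      (trans (lsum-cong (upTo n) (λ j → +-congˡ (+-identityʳ _))) (lsum-upTo (cells φ) n))

  lsum-genOP : ∀ (φ : Overpartition → Carrier) s n → lsum φ (genOP (suc s) n) ≈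
    sum< (suc n) (cells (λ c → if ⌊ size c ℕ.* suc s ≤? n ⌋
      then lsum (λ l → φ (l ++ c ∷ [])) (genOP s (n ∸ size c ℕ.* suc s)) else 0#))
  lsum-genOP φ s n = trans (lsum-concatMap φ g (filter P? cs)) (trans (lsum-filter P? (λ c → lsum φ (g c)) cs)
    (trans (lsum-cong cs (λ c → if-cong ⌊ P? c ⌋ (lsum-map φ (λ l → l ++ c ∷ []) (genOP s (n ∸ size c ℕ.* suc s)))))
      (lsum-cells _ (suc n))))
    where
    P? : Decidable (λ c → size c ℕ.* suc s ℕ.≤ n)
    P? c = size c ℕ.* suc s ≤? n
    g : ℕ × Bool → List Overpartition
    g c = map (λ l → l ++ c ∷ []) (genOP s (n ∸ size c ℕ.* suc s))
    cs = concatMap (λ f → (f , false) ∷ (f , true) ∷ []) (upTo (suc n))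

  too-big : ∀ {s n u} c → n ℕ.< proj₁ c → (if ⌊ size c ℕ.* suc s ≤? n ⌋ then u else 0#) ≈ 0#
  too-big {s} {n} c n<f rewrite ⌊⌋-false (size c ℕ.* suc s ≤? n) (λ h →
    ℕₚ.<⇒≱ n<f (ℕₚ.≤-trans (ℕₚ.m≤m+n (proj₁ c) _) (ℕₚ.≤-trans (ℕₚ.m≤m*n (size c) (suc s)) h))) = refl

  -- A part of size s + 1 > n does not fit, so only the empty cell can be appended. This allows more
  -- part sizes than n.
  genOP-pad : ∀ (φ : Overpartition → Carrier) s n → n ℕ.≤ s →
    lsum φ (genOP (suc s) n) ≈ lsum (λ l → φ (l ++ (0 , false) ∷ [])) (genOP s n)
  genOP-pad φ s n n≤s = trans (lsum-genOP φ s n) (trans (sum<-head n _)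
    (trans (+-cong (trans (+-congˡ (large (0 , true) (s≤s z≤n))) (+-identityʳ _))
      (sum<-zero n (λ j → trans (+-cong (large (suc j , false) (s≤s z≤n)) (large (suc j , true) (s≤s z≤n))) (+-identityˡ 0#))))
      (+-identityʳ _)))
    where
    large : ∀ c {u} → 1 ℕ.≤ size c → (if ⌊ size c ℕ.* suc s ≤? n ⌋ then u else 0#) ≈ 0#
    large c h rewrite ⌊⌋-false (size c ℕ.* suc s ≤? n) (λ le →
      ℕₚ.<⇒≱ (s≤s n≤s) (ℕₚ.≤-trans (ℕₚ.m≤n*m (suc s) (size c) {{ℕ.>-nonZero h}}) le)) = refl

private
  fNon-pad : ∀ l t → fNon (l ++ (0 , false) ∷ []) t ≡ fNon l t
  fNon-pad l        zero          = ≡.refl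
  fNon-pad []       (suc zero)    = ≡.refl
  fNon-pad []       (suc (suc t)) = ≡.refl
  fNon-pad (x ∷ l)  (suc zero)    = ≡.refl
  fNon-pad (x ∷ l)  (suc (suc t)) = fNon-pad l (suc t)

  fOv-pad : ∀ l t → fOv (l ++ (0 , false) ∷ []) t ≡ fOv l t
  fOv-pad l        zero          = ≡.refl
  fOv-pad []       (suc zero)    = ≡.refl
  fOv-pad []       (suc (suc t)) = ≡.refl
  fOv-pad (x ∷ l)  (suc zero)    = ≡.refl
  fOv-pad (x ∷ l)  (suc (suc t)) = fOv-pad l (suc t)

  Good-cong : ∀ {k i} l l′ → (∀ t → fNon l t ≡ fNon l′ t) → (∀ t → fOv l t ≡ fOv l′ t) → Good k i l → Good k i l′
  Good-cong {k} {i} l l′ f g (p , r , u) =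
      ≡.subst (λ z → z ℕ.+ 1 ℕ.≤ i) (≡.cong₂ ℕ._+_ (g 1) (f 2)) p
    , (λ t → ≡.subst (λ z → z ℕ.+ 1 ℕ.≤ k) (≡.cong₂ ℕ._+_ (≡.cong₂ ℕ._+_ (≡.cong₂ ℕ._+_ (g (2 ℕ.* t)) (f (2 ℕ.* t))) (g (2 ℕ.* t ℕ.+ 1))) (f (2 ℕ.* t ℕ.+ 2))) (r t))
    , (λ t h → ≡.subst (λ z → z ℕ.+ 2 ℕ.≤ k) (f (2 ℕ.* t ℕ.+ 2)) (u t (≡.subst (1 ℕ.≤_) (≡.sym (f (2 ℕ.* t ℕ.+ 1))) h)))

-- A longer list makes the decision procedure inspect more values of t, so the equality goes through
-- `Good`, which quantifies over all t and depends on the frequencies alone.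
good-pad : ∀ k i l → good k i (l ++ (0 , false) ∷ []) ≡ good k i l
good-pad k i l = ⇔→≡ {z = true} (mk⇔
  (λ h → good-complete k i l (Good-cong l′ l (fNon-pad l) (fOv-pad l) (good-sound k i l′ h)))
  (λ h → good-complete k i l′ (Good-cong l l′ (≡.sym ∘ fNon-pad l) (≡.sym ∘ fOv-pad l) (good-sound k i l h))))
  where l′ = l ++ (0 , false) ∷ []

module Extraction (F : CommutativeRing 0ℓ 0ℓ) (B : ℕ) where
  private
    module F = CommutativeRing F
    module F⟦q⟧ = PowerSeries F
    A = F⟦q⟧.seriesRing
    module A = CommutativeRing A
    module A⟦x⟧ = PowerSeries A
    R = A⟦x⟧.seriesRing
  open import Algebra.Properties.Semiring.Exp A.semiring using () renaming (_^_ to _^ᴬ_; ^-assocʳ to ^ᴬ-assocʳ)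
  open CommutativeRing R
  open import Relation.Binary.Reasoning.Setoid setoid
  open import Algebra.Properties.Semiring.Exp semiring using (_^_; ^-congˡ)
  open import Algebra.Properties.CommutativeSemiring.Exp commutativeSemiring using (^-distrib-*)
  open RingSolver R
  open ListSums F
  open FiniteSums R
  module FS = FiniteSums F
  private
    X = A⟦x⟧.X
    q = F⟦q⟧.X
    𝕤 = A⟦x⟧.const q
  open BoxSums R 𝕤 B

  boxSum-cong-length : ∀ n {f g} → (∀ l → length l ≡ n → f l ≈ g l) → boxSum n f ≈ boxSum n g
  boxSum-cong-length zero    h = h [] ≡.refl
  boxSum-cong-length (suc n) h = cellSum-cong (λ c → boxSum-cong-length n (λ l e → h (c ∷ l) (≡.cong suc e)))

  mon-++ : ∀ z l c → mon z (l ++ c ∷ []) ≈ (z * 𝕤 ^ suc (length l)) ^ size c * mon z l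
  mon-++ z []      c = *-congʳ {1#} (^-congˡ (size c) (*-congˡ {z} (sym (*-identityʳ 𝕤))))
  mon-++ z (d ∷ l) c = begin
    (z * 𝕤) ^ size d * mon (z * 𝕤) (l ++ c ∷ [])
      ≈⟨ *-congˡ {(z * 𝕤) ^ size d} (mon-++ (z * 𝕤) l c) ⟩
    (z * 𝕤) ^ size d * ((z * 𝕤 * 𝕤 ^ suc (length l)) ^ size c * mon (z * 𝕤) l)
      ≈⟨ *-congˡ {(z * 𝕤) ^ size d} (*-congʳ {mon (z * 𝕤) l} (^-congˡ (size c) (*-assoc z 𝕤 (𝕤 ^ suc (length l))))) ⟩
    (z * 𝕤) ^ size d * ((z * (𝕤 * 𝕤 ^ suc (length l))) ^ size c * mon (z * 𝕤) l)
      ≈⟨ solve 3 (λ a b c → a :* (b :* c) := b :* (a :* c)) refl ((z * 𝕤) ^ size d) ((z * (𝕤 * 𝕤 ^ suc (length l))) ^ size c) (mon (z * 𝕤) l) ⟩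
    (z * 𝕤 ^ suc (length (d ∷ l))) ^ size c * mon z (d ∷ l) ∎

  sum<-coef : ∀ n f m j → sum< n f m j F.≈ FS.sum< n (λ i → f i m j)
  sum<-coef zero    f m j = F.refl
  sum<-coef (suc n) f m j = F.+-congʳ (sum<-coef n f m j)

  monomial-coef : ∀ s a f m n → ((X * 𝕤 ^ s) ^ a * f) m n F.≈
    (if ⌊ a ℕ.* s ≤? n ⌋ then (if ⌊ a ≤? m ⌋ then f (m ∸ a) (n ∸ a ℕ.* s) else F.0#) else F.0#)
  monomial-coef s a f m n = F.trans (expand m n) coef
    where
    e = a ℕ.* s
    const≈ : (𝕤 ^ s) ^ a ≈ A⟦x⟧.const (q ^ᴬ e)
    const≈ = begin
      (𝕤 ^ s) ^ a                      ≈⟨ ^-congˡ a (A⟦x⟧.const-^ q s) ⟨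
      A⟦x⟧.const (q ^ᴬ s) ^ a          ≈⟨ A⟦x⟧.const-^ (q ^ᴬ s) a ⟨
      A⟦x⟧.const ((q ^ᴬ s) ^ᴬ a)       ≈⟨ A⟦x⟧.const-cong (A.trans (^ᴬ-assocʳ q s a) (A.reflexive (≡.cong (q ^ᴬ_) (ℕₚ.*-comm s a)))) ⟩
      A⟦x⟧.const (q ^ᴬ e)              ∎
    expand : (X * 𝕤 ^ s) ^ a * f ≈ X ^ a * (A⟦x⟧.const (q ^ᴬ e) * f)
    expand = trans (*-congʳ {f} (trans (^-distrib-* X (𝕤 ^ s) a) (*-congˡ {X ^ a} const≈))) (*-assoc (X ^ a) (A⟦x⟧.const (q ^ᴬ e)) f)
    coef : (X ^ a * (A⟦x⟧.const (q ^ᴬ e) * f)) m n F.≈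
      (if ⌊ e ≤? n ⌋ then (if ⌊ a ≤? m ⌋ then f (m ∸ a) (n ∸ e) else F.0#) else F.0#)
    coef with a ≤? m
    ... | no a≰m = F.trans (A⟦x⟧.X^-below a (A⟦x⟧.const (q ^ᴬ e) * f) m (ℕₚ.≰⇒> a≰m) n) (zeros ⌊ e ≤? n ⌋)
      where
      zeros : ∀ b → F.0# F.≈ (if b then F.0# else F.0#)
      zeros true  = F.refl
      zeros false = F.refl
    ... | yes a≤m = F.trans (F.reflexive (≡.cong (λ z → (X ^ a * (A⟦x⟧.const (q ^ᴬ e) * f)) z n) (≡.sym (ℕₚ.m+[n∸m]≡n a≤m))))
      (F.trans (A⟦x⟧.X^-above a (A⟦x⟧.const (q ^ᴬ e) * f) (m ∸ a) n) (F.trans (A⟦x⟧.const-· (q ^ᴬ e) f (m ∸ a) n) inner))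
      where
      inner : (q ^ᴬ e A.* f (m ∸ a)) n F.≈ (if ⌊ e ≤? n ⌋ then f (m ∸ a) (n ∸ e) else F.0#)
      inner with e ≤? n
      ... | no e≰n  = F⟦q⟧.X^-below e (f (m ∸ a)) n (ℕₚ.≰⇒> e≰n)
      ... | yes e≤n = F.trans (F.reflexive (≡.cong (q ^ᴬ e A.* f (m ∸ a)) (≡.sym (ℕₚ.m+[n∸m]≡n e≤n)))) (F⟦q⟧.X^-above e (f (m ∸ a)) (n ∸ e))

  -- The cap `B` is harmless since a frequency above n ≤ B exceeds the weight n. The predicate is
  -- arbitrary so that the induction on s can absorb the last cell into it.
  boxSum-coef : ∀ s (p : Overpartition → Bool) m n → n ℕ.≤ B →
    boxSum s (λ l → ind (p l) * mon X l) m n F.≈ lsum (λ l → indᶠ (⌊ numParts l ℕ.≟ m ⌋ ∧ p l)) (genOP s n)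
  boxSum-coef zero p m n _ = F.trans (*-identityʳ (ind (p [])) m n) (base m n)
    where
    base : ∀ m n → ind (p []) m n F.≈ lsum (λ l → indᶠ (⌊ numParts l ℕ.≟ m ⌋ ∧ p l)) (genOP 0 n)
    base m n with p [] in eq
    base zero    zero    | true  rewrite eq = F.sym (F.+-identityʳ _)
    base zero    (suc n) | true  = F.refl
    base (suc m) zero    | true  = F.sym (F.+-identityʳ _)
    base (suc m) (suc n) | true  = F.refl
    base zero    zero    | false rewrite eq = F.sym (F.+-identityʳ _)
    base zero    (suc n) | false = F.refl
    base (suc m) zero    | false = F.sym (F.+-identityʳ _)
    base (suc m) (suc n) | false = F.refl
  boxSum-coef (suc s) p m n n≤B = F.trans (split m n) (F.trans (sum<-coef (suc B) _ m n)
    (F.trans (FS.sum<-cong (suc B) (λ j → F.+-cong (cell (j , false)) (cell (j , true))))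
      (F.trans (sum<-extend (suc B) _ (s≤s n≤B) (λ j n<j → F.trans (F.+-cong (too-big (j , false) n<j) (too-big (j , true) n<j)) (F.+-identityˡ F.0#)))
        (F.sym (lsum-genOP _ s n)))))
    where
    f : ℕ × Bool → Carrier
    f c = boxSum s (λ l → ind (p (l ++ c ∷ [])) * mon X l)
    split : boxSum (suc s) (λ l → ind (p l) * mon X l) ≈ cellSum (λ c → (X * 𝕤 ^ suc s) ^ size c * f c)
    split = trans (boxSum-last s (λ l → ind (p l) * mon X l)) (cellSum-cong (λ c → trans
      (boxSum-cong-length s (λ l e → trans (*-congˡ {ind (p (l ++ c ∷ []))}
          (trans (mon-++ X l c) (*-congʳ {mon X l} (reflexive (≡.cong (λ z → (X * 𝕤 ^ suc z) ^ size c) e)))))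
        (solve 3 (λ a b c → a :* (b :* c) := b :* (a :* c)) refl (ind (p (l ++ c ∷ []))) ((X * 𝕤 ^ suc s) ^ size c) (mon X l))))
      (sym (boxSum-*ˡ s ((X * 𝕤 ^ suc s) ^ size c) (λ l → ind (p (l ++ c ∷ [])) * mon X l)))))
    cell : ∀ c → ((X * 𝕤 ^ suc s) ^ size c * f c) m n F.≈
      (if ⌊ size c ℕ.* suc s ≤? n ⌋
       then lsum (λ l → indᶠ (⌊ numParts (l ++ c ∷ []) ℕ.≟ m ⌋ ∧ p (l ++ c ∷ []))) (genOP s (n ∸ size c ℕ.* suc s)) else F.0#)
    cell c = F.trans (monomial-coef (suc s) (size c) (f c) m n) (if-cong ⌊ size c ℕ.* suc s ≤? n ⌋ inner)
      where
      n′ = n ∸ size c ℕ.* suc s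
      inner : (if ⌊ size c ≤? m ⌋ then f c (m ∸ size c) n′ else F.0#) F.≈
        lsum (λ l → indᶠ (⌊ numParts (l ++ c ∷ []) ℕ.≟ m ⌋ ∧ p (l ++ c ∷ []))) (genOP s n′)
      inner with size c ≤? m
      ... | yes a≤m = F.trans (boxSum-coef s (λ l → p (l ++ c ∷ [])) (m ∸ size c) n′ (ℕₚ.≤-trans (ℕₚ.m∸n≤m n (size c ℕ.* suc s)) n≤B))
        (lsum-cong (genOP s n′) (λ l → F.reflexive (≡.cong (λ b → indᶠ (b ∧ p (l ++ c ∷ []))) (count l))))
        where
        count : ∀ l → ⌊ numParts l ℕ.≟ m ∸ size c ⌋ ≡ ⌊ numParts (l ++ c ∷ []) ℕ.≟ m ⌋
        count l with numParts l ℕ.≟ m ∸ size c | numParts (l ++ c ∷ []) ℕ.≟ m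
        ... | yes _ | yes _ = ≡.refl
        ... | no _  | no _  = ≡.refl
        ... | yes e | no ¬e = ⊥-elim (¬e (≡.trans (numParts-++ l c) (≡.trans (≡.cong (ℕ._+ size c) e) (ℕₚ.m∸n+n≡m a≤m))))
        ... | no ¬e | yes e = ⊥-elim (¬e (≡.trans (≡.sym (ℕₚ.m+n∸n≡m _ (size c))) (≡.cong (_∸ size c) (≡.trans (≡.sym (numParts-++ l c)) e))))
      ... | no a≰m = F.sym (lsum-zero (genOP s n′) (λ l → F.reflexive (≡.cong (λ b → indᶠ (b ∧ p (l ++ c ∷ [])))
          (⌊⌋-false (numParts (l ++ c ∷ []) ℕ.≟ m) (λ e → a≰m (≡.subst (size c ℕ.≤_) (≡.trans (≡.sym (numParts-++ l c)) e) (ℕₚ.m≤n+m (size c) (numParts l))))))))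

  genOP-count-pad : ∀ k i m d n →
    lsum (λ l → indᶠ (⌊ numParts l ℕ.≟ m ⌋ ∧ good k i l)) (genOP (d ℕ.+ n) n)
      F.≈ lsum (λ l → indᶠ (⌊ numParts l ℕ.≟ m ⌋ ∧ good k i l)) (genOP n n)
  genOP-count-pad k i m zero    n = F.refl
  genOP-count-pad k i m (suc d) n = F.trans (genOP-pad _ (d ℕ.+ n) n (ℕₚ.m≤n+m n d))
    (F.trans (lsum-cong (genOP (d ℕ.+ n) n) (λ l → F.reflexive (≡.cong₂ (λ a b → indᶠ (⌊ a ℕ.≟ m ⌋ ∧ b))
        (≡.trans (numParts-++ l (0 , false)) (ℕₚ.+-identityʳ _)) (good-pad k i l))))
      (genOP-count-pad k i m d n))

-- The multisum

data Decreasing : ℕ → List ℕ → Set where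
  []  : ∀ {a} → Decreasing a []
  _∷_ : ∀ {a b ts} → b ℕ.≤ a → Decreasing b ts → Decreasing a (b ∷ ts)

-- The exponent of Q due to N_2, ..., N_{k-1}, for i = m + 1: the first `m` entries give squares
-- only, the later ones have index above i and also enter linearly.
expo : ℕ → List ℕ → ℕ
expo m       []       = 0
expo zero    (b ∷ ts) = b ℕ.* b ℕ.+ b ℕ.+ expo 0 ts
expo (suc m) (b ∷ ts) = b ℕ.* b ℕ.+ expo m ts

module TupleSums (A : CommutativeRing 0ℓ 0ℓ) (s : CommutativeRing.Carrier A)
  (iq : ℕ → CommutativeRing.Carrier A)
  (iq-inv : Base.IsInverseFamily A s (CommutativeRing.1# A) iq)
  (w : ℕ → CommutativeRing.Carrier A) (w-step : WeightStep.IsWeight A s w) where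

  open PowerSeries A using (seriesRing; X; const; const-·; const-*; const-+; const-^; L; X^-above; X^-below; _≋_)
  private
    module R = CommutativeRing seriesRing
  open GeneratingFunction A s iq iq-inv w w-step using (G; 𝕤; const-pow)
  module CR = Chain seriesRing 𝕤 (const ∘ iq)
  open CommutativeRing A
  open import Relation.Binary.Reasoning.Setoid setoid
  open import Algebra.Properties.Semiring.Exp semiring using (_^_; ^-congˡ; ^-homo-*)
  open import Algebra.Properties.Semiring.Exp R.semiring using () renaming (_^_ to _^ᴿ_; ^-congˡ to ^ᴿ-congˡ)
  open import Algebra.Properties.CommutativeSemiring.Exp R.commutativeSemiring using () renaming (^-distrib-* to ^ᴿ-distrib-*)
  open RingSolver A
  open Base A s
  open Chain A s iq using (recip; ρ)
  open FiniteSums A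
  open ListSums A
  module RS = FiniteSums seriesRing

  recip-const : ∀ i n → CR.recip (const ∘ i) n ≋ const (recip i n)
  recip-const i zero    = R.refl
  recip-const i (suc n) = R.trans (R.*-congˡ {const (i 0)} (recip-const (i ∘ suc) n)) (R.sym (const-* (i 0) _))

  ρ-const : ∀ M r → CR.ρ M r ≋ const (ρ M r)
  ρ-const M       zero    = recip-const iq M
  ρ-const zero    (suc r) = λ { zero → refl ; (suc n) → refl }
  ρ-const (suc M) (suc r) = ρ-const M r

  sum<-coef : ∀ n f m → RS.sum< n f m ≈ sum< n (λ i → f i m)
  sum<-coef zero    f m = refl
  sum<-coef (suc n) f m = +-congʳ (sum<-coef n f m)

  factor : Carrier → ℕ → ℕ → Carrier
  factor z a b = z ^ b * Q ^ (b ℕ.* b) * ρ a b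

  cons : Carrier → ℕ → (ℕ → List ℕ → Carrier) → List ℕ → Carrier
  cons z a τ []       = 0#
  cons z a τ (b ∷ ts) = factor z a b * τ b ts

  lsum-*ˡ : ∀ {T : Set} a (φ : T → Carrier) xs → a * lsum φ xs ≈ lsum (λ x → a * φ x) xs
  lsum-*ˡ a φ []       = zeroʳ a
  lsum-*ˡ a φ (x ∷ xs) = trans (distribˡ a _ _) (+-congˡ (lsum-*ˡ a φ xs))

  lsum-decTuples : ∀ (φ : List ℕ → Carrier) l a n → lsum φ (decTuples (suc l) a n)
    ≈ sum< (suc (a ⊓ n)) (λ b → lsum (λ ts → φ (b ∷ ts)) (decTuples l b (n ∸ b)))
  lsum-decTuples φ l a n = trans (lsum-concatMap φ (λ b → map (b ∷_) (decTuples l b (n ∸ b))) (upTo (suc (a ⊓ n))))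
    (trans (lsum-upTo _ (suc (a ⊓ n))) (sum<-cong (suc (a ⊓ n)) (λ b → lsum-map φ (b ∷_) (decTuples l b (n ∸ b)))))

  private
    D-term : ∀ {y} z f a b → y ≋ X R.* const z →
      y ^ᴿ b R.* (𝕤 R.* 𝕤) ^ᴿ (b ℕ.* b) R.* CR.ρ a b R.* f ≋ X ^ᴿ b R.* (const (factor z a b) R.* f)
    D-term {y} z f a b y≋ = R.trans
      (R.*-congʳ {f} (R.*-cong (R.*-cong (R.trans (^ᴿ-congˡ b y≋) (R.trans (^ᴿ-distrib-* X (const z) b) (R.*-congˡ {X ^ᴿ b} (R.sym (const-^ z b)))))
          (R.sym (const-pow (b ℕ.* b)))) (ρ-const a b)))
      (R.trans (RSolve.solve 5 (λ x z q r f → x RSolve.:* z RSolve.:* q RSolve.:* r RSolve.:* f RSolve.:= x RSolve.:* (z RSolve.:* q RSolve.:* r RSolve.:* f)) R.refl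
          (X ^ᴿ b) (const (z ^ b)) (const (Q ^ (b ℕ.* b))) (const (ρ a b)) f)
        (R.*-congˡ {X ^ᴿ b} (R.*-congʳ {f} (R.trans (R.*-congʳ {const (ρ a b)} (R.sym (const-* (z ^ b) _))) (R.sym (const-* _ (ρ a b)))))))
      where module RSolve = RingSolver seriesRing

    sum<-⊓ : ∀ a n (f : ℕ → Carrier) → (∀ b → n ℕ.< b → f b ≈ 0#) → sum< (suc a) f ≈ sum< (suc (a ⊓ n)) f
    sum<-⊓ a n f h with a ℕ.≤? n
    ... | yes a≤n rewrite ℕₚ.m≤n⇒m⊓n≡m a≤n = refl
    ... | no  a≰n rewrite ℕₚ.m≥n⇒m⊓n≡n (ℕₚ.<⇒≤ (ℕₚ.≰⇒> a≰n)) = sum<-extend (suc a) f (ℕₚ.m≤n⇒m≤1+n (ℕₚ.≰⇒> a≰n)) h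

  -- The factor x^b leaves n - b for the remaining entries, as in `decTuples`; entries b > n do not
  -- reach x^n, whence the bound `a ⊓ n` there.
  D-coef : ∀ {y} z f (τ : ℕ → List ℕ → Carrier) l → y ≋ X R.* const z →
    (∀ b n → f b n ≈ lsum (τ b) (decTuples l b n)) →
    ∀ a n → CR.D y f a n ≈ lsum (cons z a τ) (decTuples (suc l) a n)
  D-coef {y} z f τ l y≋ h a n = begin
    CR.D y f a n
      ≈⟨ RS.sum<-cong (suc a) (λ b → D-term z (f b) a b y≋) n ⟩
    RS.sum< (suc a) (λ b → X ^ᴿ b R.* (const (factor z a b) R.* f b)) n
      ≈⟨ sum<-coef (suc a) _ n ⟩
    sum< (suc a) (λ b → (X ^ᴿ b R.* (const (factor z a b) R.* f b)) n)
      ≈⟨ sum<-⊓ a n _ (λ b n<b → X^-below b _ n n<b) ⟩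
    sum< (suc (a ⊓ n)) (λ b → (X ^ᴿ b R.* (const (factor z a b) R.* f b)) n)
      ≈⟨ sum<-cong′ (suc (a ⊓ n)) (λ { b (s≤s b≤) → term b (ℕₚ.≤-trans b≤ (ℕₚ.m⊓n≤n a n)) }) ⟩
    sum< (suc (a ⊓ n)) (λ b → lsum (λ ts → cons z a τ (b ∷ ts)) (decTuples l b (n ∸ b)))
      ≈⟨ lsum-decTuples (cons z a τ) l a n ⟨
    lsum (cons z a τ) (decTuples (suc l) a n) ∎
    where
    term : ∀ b → b ℕ.≤ n → (X ^ᴿ b R.* (const (factor z a b) R.* f b)) n
      ≈ lsum (λ ts → factor z a b * τ b ts) (decTuples l b (n ∸ b))
    term b b≤n = begin
      (X ^ᴿ b R.* (const (factor z a b) R.* f b)) n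
        ≡⟨ ≡.cong (X ^ᴿ b R.* (const (factor z a b) R.* f b)) (≡.sym (ℕₚ.m+[n∸m]≡n b≤n)) ⟩
      (X ^ᴿ b R.* (const (factor z a b) R.* f b)) (b ℕ.+ (n ∸ b))
        ≈⟨ X^-above b (const (factor z a b) R.* f b) (n ∸ b) ⟩
      (const (factor z a b) R.* f b) (n ∸ b)
        ≈⟨ const-· (factor z a b) (f b) (n ∸ b) ⟩
      factor z a b * f b (n ∸ b)
        ≈⟨ *-congˡ (h b (n ∸ b)) ⟩
      factor z a b * lsum (τ b) (decTuples l b (n ∸ b))
        ≈⟨ lsum-*ˡ _ (τ b) (decTuples l b (n ∸ b)) ⟩
      lsum (λ ts → factor z a b * τ b ts) (decTuples l b (n ∸ b)) ∎

  -- The innermost `D` meets a sequence supported at 0, so it yields the last denominator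
  -- 1/(Q;Q)_{N_{k-1}} and no summation variable. Hence j + 1 applications correspond to tuples of
  -- length j.
  D-unit : ∀ {y} f k → f 0 ≋ const k → (∀ N → f (suc N) ≋ R.0#) → ∀ a n →
    CR.D y f a n ≈ lsum (λ _ → k * ρ a 0) (decTuples 0 a n)
  D-unit {y} f k f0 f⁺ a n = trans (series n) (coef n)
    where
    series : CR.D y f a ≋ const (k * ρ a 0)
    series = R.trans (RS.sum<-head a _) (R.trans (R.+-cong
        (R.trans (R.*-cong (R.*-cong (R.*-identityˡ R.1#) (ρ-const a 0)) f0)
          (R.trans (R.*-congʳ {const k} (R.*-identityˡ (const (ρ a 0)))) (R.trans (R.*-comm (const (ρ a 0)) (const k)) (R.sym (const-* k (ρ a 0))))))
        (RS.sum<-zero a (λ N → R.trans (R.*-congˡ {y ^ᴿ suc N R.* (𝕤 R.* 𝕤) ^ᴿ (suc N ℕ.* suc N) R.* CR.ρ a (suc N)} (f⁺ N)) (R.zeroʳ _))))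
      (R.+-identityʳ _))
    coef : ∀ n → const (k * ρ a 0) n ≈ lsum (λ _ → k * ρ a 0) (decTuples 0 a n)
    coef zero    = sym (+-identityʳ _)
    coef (suc n) = refl

  tB : ℕ → List ℕ → Carrier
  tB a []       = 1# * ρ a 0
  tB a (b ∷ ts) = factor Q a b * tB b ts

  -- The value on `[]` with `suc m` is the case i = k, where N_k = 0 turns 1 + Q^(N_k) into 1 + 1.
  tA : ℕ → ℕ → List ℕ → Carrier
  tA zero    a ts       = (1# + Q ^ a) * tB a ts
  tA (suc m) a []       = (1# + 1#) * ρ a 0
  tA (suc m) a (b ∷ ts) = factor 1# a b * tA m b ts

  private
    XQ≋ : X R.* (𝕤 R.* 𝕤) ≋ X R.* const Q
    XQ≋ = R.*-congˡ {X} (R.sym (const-* s s))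

    X≋ : X ≋ X R.* const 1#
    X≋ = R.sym (R.*-identityʳ X)

    nonempty : ∀ z τ (σ : ℕ → List ℕ → Carrier) a l n → (∀ b ts → cons z a τ (b ∷ ts) ≈ σ a (b ∷ ts)) →
      lsum (cons z a τ) (decTuples (suc l) a n) ≈ lsum (σ a) (decTuples (suc l) a n)
    nonempty z τ σ a l n h = trans (lsum-decTuples (cons z a τ) l a n) (trans
      (sum<-cong (suc (a ⊓ n)) (λ b → lsum-cong (decTuples l b (n ∸ b)) (h b)))
      (sym (lsum-decTuples (σ a) l a n)))

  iterB-coef : ∀ n a k → CR.iter (X R.* (𝕤 R.* 𝕤)) (suc n) CR.unit a k ≈ lsum (tB a) (decTuples n a k)
  iterB-coef zero a k = trans (D-unit CR.unit 1# R.refl (λ N → R.refl) a k) (empty k)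
    where
    empty : ∀ k → lsum (λ _ → 1# * ρ a 0) (decTuples 0 a k) ≈ lsum (tB a) (decTuples 0 a k)
    empty zero    = refl
    empty (suc k) = refl
  iterB-coef (suc n) a k = trans (D-coef Q _ tB n XQ≋ (iterB-coef n) a k)
    (nonempty Q tB tB a n k (λ b ts → refl))

  -- The recursion on m ends at m = 0 if n > 0, but at m = 1 if n = 0: then 1 + E acts on `unit`
  -- itself, and the first `D` after it is the one that yields no variable.
  VG-coef : ∀ m n l → m ℕ.+ n ≡ suc l → ∀ a k → CR.VG X m n a k ≈ lsum (tA m a) (decTuples l a k)
  VG-coef zero (suc n) .n ≡.refl a k = begin
    ((R.1# R.+ (𝕤 R.* 𝕤) ^ᴿ a) R.* iB) k
      ≈⟨ R.*-congʳ {iB} (R.trans (R.+-congˡ {R.1#} (R.sym (const-pow a))) (R.sym (const-+ 1# (Q ^ a)))) k ⟩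
    (const (1# + Q ^ a) R.* iB) k
      ≈⟨ const-· (1# + Q ^ a) iB k ⟩
    (1# + Q ^ a) * iB k
      ≈⟨ *-congˡ (iterB-coef n a k) ⟩
    (1# + Q ^ a) * lsum (tB a) (decTuples n a k)
      ≈⟨ lsum-*ˡ _ (tB a) (decTuples n a k) ⟩
    lsum (tA 0 a) (decTuples n a k) ∎
    where iB = CR.iter (X R.* (𝕤 R.* 𝕤)) (suc n) CR.unit a
  VG-coef (suc zero) zero .0 ≡.refl a k = trans
    (D-unit (CR.onePlusE CR.unit) (1# + 1#) (R.trans (R.*-identityʳ (R.1# R.+ R.1#)) (R.sym (const-+ 1# 1#)))
      (λ N → R.zeroʳ (R.1# R.+ (𝕤 R.* 𝕤) ^ᴿ suc N)) a k) (empty k)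
    where
    empty : ∀ k → lsum (λ _ → (1# + 1#) * ρ a 0) (decTuples 0 a k) ≈ lsum (tA 1 a) (decTuples 0 a k)
    empty zero    = refl
    empty (suc k) = refl
  VG-coef (suc zero) (suc n) (suc l) eq a k = trans (D-coef 1# _ (tA 0) l X≋ (VG-coef 0 (suc n) l (≡.cong ℕ.pred eq)) a k)
    (nonempty 1# (tA 0) (tA 1) a l k (λ b ts → refl))
  VG-coef (suc (suc m)) n (suc l) eq a k = trans (D-coef 1# _ (tA (suc m)) l X≋ (VG-coef (suc m) n l (≡.cong ℕ.pred eq)) a k)
    (nonempty 1# (tA (suc m)) (tA (suc (suc m))) a l k (λ b ts → refl))

  L-coef : ∀ v f m → L v f m ≈ sum< (suc m) (λ a → v a * f a (m ∸ a))
  L-coef v f zero    = sym (+-identityˡ _)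
  L-coef v f (suc m) = trans (+-congˡ (L-coef (v ∘ suc) (f ∘ suc) m)) (sym (sum<-head (suc m) _))

  tuple-term : ℕ → List ℕ → Carrier
  tuple-term m []       = 0#
  tuple-term m (a ∷ ts) = w a * tA m a ts

  G-coef : ∀ m n l → m ℕ.+ n ≡ suc l → ∀ k → G m n k ≈ lsum (tuple-term m) (decTuples (suc l) k k)
  G-coef m n l eq k = begin
    L w (CR.VG X m n) k
      ≈⟨ L-coef w _ k ⟩
    sum< (suc k) (λ a → w a * CR.VG X m n a (k ∸ a))
      ≈⟨ sum<-cong (suc k) (λ a → trans (*-congˡ (VG-coef m n l eq a (k ∸ a))) (lsum-*ˡ (w a) (tA m a) (decTuples l a (k ∸ a)))) ⟩
    sum< (suc k) (λ a → lsum (λ ts → w a * tA m a ts) (decTuples l a (k ∸ a)))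
      ≡⟨ ≡.cong (λ z → sum< (suc z) (λ a → lsum (λ ts → w a * tA m a ts) (decTuples l a (k ∸ a)))) (≡.sym (ℕₚ.⊓-idem k)) ⟩
    sum< (suc (k ⊓ k)) (λ a → lsum (λ ts → w a * tA m a ts) (decTuples l a (k ∸ a)))
      ≈⟨ lsum-decTuples (tuple-term m) l k k ⟨
    lsum (tuple-term m) (decTuples (suc l) k k) ∎

  lsum-decTuples-cong : ∀ l a n {φ ψ : List ℕ → Carrier} →
    (∀ ts → length ts ≡ l → Decreasing a ts → φ ts ≈ ψ ts) →
    lsum φ (decTuples l a n) ≈ lsum ψ (decTuples l a n)
  lsum-decTuples-cong zero    a zero    h = +-congʳ (h [] ≡.refl [])
  lsum-decTuples-cong zero    a (suc n) h = refl
  lsum-decTuples-cong (suc l) a n {φ} {ψ} h = trans (lsum-decTuples φ l a n) (trans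
    (sum<-cong′ (suc (a ⊓ n)) (λ { b (s≤s b≤) → lsum-decTuples-cong l b (n ∸ b)
      (λ ts e d → h (b ∷ ts) (≡.cong suc e) (ℕₚ.≤-trans b≤ (ℕₚ.m⊓n≤m a n) ∷ d)) }))
    (sym (lsum-decTuples ψ l a n)))

  recips : ℕ → List ℕ → Carrier
  recips a []       = recip iq a
  recips a (b ∷ ts) = recip iq (a ∸ b) * recips b ts

  private
    ρ-∸ : ∀ a b → b ℕ.≤ a → ρ a b ≈ recip iq (a ∸ b)
    ρ-∸ a       zero    _       = refl
    ρ-∸ (suc a) (suc b) (s≤s h) = ρ-∸ a b h

    one^ : ∀ b → 1# ^ b ≈ 1#
    one^ zero    = refl
    one^ (suc b) = trans (*-identityˡ _) (one^ b)

  tB-closed : ∀ a ts → Decreasing a ts → tB a ts ≈ Q ^ expo 0 ts * recips a ts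
  tB-closed a []       []      = refl
  tB-closed a (b ∷ ts) (h ∷ d) = begin
    Q ^ b * Q ^ (b ℕ.* b) * ρ a b * tB b ts
      ≈⟨ *-cong (*-congˡ (ρ-∸ a b h)) (tB-closed b ts d) ⟩
    Q ^ b * Q ^ (b ℕ.* b) * recip iq (a ∸ b) * (Q ^ expo 0 ts * recips b ts)
      ≈⟨ solve 5 (λ x y r z v → x :* y :* r :* (z :* v) := (y :* x) :* z :* (r :* v)) refl _ _ _ _ _ ⟩
    Q ^ (b ℕ.* b) * Q ^ b * Q ^ expo 0 ts * (recip iq (a ∸ b) * recips b ts)
      ≈⟨ *-congʳ (trans (*-congʳ (sym (^-homo-* Q (b ℕ.* b) b))) (sym (^-homo-* Q (b ℕ.* b ℕ.+ b) _))) ⟩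
    Q ^ expo 0 (b ∷ ts) * recips a (b ∷ ts) ∎

  tA-closed : ∀ m a ts → Decreasing a ts →
    tA m a ts ≈ Q ^ expo m ts * ((1# + Q ^ Nat (a ∷ ts) (suc m)) * recips a ts)
  tA-closed zero a ts d = trans (*-congˡ (tB-closed a ts d))
    (solve 3 (λ a b c → a :* (b :* c) := b :* (a :* c)) refl _ _ _)
  tA-closed (suc m) a [] d = sym (*-identityˡ _)
  tA-closed (suc m) a (b ∷ ts) (h ∷ d) = begin
    1# ^ b * Q ^ (b ℕ.* b) * ρ a b * tA m b ts
      ≈⟨ *-cong (*-cong (*-congʳ (one^ b)) (ρ-∸ a b h)) (tA-closed m b ts d) ⟩
    1# * Q ^ (b ℕ.* b) * recip iq (a ∸ b) * (Q ^ expo m ts * ((1# + Q ^ Nat (b ∷ ts) (suc m)) * recips b ts))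
      ≈⟨ solve 5 (λ y r z u v → :1 :* y :* r :* (z :* (u :* v)) := y :* z :* (u :* (r :* v))) refl _ _ _ _ _ ⟩
    Q ^ (b ℕ.* b) * Q ^ expo m ts * ((1# + Q ^ Nat (b ∷ ts) (suc m)) * (recip iq (a ∸ b) * recips b ts))
      ≈⟨ *-congʳ (^-homo-* Q (b ℕ.* b) (expo m ts)) ⟨
    Q ^ expo (suc m) (b ∷ ts) * ((1# + Q ^ Nat (b ∷ ts) (suc m)) * recips a (b ∷ ts)) ∎

  -- The symbols (-s;s²)_N and (-s²;s²)_N, largest factor first; in this order the factors of the
  -- given symbols appear once their negative exponents are pulled out.
  oddP evenP : ℕ → Carrier
  oddP zero    = 1#
  oddP (suc N) = (1# + s ^ suc (2 ℕ.* N)) * oddP N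
  evenP zero    = 1#
  evenP (suc N) = (1# + s ^ (2 ℕ.* suc N)) * evenP N

  -- (-q²;q²)_{a-1}; for a = 0 this is 1/2, the value of w 0.
  evenP⁻ : ℕ → Carrier
  evenP⁻ zero    = w 0
  evenP⁻ (suc N) = evenP N

  weight-closed : w 0 * (1# + 1#) ≈ 1# → ∀ a → w a ≈ s ^ a * (evenP⁻ a * oddP a)
  weight-closed half zero    = solve 1 (λ w → w := :1 :* (w :* :1)) refl _
  weight-closed half (suc N) = go N
    where
    go : ∀ N → w (suc N) ≈ s ^ suc N * (evenP N * oddP (suc N))
    go zero    = begin
      w 1                                                ≈⟨ w-step 0 ⟩
      -- The factor 1 + Q^0 = 2 of the first ratio cancels the initial 1/2, so halves occur at N_1 =
      -- 0 only.
      w 0 * (s * ((1# + 1#) * (1# + s * 1#)))            ≈⟨ solve 2 (λ w s → w :* (s :* ((:1 :+ :1) :* (:1 :+ s :* :1))) := (w :* (:1 :+ :1)) :* (s :* :1 :* (:1 :* ((:1 :+ s :* :1) :* :1)))) refl _ s ⟩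
      (w 0 * (1# + 1#)) * (s ^ 1 * (1# * oddP 1))        ≈⟨ *-congʳ half ⟩
      1# * (s ^ 1 * (1# * oddP 1))                       ≈⟨ *-identityˡ _ ⟩
      s ^ 1 * (1# * oddP 1) ∎
    go (suc N) = begin
      w (suc (suc N))
        ≈⟨ w-step (suc N) ⟩
      w (suc N) * (s * ((1# + Q ^ suc N) * (1# + s * Q ^ suc N)))
        ≈⟨ *-cong (go N) (*-congˡ (*-cong (+-congˡ (Q^≈ (suc N))) (+-congˡ (*-congˡ (Q^≈ (suc N)))))) ⟩
      s ^ suc N * (evenP N * oddP (suc N)) * (s * ((1# + s ^ (2 ℕ.* suc N)) * (1# + s ^ suc (2 ℕ.* suc N))))
        ≈⟨ solve 6 (λ p e o s x y → p :* (e :* o) :* (s :* (x :* y)) := s :* p :* ((x :* e) :* (y :* o))) refl _ _ _ s _ (1# + s ^ suc (2 ℕ.* suc N)) ⟩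
      s ^ suc (suc N) * (evenP (suc N) * oddP (suc (suc N))) ∎

  tuple-term-closed : w 0 * (1# + 1#) ≈ 1# → ∀ m a ts → Decreasing a ts →
    s ^ (a ℕ.+ 2 ℕ.* expo m ts) * (evenP⁻ a * (oddP a * (1# * ((1# + s ^ (2 ℕ.* Nat (a ∷ ts) (suc m))) * recips a ts))))
      ≈ tuple-term m (a ∷ ts)
  tuple-term-closed half m a ts d = sym (begin
    w a * tA m a ts
      ≈⟨ *-cong (weight-closed half a) (tA-closed m a ts d) ⟩
    s ^ a * (evenP⁻ a * oddP a) * (Q ^ expo m ts * ((1# + Q ^ Nat (a ∷ ts) (suc m)) * recips a ts))
      ≈⟨ *-congˡ (*-cong (Q^≈ (expo m ts)) (*-congʳ (+-congˡ (Q^≈ (Nat (a ∷ ts) (suc m)))))) ⟩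
    s ^ a * (evenP⁻ a * oddP a) * (s ^ (2 ℕ.* expo m ts) * ((1# + s ^ (2 ℕ.* Nat (a ∷ ts) (suc m))) * recips a ts))
      ≈⟨ solve 6 (λ p e o x y r → p :* (e :* o) :* (x :* (y :* r)) := p :* x :* (e :* (o :* (:1 :* (y :* r))))) refl _ _ _ _ _ _ ⟩
    s ^ a * s ^ (2 ℕ.* expo m ts) * (evenP⁻ a * (oddP a * (1# * ((1# + s ^ (2 ℕ.* Nat (a ∷ ts) (suc m))) * recips a ts))))
      ≈⟨ *-congʳ (^-homo-* s a (2 ℕ.* expo m ts)) ⟨
    _ ∎)

-- Laurent series with rational coefficients

ℚ-ring : CommutativeRing 0ℓ 0ℓ
ℚ-ring = ℚₚ.+-*-commutativeRing

module ℚ⟦q⟧ = PowerSeries ℚ-ring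

ℚ⟦q⟧-ring : CommutativeRing 0ℓ 0ℓ
ℚ⟦q⟧-ring = ℚ⟦q⟧.seriesRing

module A = CommutativeRing ℚ⟦q⟧-ring
open import Algebra.Properties.Semiring.Exp A.semiring using () renaming (_^_ to _^ᴬ_)

q : A.Carrier
q = ℚ⟦q⟧.X

open Base ℚ⟦q⟧-ring q using (Q^≈) renaming (Q to q²)

-- `geom` takes the predecessor of the period, so this is 1/(1 - q^(2j+2)).
iq : ℕ → A.Carrier
iq j = co (geom 1ℚ (1 ℕ.+ 2 ℕ.* j))

powℚ-1 : ∀ n → powℚ 1ℚ n ≡ 1ℚ
powℚ-1 zero    = ≡.refl
powℚ-1 (suc n) = ≡.trans (ℚₚ.*-identityˡ _) (powℚ-1 n)

-- The coefficients have period p + 1, so subtracting the shifted series leaves only the first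
-- period, which is 1, 0, ..., 0.
geom-inverse : ∀ p → (A.1# A.- q ^ᴬ suc p) A.* co (geom 1ℚ p) A.≈ A.1#
geom-inverse p n = ≡.trans (A.trans (A.distribʳ g A.1# (A.- q ^ᴬ suc p)) (A.+-cong (A.*-identityˡ g) (A.sym (-‿distribˡ-* (q ^ᴬ suc p) g))) n) (coef n)
  where
  open import Algebra.Properties.Ring A.ring using (-‿distribˡ-*)
  g = co (geom 1ℚ p)
  g≡ : ∀ n → g n ≡ (if ⌊ n % suc p ℕ.≟ 0 ⌋ then 1ℚ else 0ℚ)
  g≡ n = ≡.cong (λ z → if ⌊ n % suc p ℕ.≟ 0 ⌋ then z else 0ℚ) (powℚ-1 (n ℕ./ suc p))
  coef : ∀ n → g n ℚ.- (q ^ᴬ suc p A.* g) n ≡ A.1# n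
  coef n with n ℕ.<? suc p
  ... | yes n<p = ≡.trans (≡.cong₂ ℚ._-_ (g≡ n) (ℚ⟦q⟧.X^-below (suc p) g n n<p)) (small n n<p)
    where
    small : ∀ n → n ℕ.< suc p → (if ⌊ n % suc p ℕ.≟ 0 ⌋ then 1ℚ else 0ℚ) ℚ.- 0ℚ ≡ A.1# n
    small zero    _ = ≡.refl
    small (suc n) h rewrite m<n⇒m%n≡m h = ≡.refl
  ... | no n≮p with m , ≡.refl ← ℕₚ.m≤n⇒∃[o]m+o≡n (ℕₚ.≮⇒≥ n≮p) =
    ≡.trans (≡.cong₂ ℚ._-_ (≡.trans (g≡ (suc p ℕ.+ m)) (≡.trans (≡.cong (λ z → if ⌊ z ℕ.≟ 0 ⌋ then 1ℚ else 0ℚ) mod≡) (≡.sym (g≡ m))))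
                           (ℚ⟦q⟧.X^-above (suc p) g m))
            (ℚₚ.+-inverseʳ (g m))
    where
    mod≡ : (suc p ℕ.+ m) % suc p ≡ m % suc p
    mod≡ = ≡.trans (≡.cong (_% suc p) (ℕₚ.+-comm (suc p) m)) ([m+n]%n≡m%n m (suc p))

iq-inv : Base.IsInverseFamily ℚ⟦q⟧-ring q A.1# iq
iq-inv j = A.trans (A.*-congʳ {iq j} (A.+-congˡ {A.1#} (A.-‿cong (A.trans (A.*-identityˡ (q² ^ᴬ suc j))
    (A.trans (Q^≈ (suc j)) (A.reflexive (≡.cong (q ^ᴬ_) (ℕₚ.*-suc 2 j))))))))
  (geom-inverse (1 ℕ.+ 2 ℕ.* j))

convolution : ∀ (f g : ℕ → ℚ) n → sumTo (suc n) (λ j → f j ℚ.* g (n ∸ j)) ≡ (f A.* g) n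
convolution f g zero    = ℚₚ.+-identityˡ (f 0 ℚ.* g 0)
convolution f g (suc n) = ≡.trans (head (suc n) (λ j → f j ℚ.* g (suc n ∸ j)))
  (≡.cong (f 0 ℚ.* g (suc n) ℚ.+_) (convolution (f ∘ suc) g n))
  where
  head : ∀ n h → sumTo (suc n) h ≡ h 0 ℚ.+ sumTo n (h ∘ suc)
  head zero    h = ≡.trans (ℚₚ.+-identityˡ (h 0)) (≡.sym (ℚₚ.+-identityʳ (h 0)))
  head (suc n) h = ≡.trans (≡.cong (ℚ._+ h (suc n)) (head n h)) (ℚₚ.+-assoc (h 0) (sumTo n (h ∘ suc)) (h (suc n)))

-- Presents `S` as q^v times the power series `f`. The valuation is recorded exactly, so that
-- exponents add under `⊗`.
record Is (S : LSeries) (v : ℤ) (f : A.Carrier) : Set where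
  constructor is
  field
    val≡ : val S ≡ v
    co≈  : co S A.≈ f
open Is

⊗-is : ∀ {S T v u f g} → Is S v f → Is T u g → Is (S ⊗ T) (v ℤ.+ u) (f A.* g)
⊗-is {S} {T} {f = f} {g} (is p h) (is r k) = is (≡.cong₂ ℤ._+_ p r)
  (λ n → ≡.trans (convolution (co S) (co T) n) (A.*-cong {co S} {f} {co T} {g} h k n))

Is-≈ : ∀ {S v f g} → Is S v f → f A.≈ g → Is S v g
Is-≈ (is p h) e = is p (λ n → ≡.trans (h n) (e n))

Is-val : ∀ {S v u f} → v ≡ u → Is S v f → Is S u f
Is-val ≡.refl p = p

mono-is : ∀ e → Is (mono 1ℚ e) e A.1#
mono-is e = is ≡.refl (λ { zero → ≡.refl ; (suc n) → ≡.refl })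

-- The body of `coeff` with the difference of exponents as an argument, so that it can be rewritten.
coAt : LSeries → ℤ → ℚ
coAt S (+ j)    = co S j
coAt S -[1+ _ ] = 0ℚ

coeff-at : ∀ S e {z} → e ℤ.- val S ≡ z → coeff S e ≡ coAt S z
coeff-at S e ≡.refl with e ℤ.- val S
... | + j      = ≡.refl
... | -[1+ _ ] = ≡.refl

shifted : A.Carrier → ℤ → ℚ
shifted f (+ j)    = f j
shifted f -[1+ _ ] = 0ℚ

q^-shifted : ∀ d f n → (q ^ᴬ d A.* f) n ≡ shifted f (n ⊖ d)
q^-shifted d f n with d ℕ.≤? n
... | yes d≤n = ≡.trans (≡.cong (q ^ᴬ d A.* f) (≡.sym (ℕₚ.m+[n∸m]≡n d≤n)))
  (≡.trans (ℚ⟦q⟧.X^-above d f (n ∸ d)) (≡.cong (shifted f) (≡.sym (ℤₚ.⊖-≥ d≤n))))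
... | no d≰n = ≡.trans (ℚ⟦q⟧.X^-below d f n n<d) (≡.cong (shifted f) (≡.sym neg))
  where
  n<d = ℕₚ.≰⇒> d≰n
  neg : n ⊖ d ≡ -[1+ ℕ.pred (d ∸ n) ]
  neg = ≡.trans (ℤₚ.⊖-< n<d) (≡.cong (λ z → ℤ.- (+ z)) (≡.sym (ℕₚ.suc-pred (d ∸ n) {{ℕ.>-nonZero (ℕₚ.m<n⇒0<n∸m n<d)}})))

coeff-is : ∀ {S e f} → Is S (+ e) f → ∀ n → coeff S (+ n) ≡ (q ^ᴬ e A.* f) n
coeff-is {S} {e} {f} (is p h) n = ≡.trans
  (coeff-at S (+ n) (≡.trans (≡.cong (λ z → + n ℤ.- z) p) (ℤₚ.m-n≡m⊖n n e)))
  (≡.trans (coAt≡ (n ⊖ e)) (≡.sym (q^-shifted e f n)))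
  where
  coAt≡ : ∀ z → coAt S z ≡ shifted f z
  coAt≡ (+ j)    = h j
  coAt≡ -[1+ _ ] = ≡.refl

private
  1^ : ∀ d n → shifted A.1# (n ⊖ d) ≡ (q ^ᴬ d) n
  1^ d n = ≡.trans (≡.sym (q^-shifted d A.1# n)) (A.*-identityʳ (q ^ᴬ d) n)

  coAt-mono : ∀ e z → coAt (mono 1ℚ e) z ≡ shifted A.1# z
  coAt-mono e (+ zero)  = ≡.refl
  coAt-mono e (+ suc j) = ≡.refl
  coAt-mono e -[1+ _ ]  = ≡.refl

one-plus-is : ∀ d → Is (oneS ⊕ q^ (+ d)) (+ 0) (A.1# A.+ q ^ᴬ d)
one-plus-is d = is ≡.refl (λ n → ≡.cong₂ ℚ._+_
  (≡.trans (coeff-at oneS (+ 0 ℤ.+ + n) (ℤₚ.+-identityʳ (+ n))) (coAt-mono (+ 0) (+ n)))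
  (≡.trans (coeff-at (q^ (+ d)) (+ 0 ℤ.+ + n) (ℤₚ.m-n≡m⊖n n d)) (≡.trans (coAt-mono (+ d) (n ⊖ d)) (1^ d n))))

-- A sum starts at the smaller exponent, so 1 + q^(-(p+1)) is stored as q^(-(p+1)) times 1 +
-- q^(p+1).
bin-is : ∀ p {e} → e ≡ -[1+ p ] → Is (bin -ℚ1 e) -[1+ p ] (A.1# A.+ q ^ᴬ suc p)
bin-is p ≡.refl = is ≡.refl (λ n → ≡.trans (≡.cong₂ ℚ._+_
    (≡.trans (coeff-at oneS (-[1+ p ] ℤ.+ + n) (ℤₚ.+-identityʳ (n ⊖ suc p))) (≡.trans (coAt-mono (+ 0) (n ⊖ suc p)) (1^ (suc p) n)))
    (≡.trans (coeff-at (q^ -[1+ p ]) (-[1+ p ] ℤ.+ + n) (cancel n)) (coAt-mono -[1+ p ] (+ n))))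
  (ℚₚ.+-comm ((q ^ᴬ suc p) n) (A.1# n)))
  where
  cancel : ∀ n → (-[1+ p ] ℤ.+ + n) ℤ.- -[1+ p ] ≡ + n
  cancel n = ≡.trans (≡.cong (λ z → z ℤ.- -[1+ p ]) (ℤₚ.+-comm -[1+ p ] (+ n))) (≡.trans (ℤₚ.+-assoc (+ n) -[1+ p ] (+ suc p)) (≡.trans (≡.cong (λ z → + n ℤ.+ z) (ℤₚ.+-inverseˡ (+ suc p))) (ℤₚ.+-identityʳ (+ n))))

prodSeq : (ℕ → LSeries) → ℕ → LSeries
prodSeq h n = prodL (map h (upTo n))

private
  map-applyUpTo′ : ∀ {X : Set} (h : ℕ → X) g n → map h (applyUpTo g n) ≡ applyUpTo (h ∘ g) n
  map-applyUpTo′ h g zero    = ≡.refl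
  map-applyUpTo′ h g (suc n) = ≡.cong (h (g 0) ∷_) (map-applyUpTo′ h (g ∘ suc) n)

  applyUpTo-cong : ∀ {X : Set} {g h : ℕ → X} n → (∀ j → g j ≡ h j) → applyUpTo g n ≡ applyUpTo h n
  applyUpTo-cong zero    e = ≡.refl
  applyUpTo-cong (suc n) e = ≡.cong₂ _∷_ (e 0) (applyUpTo-cong n (e ∘ suc))

  map-upTo-suc : ∀ {X : Set} (h g : ℕ → X) n → (∀ j → h (suc j) ≡ g j) → map h (upTo (suc n)) ≡ h 0 ∷ map g (upTo n)
  map-upTo-suc h g n e = ≡.cong (h 0 ∷_) (≡.trans (map-applyUpTo′ h suc n)
    (≡.trans (applyUpTo-cong n e) (≡.sym (map-applyUpTo′ g id n))))

prodSeq-is : ∀ (h g : ℕ → LSeries) n {v u f f′} → (∀ j → h (suc j) ≡ g j) →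
  Is (h 0) v f → Is (prodSeq g n) u f′ → Is (prodSeq h (suc n)) (v ℤ.+ u) (f A.* f′)
prodSeq-is h g n {v} {u} {f} {f′} e p r = ≡.subst (λ S → Is S (v ℤ.+ u) (f A.* f′))
  (≡.cong prodL (≡.sym (map-upTo-suc h g n e))) (⊗-is {h 0} {prodSeq g n} p r)

open WeightStep ℚ⟦q⟧-ring q using (IsWeight)

-- The summand as a power of q times a power series

module Summand (w : ℕ → A.Carrier) (w-step : IsWeight w) (w₀ : w 0 A.≈ ℚ⟦q⟧.const ½) where
  open TupleSums ℚ⟦q⟧-ring q iq iq-inv w w-step
  open Chain ℚ⟦q⟧-ring q iq using (recip)

  private
    -- Raising N by one lowers the first exponent by 2, so the symbol for N + 1 without its first
    -- factor is the symbol for N.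
    down : ∀ c N j → (+ c ℤ.- + (2 ℕ.* suc N)) ℤ.+ + (2 ℕ.* suc j) ≡ (+ c ℤ.- + (2 ℕ.* N)) ℤ.+ + (2 ℕ.* j)
    down c N j = ≡.trans (≡.cong₂ (λ a b → (+ c ℤ.- + a) ℤ.+ + b) (ℕₚ.*-suc 2 N) (ℕₚ.*-suc 2 j))
      (lemma (+ c) (+ (2 ℕ.* N)) (+ (2 ℕ.* j)))
      where
      open import Data.Integer.Tactic.RingSolver using (solve-∀)
      lemma : ∀ c x y → (c ℤ.- (+ 2 ℤ.+ x)) ℤ.+ (+ 2 ℤ.+ y) ≡ (c ℤ.- x) ℤ.+ y
      lemma = solve-∀

    start-odd : ∀ N → (+ 1 ℤ.- + (2 ℕ.* suc N)) ℤ.+ + (2 ℕ.* 0) ≡ -[1+ 2 ℕ.* N ]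
    start-odd N = ≡.trans (≡.cong (λ a → (+ 1 ℤ.- + a) ℤ.+ + 0) (ℕₚ.*-suc 2 N)) (ℤₚ.+-identityʳ _)

    start-even : ∀ N → (+ 2 ℤ.- + (2 ℕ.* suc (suc N))) ℤ.+ + (2 ℕ.* 0) ≡ -[1+ suc (2 ℕ.* N) ]
    start-even N = ≡.trans (≡.cong (λ a → (+ 2 ℤ.- + a) ℤ.+ + 0) (≡.trans (ℕₚ.*-suc 2 (suc N)) (≡.cong (2 ℕ.+_) (ℕₚ.*-suc 2 N)))) (ℤₚ.+-identityʳ _)

    val-odd : ∀ N → -[1+ 2 ℕ.* N ] ℤ.+ (ℤ.- + (N ℕ.* N)) ≡ ℤ.- + (suc N ℕ.* suc N)
    val-odd N = ≡.trans (≡.sym (ℤₚ.neg-distrib-+ (+ suc (2 ℕ.* N)) (+ (N ℕ.* N)))) (≡.cong (λ z → ℤ.- + z) (lemma N))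
      where
      open import Data.Nat.Tactic.RingSolver using (solve-∀)
      lemma : ∀ N → suc (2 ℕ.* N) ℕ.+ N ℕ.* N ≡ suc N ℕ.* suc N
      lemma = solve-∀

    val-even : ∀ N → -[1+ suc (2 ℕ.* N) ] ℤ.+ (ℤ.- + (N ℕ.* suc N)) ≡ ℤ.- + (suc N ℕ.* suc (suc N))
    val-even N = ≡.trans (≡.sym (ℤₚ.neg-distrib-+ (+ suc (suc (2 ℕ.* N))) (+ (N ℕ.* suc N)))) (≡.cong (λ z → ℤ.- + z) (lemma N))
      where
      open import Data.Nat.Tactic.RingSolver using (solve-∀)
      lemma : ∀ N → suc (suc (2 ℕ.* N)) ℕ.+ N ℕ.* suc N ≡ suc N ℕ.* suc (suc N)
      lemma = solve-∀

  -- The factors 1 + q^(-d) = q^(-d)(1 + q^d) run over d = 2N-1, ..., 3, 1, and these d add up to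
  -- N².
  odd-is : ∀ N → Is (poch -ℚ1 (+ 1 ℤ.- + (2 ℕ.* N)) 2 (+ N)) (ℤ.- + (N ℕ.* N)) (oddP N)
  odd-is zero    = mono-is (+ 0)
  odd-is (suc N) = Is-val (val-odd N) (prodSeq-is
    (λ j → bin -ℚ1 ((+ 1 ℤ.- + (2 ℕ.* suc N)) ℤ.+ + (2 ℕ.* j))) (λ j → bin -ℚ1 ((+ 1 ℤ.- + (2 ℕ.* N)) ℤ.+ + (2 ℕ.* j))) N
    (λ j → ≡.cong (bin -ℚ1) (down 1 N j)) (bin-is (2 ℕ.* N) (start-odd N)) (odd-is N))

  even-is : ∀ N → Is (poch -ℚ1 (+ 2 ℤ.- + (2 ℕ.* suc N)) 2 (+ N)) (ℤ.- + (N ℕ.* suc N)) (evenP N)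
  even-is zero    = mono-is (+ 0)
  even-is (suc N) = Is-val (val-even N) (prodSeq-is
    (λ j → bin -ℚ1 ((+ 2 ℤ.- + (2 ℕ.* suc (suc N))) ℤ.+ + (2 ℕ.* j))) (λ j → bin -ℚ1 ((+ 2 ℤ.- + (2 ℕ.* suc N)) ℤ.+ + (2 ℕ.* j))) N
    (λ j → ≡.cong (bin -ℚ1) (down 2 (suc N) j))
    (Is-≈ (bin-is (suc (2 ℕ.* N)) (start-even N)) (A.+-congˡ {A.1#} (A.reflexive (≡.cong (q ^ᴬ_) (≡.sym (ℕₚ.*-suc 2 N))))))
    (even-is N))

  even⁻-is : ∀ a → Is (poch -ℚ1 (+ 2 ℤ.- + (2 ℕ.* a)) 2 (+ a ℤ.- + 1)) (ℤ.- + (a ℕ.* (a ∸ 1))) (evenP⁻ a)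
  -- At N_1 = 0 the index is -1 and the only factor is 1/(1 + q^0) = 1/2.
  even⁻-is zero = Is-≈ (⊗-is half-is (mono-is (+ 0))) (A.trans (A.*-identityʳ (ℚ⟦q⟧.const ½)) (A.sym w₀))
    where
    half-is : Is (invBin -ℚ1 (+ 0)) (+ 0) (ℚ⟦q⟧.const ½)
    half-is = is ≡.refl (λ { zero → ≡.refl ; (suc n) → ≡.refl })
  even⁻-is (suc N) = Is-val (≡.cong (λ z → ℤ.- + z) (ℕₚ.*-comm N (suc N))) (even-is N)

  recipPoch-is : ∀ n → Is (recipPoch 1ℚ (+ 2) 2 n) (+ 0) (recip iq n)
  recipPoch-is n = go (λ j → geom 1ℚ (1 ℕ.+ 2 ℕ.* j)) n (λ j → ≡.refl)
    where
    go : ∀ (h : ℕ → LSeries) n → (∀ j → val (h j) ≡ + 0) → Is (prodSeq h n) (+ 0) (recip (co ∘ h) n)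
    go h zero    e = mono-is (+ 0)
    go h (suc n) e = prodSeq-is h (h ∘ suc) n (λ j → ≡.refl) (is (e 0) A.refl) (go (h ∘ suc) n (e ∘ suc))

  private
    gap : List ℕ → ℕ → LSeries
    gap N j = recipPoch 1ℚ (+ 2) 2 (Nat N (suc j) ∸ Nat N (suc (suc j)))

  recips-is : ∀ a ts → Is (prodSeq (gap (a ∷ ts)) (suc (length ts))) (+ 0) (recips a ts)
  recips-is a []       = Is-≈ (⊗-is (recipPoch-is a) (mono-is (+ 0))) (A.*-identityʳ (recip iq a))
  recips-is a (b ∷ ts) = prodSeq-is (gap (a ∷ b ∷ ts)) (gap (b ∷ ts)) (suc (length ts)) (λ j → ≡.refl) (recipPoch-is (a ∸ b)) (recips-is b ts)

  private
    sumSeq : (ℕ → ℕ) → ℕ → ℕ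
    sumSeq h n = sum (map h (upTo n))

    sumSeq-suc : ∀ (h : ℕ → ℕ) n → sumSeq h (suc n) ≡ h 0 ℕ.+ sumSeq (h ∘ suc) n
    sumSeq-suc h n = ≡.cong sum (map-upTo-suc h (h ∘ suc) n (λ j → ≡.refl))

    square : List ℕ → ℕ → ℕ
    square ts j = Nat ts (1 ℕ.+ j) ℕ.* Nat ts (1 ℕ.+ j)

    squares : List ℕ → ℕ
    squares ts = sumSeq (square ts) (length ts)

    tails : ℕ → List ℕ → ℕ
    tails m ts = sumSeq (λ j → Nat ts (suc m ℕ.+ j)) (length ts ∸ m)

    expo-sum : ∀ m ts → squares ts ℕ.+ tails m ts ≡ expo m ts
    expo-sum zero    []       = ≡.refl
    expo-sum (suc m) []       = ≡.refl
    expo-sum zero    (b ∷ ts) = ≡.trans (≡.cong₂ ℕ._+_ (sumSeq-suc (square (b ∷ ts)) (length ts)) (sumSeq-suc (λ j → Nat (b ∷ ts) (suc j)) (length ts)))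
      (≡.trans (swap (b ℕ.* b) (squares ts) b (tails 0 ts)) (≡.cong (b ℕ.* b ℕ.+ b ℕ.+_) (expo-sum 0 ts)))
      where
      open import Data.Nat.Tactic.RingSolver using (solve-∀)
      swap : ∀ x y b z → (x ℕ.+ y) ℕ.+ (b ℕ.+ z) ≡ x ℕ.+ b ℕ.+ (y ℕ.+ z)
      swap = solve-∀
    expo-sum (suc m) (b ∷ ts) = ≡.trans (≡.cong (ℕ._+ tails m ts) (sumSeq-suc (square (b ∷ ts)) (length ts)))
      (≡.trans (ℕₚ.+-assoc (b ℕ.* b) (squares ts) (tails m ts)) (≡.cong (b ℕ.* b ℕ.+_) (expo-sum m ts)))

    exponent : ℕ → ℕ → List ℕ → ℕ
    exponent m a ts = sumℕ 1 (suc (length ts)) (λ j → Nat (a ∷ ts) j ℕ.* Nat (a ∷ ts) j)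
      ℕ.+ sumℕ (suc (suc m)) (suc (length ts)) (Nat (a ∷ ts))

    total-exponent : ∀ m a ts → exponent m a ts ≡ a ℕ.* a ℕ.+ expo m ts
    total-exponent m a ts = ≡.trans (≡.cong (ℕ._+ tails m ts) (sumSeq-suc (square (a ∷ ts)) (length ts)))
      (≡.trans (ℕₚ.+-assoc (a ℕ.* a) (squares ts) (tails m ts)) (≡.cong (a ℕ.* a ℕ.+_) (expo-sum m ts)))

    -- The valuations -a(a-1) and -a² of the two symbols leave only q^a of q^(2a²); this is the
    -- power s^a in the weight.
    total-val : ∀ a E e → E ≡ a ℕ.* a ℕ.+ e →
      (ℤ.- + (a ℕ.* (a ∸ 1))) ℤ.+ ((ℤ.- + (a ℕ.* a)) ℤ.+ (+ (2 ℕ.* E) ℤ.+ (+ 0 ℤ.+ + 0))) ≡ + (a ℕ.+ 2 ℕ.* e)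
    total-val a .(a ℕ.* a ℕ.+ e) e ≡.refl = ≡.trans (≡.cong (λ z → (ℤ.- + x) ℤ.+ ((ℤ.- + y) ℤ.+ (+ z ℤ.+ (+ 0 ℤ.+ + 0)))) (split a))
      (lemma (+ x) (+ y) (+ (a ℕ.+ 2 ℕ.* e)))
      where
      x = a ℕ.* (a ∸ 1)
      y = a ℕ.* a
      open import Data.Integer.Tactic.RingSolver using (solve-∀)
      lemma : ∀ x y z → (ℤ.- x) ℤ.+ ((ℤ.- y) ℤ.+ ((x ℤ.+ y ℤ.+ z) ℤ.+ (+ 0 ℤ.+ + 0))) ≡ z
      lemma = solve-∀
      split : ∀ a → 2 ℕ.* (a ℕ.* a ℕ.+ e) ≡ a ℕ.* (a ∸ 1) ℕ.+ a ℕ.* a ℕ.+ (a ℕ.+ 2 ℕ.* e)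
      split zero    = ≡.refl
      split (suc N) = poly N e
        where
        open import Data.Nat.Tactic.RingSolver using () renaming (solve-∀ to solveℕ)
        poly : ∀ N e → 2 ℕ.* (suc N ℕ.* suc N ℕ.+ e) ≡ suc N ℕ.* N ℕ.+ suc N ℕ.* suc N ℕ.+ (suc N ℕ.+ 2 ℕ.* e)
        poly = solveℕ

  summand-is : ∀ m a ts → Is (summand (suc (suc (length ts))) (suc m) (a ∷ ts)) (+ (a ℕ.+ 2 ℕ.* expo m ts))
    (evenP⁻ a A.* (oddP a A.* (A.1# A.* ((A.1# A.+ q ^ᴬ (2 ℕ.* Nat (a ∷ ts) (suc m))) A.* recips a ts))))
  summand-is m a ts = Is-val (total-val a (exponent m a ts) (expo m ts) (total-exponent m a ts))
    (⊗-is (even⁻-is a) (⊗-is (odd-is a) (⊗-is (mono-is (+ (2 ℕ.* exponent m a ts))) (⊗-is (one-plus-is (2 ℕ.* Nat (a ∷ ts) (suc m))) (recips-is a ts)))))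

  summand-coeff : w 0 A.* (A.1# A.+ A.1#) A.≈ A.1# → ∀ m a ts → Decreasing a ts → ∀ n →
    coeff (summand (suc (suc (length ts))) (suc m) (a ∷ ts)) (+ n) ≡ tuple-term m (a ∷ ts) n
  summand-coeff half m a ts d n = ≡.trans (coeff-is (summand-is m a ts) n) (tuple-term-closed half m a ts d n)

  summand-[]-coeff : w 0 A.* (A.1# A.+ A.1#) A.≈ A.1# → ∀ n → coeff (summand 1 1 []) (+ n) ≡ A.1# n
  summand-[]-coeff half n = ≡.trans (coeff-is summand-[]-is n) (≡.trans (A.*-identityˡ _ n) (≡.trans (A.*-congˡ {w 0} e n) (half n)))
    where
    summand-[]-is : Is (summand 1 1 []) (+ 0) (w 0 A.* (A.1# A.* (A.1# A.* ((A.1# A.+ A.1#) A.* A.1#))))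
    summand-[]-is = ⊗-is (even⁻-is 0) (⊗-is (mono-is (+ 0)) (⊗-is (mono-is (+ 0)) (⊗-is (one-plus-is 0) (mono-is (+ 0)))))
    e : A.1# A.* (A.1# A.* ((A.1# A.+ A.1#) A.* A.1#)) A.≈ A.1# A.+ A.1#
    e = A.trans (A.*-identityˡ _) (A.trans (A.*-identityˡ _) (A.*-identityʳ (A.1# A.+ A.1#)))

-- Assembly over the rationals

open TruncatedComparison ℚ-ring ½ ≡.refl iq iq-inv using (G; G₀₀; weightᴹ; weightᴹ-step; family; module Comparison; R)
open Summand weightᴹ weightᴹ-step (λ _ → ≡.refl)
module TS = TupleSums ℚ⟦q⟧-ring q iq iq-inv weightᴹ weightᴹ-step
module Lᴬ = ListSums ℚ⟦q⟧-ring
module Lℚ = ListSums ℚ-ring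

half-weight : weightᴹ 0 A.* (A.1# A.+ A.1#) A.≈ A.1#
half-weight = A.trans (A.sym (A.trans (ℚ⟦q⟧.const-* ½ (1ℚ ℚ.+ 1ℚ)) (A.*-congˡ {ℚ⟦q⟧.const ½} (ℚ⟦q⟧.const-+ 1ℚ 1ℚ)))) (ℚ⟦q⟧.const-cong {½ ℚ.* (1ℚ ℚ.+ 1ℚ)} {1ℚ} ≡.refl)

foldr-lsum : ∀ {T : Set} (φ : T → A.Carrier) n xs → foldr ℚ._+_ 0ℚ (map (λ x → φ x n) xs) ≡ Lᴬ.lsum φ xs n
foldr-lsum φ n []       = ≡.refl
foldr-lsum φ n (x ∷ xs) = ≡.cong (φ x n ℚ.+_) (foldr-lsum φ n xs)

rhs≡G : ∀ K m → m ≤ K → ∀ M N → rhsCoeff (suc K) (suc m) M N ≡ G m (K ∸ m) M N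
-- For k = 1 the empty tuple is the only one and contributes to x^0 alone.
rhs≡G zero zero z≤n zero N = ≡.trans (ℚₚ.+-identityʳ (coeff (summand 1 1 []) (+ N))) (≡.trans (summand-[]-coeff half-weight N) (≡.sym (G₀₀ 0 N)))
rhs≡G zero zero z≤n (suc M) N = ≡.sym (G₀₀ (suc M) N)
rhs≡G (suc l) m m≤K M N = ≡.trans (foldr-lsum φ N (decTuples (suc l) M M)) (≡.trans
  (TS.lsum-decTuples-cong (suc l) M M {φ} {TS.tuple-term m} term N)
  (≡.sym (TS.G-coef m (suc l ∸ m) l (ℕₚ.m+[n∸m]≡n m≤K) M N)))
  where
  φ : List ℕ → A.Carrier
  φ ts n = coeff (summand (suc (suc l)) (suc m) ts) (+ n)
  term : ∀ ts → length ts ≡ suc l → Decreasing M ts → φ ts A.≈ TS.tuple-term m ts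
  term (a ∷ ts) ≡.refl (_ ∷ d) = summand-coeff half-weight m a ts d

suc/1 : ∀ n → (+ suc n) / 1 ≡ 1ℚ ℚ.+ (+ n) / 1
suc/1 n = ℚₚ.toℚᵘ-injective (begin
  ℚ.toℚᵘ ((+ suc n) / 1)                       ≈⟨ ℚₚ.toℚᵘ-fromℚᵘ (ℚᵘ.mkℚᵘ (+ suc n) 0) ⟩
  ℚᵘ.mkℚᵘ (+ suc n) 0                          ≈⟨ ℚᵘ.*≡* (≡.cong (ℤ._* + 1) (≡.sym (≡.cong (λ z → + 1 ℤ.+ z) (ℤₚ.*-identityʳ (+ n))))) ⟩
  ℚᵘ.1ℚᵘ ℚᵘ.+ ℚᵘ.mkℚᵘ (+ n) 0                  ≈⟨ ℚᵘₚ.+-congʳ ℚᵘ.1ℚᵘ (ℚₚ.toℚᵘ-fromℚᵘ (ℚᵘ.mkℚᵘ (+ n) 0)) ⟨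
  ℚ.toℚᵘ 1ℚ ℚᵘ.+ ℚ.toℚᵘ ((+ n) / 1)            ≈⟨ ℚₚ.toℚᵘ-homo-+ 1ℚ ((+ n) / 1) ⟨
  ℚ.toℚᵘ (1ℚ ℚ.+ (+ n) / 1)                    ∎)
  where open ℚᵘₚ.≃-Reasoning

count-lsum : ∀ {T : Set} (p : T → Bool) xs →
  (+ length (filter (λ x → p x Bool.≟ true) xs)) / 1 ≡ Lℚ.lsum (λ x → Lℚ.indᶠ (p x)) xs
count-lsum p [] = ≡.refl
count-lsum p (x ∷ xs) with p x
... | true  = ≡.trans (suc/1 (length (filter (λ y → p y Bool.≟ true) xs))) (≡.cong (1ℚ ℚ.+_) (count-lsum p xs))
... | false = ≡.trans (count-lsum p xs) (≡.sym (ℚₚ.+-identityˡ (Lℚ.lsum (λ y → Lℚ.indᶠ (p y)) xs)))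

O≡family : ∀ K i → i ≤ suc K → ∀ m n → (+ O (suc K) i m n) / 1 ≡ family K i m n
O≡family K i i≤k m n = begin
  (+ O k i m n) / 1
    ≡⟨ count-lsum (isCounted k i m) (genOP n n) ⟩
  Lℚ.lsum (λ l → Lℚ.indᶠ (isCounted k i m l)) (genOP n n)
    ≡⟨ Lℚ.lsum-cong (genOP n n) (λ l → ≡.cong Lℚ.indᶠ (if≡∧ ⌊ numParts l ℕ.≟ m ⌋)) ⟩
  Lℚ.lsum φ (genOP n n)
    ≡⟨ Ex.genOP-count-pad k i m n n ⟨
  Lℚ.lsum φ (genOP (n ℕ.+ n) n)
    ≡⟨ ≡.cong (λ z → Lℚ.lsum φ (genOP z n)) double ⟩
  Lℚ.lsum φ (genOP (n ℕ.* 2) n)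
    ≡⟨ Ex.boxSum-coef (n ℕ.* 2) (good k i) m n n≤B ⟨
  C.P (n ℕ.* 2) k i (PowerSeries.X ℚ⟦q⟧-ring) m n
    ≡⟨ proj₂ (Cmp.P≈family n (ℕₚ.m≤m+n (n ℕ.* 2) K) i i≤k) m n n≤2n ⟩
  family K i m n ∎
  where
  open ≡.≡-Reasoning
  k = suc K
  -- At least 2n for the precision of the comparison, and at least K so that the box holds every
  -- admissible number of parts 2.
  B = n ℕ.* 2 ℕ.+ K
  module Ex = Extraction ℚ-ring B
  module Cmp = Comparison B K (ℕₚ.m≤n+m K (n ℕ.* 2))
  module C = BoxSums R (PowerSeries.const ℚ⟦q⟧-ring q) B
  φ : Overpartition → ℚ
  φ l = Lℚ.indᶠ (⌊ numParts l ℕ.≟ m ⌋ ∧ good k i l)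
  double : n ℕ.+ n ≡ n ℕ.* 2
  double = ≡.trans (≡.cong (n ℕ.+_) (≡.sym (ℕₚ.+-identityʳ n))) (ℕₚ.*-comm 2 n)
  n≤2n : n ≤ n ℕ.* 2
  n≤2n = ≡.subst (n ≤_) double (ℕₚ.m≤m+n n n)
  n≤B : n ≤ B
  n≤B = ℕₚ.≤-trans n≤2n (ℕₚ.m≤m+n (n ℕ.* 2) K)
  if≡∧ : ∀ a {b} → (if a then b else false) ≡ a ∧ b
  if≡∧ true  = ≡.refl
  if≡∧ false = ≡.refl

theorem1p9 : (k i : ℕ) → 1 ≤ i → i ≤ k → (m n : ℕ) →
    (+ O k i m n) / 1 ≡ rhsCoeff k i m n
theorem1p9 (suc K) (suc i) _ i≤k m n =
  ≡.trans (O≡family K (suc i) i≤k m n) (≡.sym (rhs≡G K i (ℕₚ.≤-pred i≤k) m n))
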